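{- $\mathrm{ZP}_\tau\mathrm{CL}=\mathrm{ZP}_\tau\mathrm{CL}\mathrm{P}$.
   Context: A catalytic-tape machine has a read-only input tape, a write-only output tape, a read-write work tape of $s$ bits and a read-write catalytic tape of $c$ bits with arbitrary initial content $\tau\in\{0,1\}^c$. $L\in\mathrm{ZP}_\tau\mathrm{CSPACE}[s,c]$ if there is a deterministic such machine with work space $s$ and catalytic space $c$ which on every input $x$ and every $\tau$ halts with exactly $\tau$ on the catalytic tape and outputs either $L(x)$ or a special symbol $\perp$ (never the wrong answer), and for every $x$ it outputs $L(x)$ for at least half of all $\tau\in\{0,1\}^c$. $\mathrm{ZP}_\tau\mathrm{CL}=\bigcup_k\mathrm{ZP}_\tau\mathrm{CSPACE}[k\log n,n^k]$, and $\mathrm{ZP}_\tau\mathrm{CL}\mathrm{P}$ is the subclass where additionally, for the same constant $k$, the machine always halts within $n^k$ steps. -}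

module Defs where

open import Data.Bool using (Bool; true; false; if_then_else_)
open import Data.Nat using (ℕ; zero; suc; _+_; _*_; _^_; _≤_)
open import Data.Nat.Logarithm using (⌈log₂_⌉)
open import Data.Fin using (Fin; zero; suc; inject₁)
open import Data.Vec using (Vec; []; _∷_; replicate; fromList)
open import Data.List using (List; length)
open import Data.List.Relation.Unary.All using (All)
open import Data.List.Relation.Unary.Unique.Propositional using (Unique)
open import Data.Maybe using (Maybe; just; nothing)
open import Data.Product using (Σ; ∃; ∃-syntax; _×_; _,_)
open import Data.Sum using (_⊎_)
open import Relation.Binary.PropositionalEquality using (_≡_)

-- Tapes with end markers.
-- A bounded tape of m cells holds `Vec Bool m`; its head ranges over
-- `Fin (2 + m)`: position 0 is the left end marker, positions 1..m are
-- the cells, position m+1 is the right end marker.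

data Sym : Set where
  bit  : Bool → Sym
  lend : Sym
  rend : Sym

data Move : Set where
  left stay right : Move

readCell : ∀ {m} → Vec Bool m → Fin (suc m) → Sym
readCell []      zero    = rend
readCell (b ∷ v) zero    = bit b
readCell (b ∷ v) (suc i) = readCell v i

readTape : ∀ {m} → Vec Bool m → Fin (suc (suc m)) → Sym
readTape v zero    = lend
readTape v (suc i) = readCell v i

writeCell : ∀ {m} → Vec Bool m → Fin (suc m) → Bool → Vec Bool m
writeCell []      _       _ = []
writeCell (x ∷ v) zero    b = b ∷ v
writeCell (x ∷ v) (suc i) b = x ∷ writeCell v i b

writeTape : ∀ {m} → Vec Bool m → Fin (suc (suc m)) → Bool → Vec Bool m
writeTape v zero    b = v
writeTape v (suc i) b = writeCell v i b

moveL : ∀ {n} → Fin (suc n) → Fin (suc n)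
moveL zero    = zero
moveL (suc i) = inject₁ i

moveR : ∀ {n} → Fin (suc n) → Fin (suc n)
moveR {zero}  zero    = zero
moveR {suc n} zero    = suc zero
moveR {suc n} (suc i) = suc (moveR i)

moveHead : ∀ {n} → Move → Fin (suc n) → Fin (suc n)
moveHead left  i = moveL i
moveHead stay  i = i
moveHead right i = moveR i

data Ans : Set where
  acc rej dunno : Ans

record Action (q : ℕ) : Set where
  field
    next      : Fin q
    workWrite : Bool
    catWrite  : Bool
    inMove    : Move
    workMove  : Move
    catMove   : Move

record Machine : Set where
  field
    q     : ℕ
    start : Fin q
    -- halting states and the single symbol they write on the output tape
    halt  : Fin q → Maybe Ans
    -- transition: state, input symbol, work symbol, catalytic symbol
    δ     : Fin q → Sym → Sym → Sym → Action q

record Config (M : Machine) (n s c : ℕ) : Set where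
  field
    state : Fin (Machine.q M)
    ih    : Fin (suc (suc n))
    wt    : Vec Bool s
    wh    : Fin (suc (suc s))
    ct    : Vec Bool c
    ch    : Fin (suc (suc c))

module _ (M : Machine) {n s c : ℕ} (x : Vec Bool n) where
  open Machine M

  step : Config M n s c → Config M n s c
  step cfg with halt (Config.state cfg)
  ... | just _  = cfg
  ... | nothing =
    let open Config cfg
        a = δ state (readTape x ih) (readTape wt wh) (readTape ct ch)
        open Action a
    in record
      { state = next
      ; ih    = moveHead inMove ih
      ; wt    = writeTape wt wh workWrite
      ; wh    = moveHead workMove wh
      ; ct    = writeTape ct ch catWrite
      ; ch    = moveHead catMove ch
      }

  run : ℕ → Config M n s c → Config M n s c
  run zero    cfg = cfg
  run (suc t) cfg = run t (step cfg)

init : (M : Machine) {n s c : ℕ} → Vec Bool c → Config M n s c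
init M τ = record
  { state = Machine.start M ; ih = zero ; wt = replicate _ false ; wh = zero
  ; ct = τ ; ch = zero }

HaltsAt : (M : Machine) (s c : ℕ → ℕ) (x : List Bool)
          → Vec Bool (c (length x)) → ℕ → Ans → Set
HaltsAt M s c x τ t a =
  let cfg = run M {length x} {s (length x)} {c (length x)} (fromList x) t (init M τ)
  in Machine.halt M (Config.state cfg) ≡ just a

HaltsRestoring : (M : Machine) (s c : ℕ → ℕ) (x : List Bool)
                 → Vec Bool (c (length x)) → ℕ → Ans → Set
HaltsRestoring M s c x τ t a =
  HaltsAt M s c x τ t a ×
  Config.ct (run M {length x} {s (length x)} {c (length x)} (fromList x) t (init M τ)) ≡ τ

Language : Set
Language = List Bool → Bool

correct : Language → List Bool → Ans
correct L x = if L x then acc else rej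

ZPτCSPACE-machine : Machine → Language → (s c : ℕ → ℕ) → Set
ZPτCSPACE-machine M L s c =
  (∀ (x : List Bool) (τ : Vec Bool (c (length x))) →
     ∃[ t ] ∃[ a ] (HaltsRestoring M s c x τ t a × (a ≡ correct L x ⊎ a ≡ dunno)))
  ×
  -- for at least half of all τ it outputs L(x)
  (∀ (x : List Bool) → ∃[ ts ] (Unique {A = Vec Bool (c (length x))} ts ×
     All (λ τ → ∃[ t ] HaltsAt M s c x τ t (correct L x)) ts ×
     2 ^ c (length x) ≤ 2 * length ts))

TimeBounded : Machine → (s c T : ℕ → ℕ) → Set
TimeBounded M s c T =
  ∀ (x : List Bool) (τ : Vec Bool (c (length x))) →
    ∃[ t ] ∃[ a ] (t ≤ T (length x) × HaltsAt M s c x τ t a)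

logSpace : ℕ → ℕ → ℕ
logSpace k n = k * ⌈log₂ (n + 2) ⌉

poly : ℕ → ℕ → ℕ
poly k n = (n + 2) ^ k

ZPτCL : Language → Set
ZPτCL L = ∃[ k ] ∃[ M ] ZPτCSPACE-machine M L (logSpace k) (poly k)

ZPτCLP : Language → Set
ZPτCLP L = ∃[ k ] ∃[ M ]
  (ZPτCSPACE-machine M L (logSpace k) (poly k) × TimeBounded M (logSpace k) (poly k) (poly k))

{-# OPTIONS --safe #-}
module Submission where

-- Let M decide L with an unrestricted running time.  For a fixed input, the configurations of M form
-- a graph with out-degree at most one.  As M restores its catalytic tape, the components of the
-- start configurations of distinct tapes τ are disjoint trees, so the average size of such a tree is
-- polynomial.  A configuration has boundedly many candidate predecessors, each of which can be tested
-- locally; hence an Euler tour of the component can be followed one dart at a time, forwards and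
-- backwards.  The new machine follows the tour for a polynomial number of steps, notes the answer
-- if the tour meets a halting configuration (there is only one in the component), and then retraces
-- its steps, which restores τ whether or not an answer was found.  Only a small fraction of the τ have
-- tours that are too long, so at least 3/8 of them give the answer; trying two disjoint windows of a
-- longer catalytic tape brings this above 1/2.
--
-- The tour is programmed for a counter machine with seven counters, which are kept in
-- binary, interleaved, on the work tape: the work tape of M becomes a pair of stacks, and the head
-- on the catalytic window is tracked by its distances from the two ends of the window.

-- The catalytic window is itself the memory of the simulation: while the tour runs, τ is
-- overwritten and recorded nowhere else. Every step must therefore be invertible from local
-- information. This is arranged by pairing darts: `flip` exchanges the two ends of an arc and fixes
-- a dart that belongs to no arc, so it is an involution, and the rotation at a vertex is a cyclic
-- shift. Their composite can be undone blindly, and a clock is all that has to be kept. The clock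
-- exceeds eight times the average number of darts per seed, which costs at most 1/8 of the seeds;
-- of the promised 1/2 there remain 3/8. Two windows both fail for at most 25/64 of the tapes. The
-- machine is fixed while the input length varies, so it computes its own parameters: it multiplies
-- by walking over the input, and powers of two come from the wrap-around of registers whose widths
-- the layout tunes. Finally, one constant has to bound work space, catalytic space and time
-- together, although a longer work tape slows down every instruction.

open import Defs
open import Data.Bool using (Bool; true; false; _∧_; if_then_else_; not; _∨_)
open import Data.Nat using (ℕ; zero; suc; _+_; _*_; _^_; _∸_; _≤_; _<_; z≤n; s≤s; NonZero; _%_; _/_; >-nonZero; ⌈_/2⌉)
open import Data.Fin using (Fin; zero; suc; combine; remQuot; join; splitAt; inject₁; toℕ; fromℕ; lower₁; fromℕ<)
open import Data.Fin.Properties using (remQuot-combine; combine-remQuot; splitAt-join; any?; pigeonhole; toℕ-fromℕ; toℕ-inject₁; toℕ<n; lower₁-inject₁′; toℕ-fromℕ<; injective⇒≤; toℕ-injective) renaming (_≟_ to _≟F_)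
open import Data.Vec as Vec using (Vec; []; _∷_; toList; lookup; _[_]≔_; fromList)
open import Data.Product using (_×_; _,_; ∃-syntax; proj₁; proj₂)
open import Data.Sum as Sum using (_⊎_; inj₁; inj₂; [_,_])
open import Data.Unit using (⊤; tt)
open import Data.Nat.Properties
open import Data.Vec.Properties using (toList-injective; length-toList; lookup∘update; lookup∘update′; ∷-injectiveʳ; ∷-injectiveˡ; take++drop≡id; toList∘fromList; toList-replicate; cast-is-id; toList-++)
open import Data.List as List using (List; []; _∷_; _++_; length; _ʳ++_; reverse; replicate; map; filter)
open import Data.List.Properties using (++-assoc; length-++; ʳ++-defn; reverse-involutive; length-reverse; length-replicate; length-map) renaming (≡-dec to List-≡-dec)
open import Data.Empty using (⊥; ⊥-elim)
open import Data.Nat.DivMod using (m≡m%n+[m/n]*n; m%n<n)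
open import Data.Maybe using (Maybe; just; nothing)
open import Data.Maybe.Properties using (just-injective)
open import Data.Product.Properties using (≡-dec)
import Data.Bool.Properties as Boolₚ
open import Data.Nat.Tactic.RingSolver using (solve-∀)
open import Data.List.Relation.Unary.All as All using (All; []; _∷_)
import Data.List.Relation.Unary.All.Properties as Allₚ
open import Data.List.Relation.Unary.Any using (here; index)
open import Data.List.Relation.Unary.Any.Properties using (lookup-index)
open import Data.List.Relation.Unary.AllPairs using ([]; _∷_)
open import Data.List.Relation.Unary.Unique.Propositional using (Unique)
open import Data.List.Relation.Unary.Unique.Propositional.Properties as Uniqueₚ using (map⁺; ++⁺)
open import Data.List.Membership.Propositional using (_∈_)
open import Data.List.Membership.Propositional.Properties using (∈-map⁺; ∈-map⁻; ∈-++⁺ˡ; ∈-++⁺ʳ; ∈-lookup)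
open import Data.Nat.Induction using (<-wellFounded)
open import Data.Nat.Logarithm using (⌈log₂_⌉; ⌈log₂⌉-mono-≤; ⌈log₂2^n⌉≡n)
open import Data.Nat.Logarithm.Core using (⌈log2⌉)
open import Relation.Nullary.Decidable using (map′; dec-true; dec-false)
open import Relation.Binary using (DecidableEquality; Tri; tri<; tri≈; tri>)
open import Relation.Binary.PropositionalEquality hiding ([_])
open import Relation.Nullary using (¬_; Dec; yes; no; contradiction; does; ¬?)
open import Function using (_∘_; id; it)
open import Induction.WellFounded using (Acc; acc)

-- Finite types

-- A retract of Fin size; `to` need not be onto.
record Finite (A : Set) : Set where
  no-eta-equality
  field
    size    : ℕ
    to      : A → Fin size
    from    : Fin size → A
    from-to : ∀ a → from (to a) ≡ a

open Finite

retract : ∀ {A B : Set} → Finite B → (f : A → B) (g : B → A) → (∀ a → g (f a) ≡ a) → Finite A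
retract F f g gf = record
  { size = size F ; to = λ a → to F (f a) ; from = λ i → g (from F i)
  ; from-to = λ a → trans (cong g (from-to F (f a))) (gf a) }

instance
  fin-Fin : ∀ {n} → Finite (Fin n)
  fin-Fin {n} = record { size = n ; to = λ i → i ; from = λ i → i ; from-to = λ _ → refl }

  fin-⊤ : Finite ⊤
  fin-⊤ = record { size = 1 ; to = λ _ → zero ; from = λ _ → tt ; from-to = λ _ → refl }

-- Opaque, because comparing two programs would otherwise unfold the encodings of their states.
opaque
  instance
    fin-× : ∀ {A B : Set} ⦃ _ : Finite A ⦄ ⦃ _ : Finite B ⦄ → Finite (A × B)
    fin-× ⦃ F ⦄ ⦃ G ⦄ = record
      { size = size F * size G
      ; to = λ (a , b) → combine (to F a) (to G b)
      ; from = λ i → let j , k = remQuot (size G) i in from F j , from G k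
      ; from-to = λ (a , b) → trans (cong (λ (j , k) → from F j , from G k) (remQuot-combine (to F a) (to G b)))
                                    (cong₂ _,_ (from-to F a) (from-to G b)) }

    fin-⊎ : ∀ {A B : Set} ⦃ _ : Finite A ⦄ ⦃ _ : Finite B ⦄ → Finite (A ⊎ B)
    fin-⊎ {A} {B} ⦃ F ⦄ ⦃ G ⦄ = record
      { size = size F + size G
      ; to = λ s → join (size F) (size G) (Sum.map (to F) (to G) s)
      ; from = λ i → Sum.map (from F) (from G) (splitAt (size F) i)
      ; from-to = λ s → trans (cong (Sum.map (from F) (from G)) (splitAt-join (size F) (size G) (Sum.map (to F) (to G) s))) (lemma s) }
      where
      lemma : ∀ s → Sum.map (from F) (from G) (Sum.map (to F) (to G) s) ≡ s
      lemma (inj₁ a) = cong inj₁ (from-to F a)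
      lemma (inj₂ b) = cong inj₂ (from-to G b)

  size-× : ∀ {A B : Set} (F : Finite A) (G : Finite B) → size (fin-× ⦃ F ⦄ ⦃ G ⦄) ≡ size F * size G
  size-× F G = refl

  -- `Finite` only provides a retraction. For the labels of arcs a bijection is required, because
  -- soundness of `undo` must give back the very label that was tried.
  to-from-× : ∀ {A B : Set} (F : Finite A) (G : Finite B) →
              (∀ i → to F (from F i) ≡ i) → (∀ i → to G (from G i) ≡ i) →
              ∀ i → to (fin-× ⦃ F ⦄ ⦃ G ⦄) (from (fin-× ⦃ F ⦄ ⦃ G ⦄) i) ≡ i
  to-from-× F G f g i = let j , k = remQuot {size F} (size G) i in
    trans (cong₂ combine (f j) (g k)) (combine-remQuot {size F} (size G) i)

instance
  fin-Bool : Finite Bool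
  fin-Bool = record
    { size = 2
    ; to = λ { false → zero ; true → suc zero }
    ; from = λ { zero → false ; (suc _) → true }
    ; from-to = λ { false → refl ; true → refl } }

  fin-Sym : Finite Sym
  fin-Sym = record
    { size = 4
    ; to = λ { lend → zero ; rend → suc zero ; (bit false) → suc (suc zero) ; (bit true) → suc (suc (suc zero)) }
    ; from = λ { zero → lend ; (suc zero) → rend ; (suc (suc zero)) → bit false ; (suc (suc (suc _))) → bit true }
    ; from-to = λ { lend → refl ; rend → refl ; (bit false) → refl ; (bit true) → refl } }

  fin-Move : Finite Move
  fin-Move = record
    { size = 3
    ; to = λ { left → zero ; stay → suc zero ; right → suc (suc zero) }
    ; from = λ { zero → left ; (suc zero) → stay ; (suc (suc _)) → right }
    ; from-to = λ { left → refl ; stay → refl ; right → refl } }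

  fin-Ans : Finite Ans
  fin-Ans = record
    { size = 3
    ; to = λ { acc → zero ; rej → suc zero ; dunno → suc (suc zero) }
    ; from = λ { zero → acc ; (suc zero) → rej ; (suc (suc _)) → dunno }
    ; from-to = λ { acc → refl ; rej → refl ; dunno → refl } }

  fin-Vec : ∀ {m} → Finite (Vec Bool m)
  fin-Vec {zero}  = record { size = 1 ; to = λ _ → zero ; from = λ _ → [] ; from-to = λ { [] → refl } }
  fin-Vec {suc m} = retract (fin-× ⦃ fin-Bool ⦄ ⦃ fin-Vec {m} ⦄) (λ { (b ∷ v) → b , v }) (λ (b , v) → b ∷ v) (λ { (b ∷ v) → refl })

size-Vec : ∀ m → size (fin-Vec {m}) ≡ 2 ^ m
size-Vec zero    = refl
size-Vec (suc m) = trans (size-× fin-Bool (fin-Vec {m})) (cong (2 *_) (size-Vec m))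

to-injective : ∀ {A : Set} (F : Finite A) {a b} → to F a ≡ to F b → a ≡ b
to-injective F {a} {b} eq = trans (sym (from-to F a)) (trans (cong (from F) eq) (from-to F b))

finite-≟ : ∀ {A : Set} → Finite A → DecidableEquality A
finite-≟ F a b = map′ (to-injective F) (cong (to F)) (to F a ≟F to F b)

-- Tapes as zippers

-- The left part is stored reversed and no length is recorded, so vertices can be compared without
-- transports between lengths, and a tape can be viewed as a part of a longer one.
data Zip : Set where
  atL : List Bool → Zip
  at  : List Bool → Bool → List Bool → Zip
  atR : List Bool → Zip

popL popR : List Bool → List Bool → Zip
popL []      r = atL r
popL (b ∷ l) r = at l b r
popR l []      = atR l
popR l (b ∷ r) = at l b r

zread : Zip → Sym
zread (atL _)    = lend
zread (at _ b _) = bit b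
zread (atR _)    = rend

zwrite : Bool → Zip → Zip
zwrite b (at l _ r) = at l b r
zwrite _ z          = z

zmove : Move → Zip → Zip
zmove left  (atL r)    = atL r
zmove left  (at l b r) = popL l (b ∷ r)
zmove left  (atR l)    = popL l []
zmove stay  z          = z
zmove right (atL r)    = popR [] r
zmove right (at l b r) = popR (b ∷ l) r
zmove right (atR l)    = atR l

cells : Zip → List Bool
cells (atL r)    = r
cells (at l b r) = l ʳ++ (b ∷ r)
cells (atR l)    = l ʳ++ []

private
  focus : ∀ {m} → List Bool → Vec Bool m → Fin (suc m) → Zip
  focus l []      zero    = atR l
  focus l (b ∷ v) zero    = at l b (toList v)
  focus l (b ∷ v) (suc i) = focus (b ∷ l) v i

zip : ∀ {m} → Vec Bool m → Fin (suc (suc m)) → Zip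
zip v zero    = atL (toList v)
zip v (suc i) = focus [] v i

private
  read-focus : ∀ {m} l (v : Vec Bool m) i → zread (focus l v i) ≡ readCell v i
  read-focus l []      zero    = refl
  read-focus l (b ∷ v) zero    = refl
  read-focus l (b ∷ v) (suc i) = read-focus (b ∷ l) v i

  write-focus : ∀ {m} l (v : Vec Bool m) i b → zwrite b (focus l v i) ≡ focus l (writeCell v i b) i
  write-focus l []      zero    b = refl
  write-focus l (x ∷ v) zero    b = refl
  write-focus l (x ∷ v) (suc i) b = write-focus (x ∷ l) v i b

  right-focus : ∀ {m} l (v : Vec Bool m) i → zmove right (focus l v i) ≡ focus l v (moveR i)
  right-focus l []            zero    = refl
  right-focus l (b ∷ [])      zero    = refl
  right-focus l (b ∷ (x ∷ v)) zero    = refl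
  right-focus l (b ∷ v)       (suc i) = right-focus (b ∷ l) v i

  left-focus₀ : ∀ {m} l (v : Vec Bool m) → zmove left (focus l v zero) ≡ popL l (toList v)
  left-focus₀ l []      = refl
  left-focus₀ l (b ∷ v) = refl

  left-focus : ∀ {m} l (v : Vec Bool m) i → zmove left (focus l v (suc i)) ≡ focus l v (inject₁ i)
  left-focus l (b ∷ v) zero    = left-focus₀ (b ∷ l) v
  left-focus l (b ∷ v) (suc i) = left-focus (b ∷ l) v i

  cells-focus : ∀ {m} l (v : Vec Bool m) i → cells (focus l v i) ≡ l ʳ++ toList v
  cells-focus l []      zero    = refl
  cells-focus l (b ∷ v) zero    = refl
  cells-focus l (b ∷ v) (suc i) = cells-focus (b ∷ l) v i

zread-zip : ∀ {m} (v : Vec Bool m) i → zread (zip v i) ≡ readTape v i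
zread-zip v zero    = refl
zread-zip v (suc i) = read-focus [] v i

zwrite-zip : ∀ {m} (v : Vec Bool m) i b → zwrite b (zip v i) ≡ zip (writeTape v i b) i
zwrite-zip v zero    b = refl
zwrite-zip v (suc i) b = write-focus [] v i b

zmove-zip : ∀ d {m} (v : Vec Bool m) i → zmove d (zip v i) ≡ zip v (moveHead d i)
zmove-zip left  v       zero          = refl
zmove-zip left  v       (suc zero)    = left-focus₀ [] v
zmove-zip left  (b ∷ v) (suc (suc i)) = left-focus [] (b ∷ v) i
zmove-zip stay  v       i             = refl
zmove-zip right []      zero          = refl
zmove-zip right (b ∷ v) zero          = refl
zmove-zip right v       (suc i)       = right-focus [] v i

cells-zip : ∀ {m} (v : Vec Bool m) i → cells (zip v i) ≡ toList v
cells-zip v zero    = refl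
cells-zip v (suc i) = cells-focus [] v i

zact : Bool → Move → Zip → Zip
zact b d z = zmove d (zwrite b z)

zact-zip : ∀ b d {m} (v : Vec Bool m) i →
           zact b d (zip v i) ≡ zip (writeTape v i b) (moveHead d i)
zact-zip b d v i = trans (cong (zmove d) (zwrite-zip v i b)) (zmove-zip d (writeTape v i b) i)

bitOf : Sym → Bool
bitOf (bit b) = b
bitOf lend    = false
bitOf rend    = false

zwrite-same : ∀ z → zwrite (bitOf (zread z)) z ≡ z
zwrite-same (atL _)    = refl
zwrite-same (at _ _ _) = refl
zwrite-same (atR _)    = refl

-- `window pre post z` is the tape whose cells are pre reversed, then those of z, then post.
-- When z is at an end marker, the head of the large tape is just outside the window.
window : List Bool → List Bool → Zip → Zip
window pre post (atL r)    = popL pre (r ++ post)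
window pre post (at l b r) = at (l ++ pre) b (r ++ post)
window pre post (atR l)    = popR (l ++ pre) post

right-popL : ∀ l r → zmove right (popL l r) ≡ popR l r
right-popL []      r = refl
right-popL (b ∷ l) r = refl

left-popR : ∀ l r → zmove left (popR l r) ≡ popL l r
left-popR l []      = refl
left-popR l (b ∷ r) = refl

window-popR : ∀ pre post l r → window pre post (popR l r) ≡ popR (l ++ pre) (r ++ post)
window-popR pre post l []      = refl
window-popR pre post l (b ∷ r) = refl

window-popL : ∀ pre post l r → window pre post (popL l r) ≡ popL (l ++ pre) (r ++ post)
window-popL pre post []      r = refl
window-popL pre post (b ∷ l) r = refl

-- At its right end marker the simulated head is blocked, whereas the head of the large tape would
-- run on into `post`. The simulating program has to catch this case itself.
window-right : ∀ pre post z → zread z ≢ rend →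
               zmove right (window pre post z) ≡ window pre post (zmove right z)
window-right pre post (atL r)    _ = trans (right-popL pre (r ++ post)) (sym (window-popR pre post [] r))
window-right pre post (at l b r) _ = sym (window-popR pre post (b ∷ l) r)
window-right pre post (atR l)    p with () ← p refl

window-left : ∀ pre post z → zread z ≢ lend →
              zmove left (window pre post z) ≡ window pre post (zmove left z)
window-left pre post (atL r)    p with () ← p refl
window-left pre post (at l b r) _ = sym (window-popL pre post l (b ∷ r))
window-left pre post (atR l)    _ = trans (left-popR (l ++ pre) post) (sym (window-popL pre post l []))

cells-popL : ∀ l r → cells (popL l r) ≡ l ʳ++ r
cells-popL []      r = refl
cells-popL (b ∷ l) r = refl

-- Euler tours of functional graphs

-- Cyclic predecessor and successor. They rotate the darts at a vertex, and `down` also steps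
-- through the offsets within a period of the work tape.
down up : ∀ {k} → Fin (suc k) → Fin (suc k)
down zero    = fromℕ _
down (suc i) = inject₁ i
up {k} i with k ≟ toℕ i
... | yes _   = zero
... | no  k≢i = suc (lower₁ i k≢i)

up-down : ∀ {k} (i : Fin (suc k)) → up (down i) ≡ i
up-down {k} zero with k ≟ toℕ (fromℕ k)
... | yes _ = refl
... | no  p = contradiction (sym (toℕ-fromℕ k)) p
up-down {k} (suc i) with k ≟ toℕ (inject₁ i)
... | yes p = contradiction (trans p (toℕ-inject₁ i)) (≢-sym (<⇒≢ (toℕ<n i)))
... | no  p = cong suc (lower₁-inject₁′ i p)

iter : ∀ {A : Set} → (A → A) → ℕ → A → A
iter f zero    x = x
iter f (suc i) x = f (iter f i x)

iter-+ : ∀ {A : Set} (f : A → A) i j x → iter f (i + j) x ≡ iter f i (iter f j x)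
iter-+ f zero    j x = refl
iter-+ f (suc i) j x = cong f (iter-+ f i j x)

iter-period : ∀ {A : Set} (f : A → A) p x → iter f p x ≡ x → ∀ i → iter f (i * p) x ≡ x
iter-period f p x eq zero    = refl
iter-period f p x eq (suc i) =
  trans (iter-+ f p (i * p) x) (trans (cong (iter f p) (iter-period f p x eq i)) eq)

-- Invertibility strips the common applications of `f`, so the orbit returns to `x` itself and not
-- merely to a later point. The bound on the period is used in the pigeonhole arguments.
iter-collision : ∀ {A : Set} (f g : A → A) → (∀ x → g (f x) ≡ x) →
                 ∀ {i j} x → i < j → iter f i x ≡ iter f j x → ∃[ p ] (suc p ≤ j × iter f (suc p) x ≡ x)
iter-collision f g gf {zero}  {suc j} x _         eq = j , ≤-refl , sym eq
iter-collision f g gf {suc i} {suc j} x (s≤s i<j) eq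
  with p , p≤j , eq′ ← iter-collision f g gf {i} {j} x i<j
         (trans (sym (gf _)) (trans (cong g eq) (gf _)))
  = p , m≤n⇒m≤1+n p≤j , eq′

-- An arc u → v is recovered from v and the label desc u.  `out` is the dart of the arc leaving
-- a vertex, `inn d` that of the arc with label d entering it.
module Tour (V : Set) (_≟V_ : DecidableEquality V) (K : ℕ)
            (step : V → Maybe V) (desc : V → Fin K) (undo : Fin K → V → Maybe V)
            (undo-complete : ∀ {u v} → step u ≡ just v → undo (desc u) v ≡ just u)
            (undo-sound : ∀ {d u v} → undo d v ≡ just u → step u ≡ just v × desc u ≡ d) where

  pattern out   = zero
  pattern inn d = suc d

  data _↝[_]_ : V → ℕ → V → Set where
    here : ∀ {v} → v ↝[ zero ] v
    next : ∀ {u v w t} → step u ≡ just v → v ↝[ t ] w → u ↝[ suc t ] w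

  ↝-trans : ∀ {u v w s t} → u ↝[ s ] v → v ↝[ t ] w → u ↝[ s + t ] w
  ↝-trans here       q = q
  ↝-trans (next e p) q = next e (↝-trans p q)

  -- Out-degree at most one makes walks deterministic. That the lengths agree as well excludes
  -- cycles: going round a cycle would reach the same end with a second length.
  ↝-unique : ∀ {u v w s t} → u ↝[ s ] v → u ↝[ t ] w → step v ≡ nothing → step w ≡ nothing →
             v ≡ w × s ≡ t
  ↝-unique here       here        _  _  = refl , refl
  ↝-unique here       (next e _)  hv _  with () ← trans (sym e) hv
  ↝-unique (next e _) here        _  hw with () ← trans (sym e) hw
  ↝-unique (next e p) (next e′ q) hv hw with refl ← just-injective (trans (sym e) e′)
    with refl , refl ← ↝-unique p q hv hw = refl , refl

  Dart : Set
  Dart = V × Fin (suc K)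

  -- Halting vertices and failed candidate labels give darts that are their own partners. This keeps
  -- the map total and an involution without knowing the true degree of a vertex.
  flip : Dart → Dart
  flip (v , out) with step v
  ... | just w  = w , inn (desc v)
  ... | nothing = v , out
  flip (v , inn d) with undo d v
  ... | just u  = u , out
  ... | nothing = v , inn d

  flip-out-just : ∀ {v w} → step v ≡ just w → flip (v , out) ≡ (w , inn (desc v))
  flip-out-just eq rewrite eq = refl

  flip-out-nothing : ∀ {v} → step v ≡ nothing → flip (v , out) ≡ (v , out)
  flip-out-nothing eq rewrite eq = refl

  flip-inn-just : ∀ {d u v} → undo d v ≡ just u → flip (v , inn d) ≡ (u , out)
  flip-inn-just eq rewrite eq = refl

  flip-inn-nothing : ∀ {d v} → undo d v ≡ nothing → flip (v , inn d) ≡ (v , inn d)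
  flip-inn-nothing eq rewrite eq = refl

  flip-flip : ∀ x → flip (flip x) ≡ x
  flip-flip (v , out) with step v in eq
  ... | just w  rewrite undo-complete eq = refl
  ... | nothing rewrite eq = refl
  flip-flip (v , inn d) with undo d v in eq
  ... | nothing rewrite eq = refl
  ... | just u with st , refl ← undo-sound eq rewrite st = refl

  turn unturn : Dart → Dart
  turn   (v , e) = v , down e
  unturn (v , e) = v , up e

  -- The walk around a tree drawn in the plane: cross the arc, then turn to the neighbouring dart at
  -- the new vertex.
  fwd bwd : Dart → Dart
  fwd x = turn (flip x)
  bwd x = flip (unturn x)

  bwd-fwd : ∀ x → bwd (fwd x) ≡ x
  bwd-fwd x = trans (cong (λ e → flip (proj₁ (flip x) , e)) (up-down (proj₂ (flip x)))) (flip-flip x)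

  fwd-injective : ∀ {x y} → fwd x ≡ fwd y → x ≡ y
  fwd-injective eq = trans (sym (bwd-fwd _)) (trans (cong bwd eq) (bwd-fwd _))

  -- Crossing an arc forwards shortens the path to `h`, crossing it backwards lengthens it. Only the
  -- dart `(h , out)` can leave the ancestors of `h`; the hypothesis covers both the case that `h`
  -- halts and the case that this dart is avoided.
  flip-leads : ∀ {h} x → (x ≡ (h , out) → step h ≡ nothing) →
               ∃[ t ] proj₁ x ↝[ t ] h → ∃[ t ] proj₁ (flip x) ↝[ t ] h
  flip-leads (v , out) stuck (t , p) with step v in eq
  ... | nothing = t , p
  ... | just w with p
  ...   | here      with () ← trans (sym eq) (stuck refl)
  ...   | next e p′ with refl ← just-injective (trans (sym e) eq) = _ , p′
  flip-leads (v , inn d) _ (t , p) with undo d v in eq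
  ... | nothing = t , p
  ... | just u  = _ , next (proj₁ (undo-sound eq)) p

  iter-leads : ∀ {h} → step h ≡ nothing → ∀ x → ∃[ t ] proj₁ x ↝[ t ] h →
               ∀ i → ∃[ t ] proj₁ (iter fwd i x) ↝[ t ] h
  iter-leads hh x p zero    = p
  iter-leads hh x p (suc i) = flip-leads (iter fwd i x) (λ _ → hh) (iter-leads hh x p i)

  module _ (B : ℕ) (decode : Fin B → V) where

    -- The vertex type is infinite, since zippers have any length. Finiteness comes from an
    -- enumeration that covers a set closed under `step` and `undo`.
    Valid : V → Set
    Valid v = ∃[ i ] decode i ≡ v

    decodeDart : Fin (B * suc K) → Dart
    decodeDart j = let i , e = remQuot (suc K) j in decode i , e

    encodeDart : ∀ x → Valid (proj₁ x) → ∃[ j ] decodeDart j ≡ x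
    encodeDart (v , e) (i , refl) = combine i e , cong (λ (i , e) → decode i , e) (remQuot-combine i e)

    module Reach (valid-step : ∀ {v w} → step v ≡ just w → Valid v → Valid w)
                 (valid-undo : ∀ {d v w} → undo d v ≡ just w → Valid v → Valid w) where

      flip-valid : ∀ x → Valid (proj₁ x) → Valid (proj₁ (flip x))
      flip-valid (v , out) p with step v in eq
      ... | just w  = valid-step eq p
      ... | nothing = p
      flip-valid (v , inn d) p with undo d v in eq
      ... | just u  = valid-undo eq p
      ... | nothing = p

      iter-valid : ∀ x → Valid (proj₁ x) → ∀ i → Valid (proj₁ (iter fwd i x))
      iter-valid x p zero    = p
      iter-valid x p (suc i) = flip-valid (iter fwd i x) (iter-valid x p i)

      _⇝_ : Dart → Dart → Set
      x ⇝ y = ∃[ i ] iter fwd i x ≡ y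

      ⇝-trans : ∀ {x y z} → x ⇝ y → y ⇝ z → x ⇝ z
      ⇝-trans {x} (i , refl) (j , refl) = j + i , iter-+ fwd j i x

      fwd-out : ∀ {u v} → step u ≡ just v → fwd (u , out) ≡ (v , down (inn (desc u)))
      fwd-out eq rewrite eq = refl

      fwd-inn : ∀ {u v} → step u ≡ just v → fwd (v , inn (desc u)) ≡ (u , down out)
      fwd-inn eq rewrite undo-complete eq = refl

      -- The tour stays among the ancestors of u until it uses the arc leaving u.  If it never
      -- did, it would be periodic and its last dart before u would lie on the successor of u.
      returns : ∀ {u v h t} → step u ≡ just v → u ↝[ t ] h → step h ≡ nothing → Valid u →
                (u , down out) ⇝ (u , out)
      returns {u} {v} {h} {t} eq p hh val
        with any? {n = suc (B * suc K)} (λ i → ≡-dec _≟V_ _≟F_ (iter fwd (toℕ i) (u , down out)) (u , out))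
      ... | yes (i , e) = toℕ i , e
      ... | no none = ⊥-elim absurd
        where
        x = u , down out
        N = B * suc K

        never : ∀ i → i ≤ N → iter fwd i x ≢ (u , out)
        never i i≤N e = none (fromℕ< (s≤s i≤N) , trans (cong (λ i → iter fwd i x) (toℕ-fromℕ< (s≤s i≤N))) e)

        below : ∀ i → i ≤ N → ∃[ t ] proj₁ (iter fwd i x) ↝[ t ] u
        below zero    _   = 0 , here
        below (suc i) i<N = flip-leads (iter fwd i x) (λ e → contradiction e (never i (<⇒≤ i<N))) (below i (<⇒≤ i<N))

        code : ∀ i → ∃[ j ] decodeDart j ≡ iter fwd i x
        code i = encodeDart (iter fwd i x) (iter-valid x val i)

        absurd : ⊥
        absurd with i , j , i<j , e ← pigeonhole (n<1+n N) (λ i → proj₁ (code (toℕ i)))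
          with p′ , p′≤j , per ← iter-collision fwd bwd bwd-fwd x i<j
                 (trans (sym (proj₂ (code (toℕ i)))) (trans (cong decodeDart e) (proj₂ (code (toℕ j)))))
          with s , q ← below p′ (≤-trans (n≤1+n p′) (≤-trans p′≤j (≤-pred (toℕ<n j))))
          with q′ ← subst (λ y → proj₁ y ↝[ s ] u)
                      (fwd-injective {iter fwd p′ x} {v , inn (desc u)} (trans per (sym (fwd-inn eq)))) q
          -- Now `v` leads to `u` and `u` steps to `v`, so the path from `u` to `h` would have two
          -- different lengths.
          = m≢1+n+m t (proj₂ (↝-unique p (next eq (↝-trans q′ p)) hh hh))

      -- An incoming dart is either void and skipped in one step, or it opens an excursion into the
      -- subtree of a child, from which `returns` brings the tour back. So the darts at `v` are met
      -- in decreasing order until `out`. The bound `m` serves as recursion measure, as `inject₁ d`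
      -- is not a subterm.
      descend : ∀ {v h t} m (e : Fin (suc K)) → toℕ e ≤ m → v ↝[ t ] h → step h ≡ nothing → Valid v →
                (v , e) ⇝ (v , out)
      descend m       out     _         p hh val = 0 , refl
      descend {v} (suc m) (inn d) (s≤s d≤m) p hh val =
        ⇝-trans ahead (descend m (inject₁ d) (subst (_≤ m) (sym (toℕ-inject₁ d)) d≤m) p hh val)
        where
        ahead : (v , inn d) ⇝ (v , inject₁ d)
        ahead with undo d v in eq
        ... | nothing = 1 , lem where
          lem : fwd (v , inn d) ≡ (v , inject₁ d)
          lem rewrite eq = refl
        ... | just u with st , refl ← undo-sound eq =
          ⇝-trans (1 , fwd-inn st) (⇝-trans (returns st (next st p) hh (valid-undo eq val)) (1 , fwd-out st))

      reaches : ∀ {v h t} e → v ↝[ t ] h → step h ≡ nothing → Valid v → (v , e) ⇝ (h , out)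
      reaches e here        hh val = descend _ e ≤-refl here hh val
      reaches e (next st p) hh val =
        ⇝-trans (descend _ e ≤-refl (next st p) hh val)
          (⇝-trans (1 , fwd-out st) (reaches _ p hh (valid-step st val)))

      -- A repetition before `T` would make the orbit periodic with a period below `T`. The dart at
      -- `h`, which is reached at some time, would then already be met within the first period.
      orbit-injective : ∀ {v h t} e T → v ↝[ t ] h → step h ≡ nothing → Valid v →
        (∀ i → i < T → step (proj₁ (iter fwd i (v , e))) ≢ nothing) →
        ∀ {i j} → i < j → j < T → iter fwd i (v , e) ≢ iter fwd j (v , e)
      orbit-injective {v} {h} e T p hh val never {i} {j} i<j j<T eq
        with q , q<j , per ← iter-collision fwd bwd bwd-fwd (v , e) i<j eq
        with m , hit ← reaches e p hh val
        = never r (<-≤-trans (m%n<n m (suc q)) (≤-trans q<j (<⇒≤ j<T)))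
            (subst (λ y → step (proj₁ y) ≡ nothing) (sym (trans back hit)) hh)
        where
        r = m % suc q
        back : iter fwd r (v , e) ≡ iter fwd m (v , e)
        back = sym (begin
          iter fwd m (v , e)                                 ≡⟨ cong (λ a → iter fwd a (v , e)) (m≡m%n+[m/n]*n m (suc q)) ⟩
          iter fwd (r + m / suc q * suc q) (v , e)           ≡⟨ iter-+ fwd r _ _ ⟩
          iter fwd r (iter fwd (m / suc q * suc q) (v , e))  ≡⟨ cong (iter fwd r) (iter-period fwd (suc q) (v , e) per (m / suc q)) ⟩
          iter fwd r (v , e)                                 ∎)
          where open ≡-Reasoning

-- Undoing a machine step

_≟S_ : DecidableEquality Sym
_≟S_ = finite-≟ fin-Sym

_≟Z_ : DecidableEquality Zip
a ≟Z b = map′ (λ eq → trans (sym (unkey-key a)) (trans (cong unkey eq) (unkey-key b))) (cong key)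
  (≡-dec _≟S_ (≡-dec (List-≡-dec Boolₚ._≟_) (List-≡-dec Boolₚ._≟_)) (key a) (key b))
  where
  key : Zip → Sym × List Bool × List Bool
  key (atL r)    = lend , [] , r
  key (at l b r) = bit b , l , r
  key (atR l)    = rend , l , []
  unkey : Sym × List Bool × List Bool → Zip
  unkey (bit b , l , r) = at l b r
  unkey (lend  , _ , r) = atL r
  unkey (rend  , l , _) = atR l
  unkey-key : ∀ z → unkey (key z) ≡ z
  unkey-key (atL _)    = refl
  unkey-key (at _ _ _) = refl
  unkey-key (atR _)    = refl

inv : Move → Move
inv left  = right
inv stay  = stay
inv right = left

-- The move actually performed: end markers block the head.
eff : Move → Sym → Move
eff left  lend = stay
eff right rend = stay
eff m     _    = m

free : Move → Sym → Bool
free left  lend = false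
free right rend = false
free _     _    = true

zmove-eff : ∀ m z → zmove (eff m (zread z)) z ≡ zmove m z
zmove-eff left  (atL _)    = refl
zmove-eff left  (at _ _ _) = refl
zmove-eff left  (atR _)    = refl
zmove-eff stay  z          = refl
zmove-eff right (atL _)    = refl
zmove-eff right (at _ _ _) = refl
zmove-eff right (atR _)    = refl

free-eff : ∀ m s → free (eff m s) s ≡ true
free-eff left  (bit _) = refl
free-eff left  lend    = refl
free-eff left  rend    = refl
free-eff stay  _       = refl
free-eff right (bit _) = refl
free-eff right lend    = refl
free-eff right rend    = refl

zmove-inv : ∀ m z → free m (zread z) ≡ true → zmove (inv m) (zmove m z) ≡ z
zmove-inv left  (at [] b r)      _ = refl
zmove-inv left  (at (x ∷ l) b r) _ = refl
zmove-inv left  (atR [])         _ = refl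
zmove-inv left  (atR (x ∷ l))    _ = refl
zmove-inv stay  z                _ = refl
zmove-inv right (atL [])         _ = refl
zmove-inv right (atL (x ∷ r))    _ = refl
zmove-inv right (at l b [])      _ = refl
zmove-inv right (at l b (x ∷ r)) _ = refl

free-inv : ∀ m z → free m (zread z) ≡ true → free (inv m) (zread (zmove m z)) ≡ true
free-inv left  (at [] b r)      _ = refl
free-inv left  (at (x ∷ l) b r) _ = refl
free-inv left  (atR [])         _ = refl
free-inv left  (atR (x ∷ l))    _ = refl
free-inv stay  z                _ = refl
free-inv right (atL [])         _ = refl
free-inv right (atL (x ∷ r))    _ = refl
free-inv right (at l b [])      _ = refl
free-inv right (at l b (x ∷ r)) _ = refl

inv-inv : ∀ m → inv (inv m) ≡ m
inv-inv left  = refl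
inv-inv stay  = refl
inv-inv right = refl

written : Bool → Sym → Sym
written w (bit _) = bit w
written w lend    = lend
written w rend    = rend

written-bitOf : ∀ s → written (bitOf s) s ≡ s
written-bitOf (bit _) = refl
written-bitOf lend    = refl
written-bitOf rend    = refl

zread-zwrite : ∀ w z → zread (zwrite w z) ≡ written w (zread z)
zread-zwrite w (atL _)    = refl
zread-zwrite w (at _ _ _) = refl
zread-zwrite w (atR _)    = refl

eff-written : ∀ m w s → eff m (written w s) ≡ eff m s
eff-written left  w (bit _) = refl
eff-written left  w lend    = refl
eff-written left  w rend    = refl
eff-written stay  w _       = refl
eff-written right w (bit _) = refl
eff-written right w lend    = refl
eff-written right w rend    = refl

-- The guessed symbol `s` supplies what the step destroyed: the overwritten bit, and whether an end
-- marker blocked the move.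
unact : Bool → Move → Sym → Zip → Zip
unact w m s z = zwrite (bitOf s) (zmove (inv (eff m s)) z)

-- The first two conclusions are the tests that validate a guess. They look only at the symbol under
-- the head, before and after moving back, so a program with finite control can perform them.
unact-complete : ∀ w m z → let s = zread z ; z′ = zact w m z in
  free (inv (eff m s)) (zread z′) ≡ true ×
  zread (zmove (inv (eff m s)) z′) ≡ written w s ×
  unact w m s z′ ≡ z
unact-complete w m z = subst (λ a → free (inv e) (zread a) ≡ true) eq (free-inv e z₁ fr)
                     , trans (cong zread back) (zread-zwrite w z)
                     , trans (cong (zwrite (bitOf (zread z))) back) (rewrite-same z)
  where
  e  = eff m (zread z)
  z₁ = zwrite w z
  e≡ : eff m (zread z₁) ≡ e
  e≡ = trans (cong (eff m) (zread-zwrite w z)) (eff-written m w (zread z))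
  eq : zmove e z₁ ≡ zmove m z₁
  eq = trans (cong (λ e → zmove e z₁) (sym e≡)) (zmove-eff m z₁)
  fr : free e (zread z₁) ≡ true
  fr = subst (λ e → free e (zread z₁) ≡ true) e≡ (free-eff m (zread z₁))
  back : zmove (inv e) (zmove m z₁) ≡ z₁
  back = trans (cong (zmove (inv e)) (sym eq)) (zmove-inv e z₁ fr)
  rewrite-same : ∀ z → zwrite (bitOf (zread z)) (zwrite w z) ≡ z
  rewrite-same (atL _)    = refl
  rewrite-same (at _ _ _) = refl
  rewrite-same (atR _)    = refl

unact-sound : ∀ w m s z′ → let z₁ = zmove (inv (eff m s)) z′ in
  free (inv (eff m s)) (zread z′) ≡ true → zread z₁ ≡ written w s →
  zread (unact w m s z′) ≡ s × zact w m (unact w m s z′) ≡ z′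
unact-sound w m s z′ fr rd = rd′ , trans (cong (zmove m) (wr s z₁ rd)) (trans (sym mv) back)
  where
  e  = eff m s
  z₁ = zmove (inv e) z′
  rd′ : zread (zwrite (bitOf s) z₁) ≡ s
  rd′ = trans (zread-zwrite (bitOf s) z₁) (trans (cong (written (bitOf s)) rd) (ww s))
    where
    ww : ∀ s → written (bitOf s) (written w s) ≡ s
    ww (bit _) = refl
    ww lend    = refl
    ww rend    = refl
  wr : ∀ s z → zread z ≡ written w s → zwrite w (zwrite (bitOf s) z) ≡ z
  wr s       (atL _)    eq = refl
  wr s       (atR _)    eq = refl
  wr (bit _) (at l b r) refl = refl
  mv : zmove e z₁ ≡ zmove m z₁
  mv = trans (cong (λ e → zmove e z₁) (sym (trans (cong (eff m) rd) (eff-written m w s)))) (zmove-eff m z₁)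
  back : zmove e z₁ ≡ z′
  back = trans (cong (λ d → zmove d z₁) (sym (inv-inv e))) (zmove-inv (inv e) z′ fr)

Syms : Set
Syms = Sym × Sym × Sym

Tapes : Set
Tapes = Zip × Zip × Zip

syms : Tapes → Syms
syms (i , w , c) = zread i , zread w , zread c

-- Input move, work bit and move, catalytic bit and move.
TAct : Set
TAct = Move × (Bool × Move) × (Bool × Move)

tact : TAct → Tapes → Tapes
tact (mi , (bw , mw) , (bc , mc)) (i , w , c) = zmove mi i , zact bw mw w , zact bc mc c

Moves : Set
Moves = Move × Move × Move

keeping : Syms → Moves → TAct
keeping (_ , sw , sc) (mi , mw , mc) = mi , (bitOf sw , mw) , (bitOf sc , mc)

tmove : Moves → Tapes → Tapes
tmove (mi , mw , mc) (i , w , c) = zmove mi i , zmove mw w , zmove mc c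

tact-keeping : ∀ ms t → tact (keeping (syms t) ms) t ≡ tmove ms t
tact-keeping (mi , mw , mc) (i , w , c) =
  cong₂ (λ a b → zmove mi i , zmove mw a , zmove mc b) (zwrite-same w) (zwrite-same c)

-- The configuration graph of a machine

module Graph (M : Machine) where
  open Machine M

  -- An arc is labelled by the state and the symbols at its source, which suffices to recover the
  -- source from the target. The number of labels depends on `M` alone, so candidates can be tried
  -- by finite control.
  Desc : Set
  Desc = Fin q × Syms

  K : ℕ
  K = size (fin-× {Fin q} {Syms})

  encD : Desc → Fin K
  encD = to fin-×

  decD : Fin K → Desc
  decD = from fin-×

  decD-encD : ∀ d → decD (encD d) ≡ d
  decD-encD = from-to fin-×

  V : Set
  V = Fin q × Tapes

  _≟V_ : DecidableEquality V
  _≟V_ = ≡-dec _≟F_ (≡-dec _≟Z_ (≡-dec _≟Z_ _≟Z_))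

  tactOf : Action q → TAct
  tactOf a = let open Action a in inMove , (workWrite , workMove) , (catWrite , catMove)

  action : Desc → Action q
  action (p , a , b , c) = δ p a b c

  vdesc : V → Desc
  vdesc (p , t) = p , syms t

  vstep : V → Maybe V
  vstep (p , t) with halt p
  ... | just _  = nothing
  ... | nothing = let a = action (p , syms t) in just (Action.next a , tact (tactOf a) t)

  effs : Desc → Moves
  effs d@(p , a , b , c) = let open Action (action d) in eff inMove a , eff workMove b , eff catMove c

  invs : Moves → Moves
  invs (mi , mw , mc) = inv mi , inv mw , inv mc

  frees : Moves → Syms → Bool
  frees (mi , mw , mc) (a , b , c) = free mi a ∧ free mw b ∧ free mc c

  isRunning : Fin q → Bool
  isRunning p with halt p
  ... | just _  = false
  ... | nothing = true

  -- The test of a candidate is split in two because only the symbols under the heads are visible: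
  -- the first half precedes the backward moves and guarantees that they are not blocked, the second
  -- half follows them.
  check₁ : Desc → Fin q → Syms → Bool
  check₁ d@(p , _) q′ s = isRunning p ∧ does (Action.next (action d) ≟F q′) ∧ frees (invs (effs d)) s

  check₂ : Desc → Syms → Bool
  check₂ d@(p , a , b , c) (a′ , b′ , c′) = let open Action (action d) in
    does (a′ ≟S a) ∧ does (b′ ≟S written workWrite b) ∧ does (c′ ≟S written catWrite c)

  rewriting : Desc → TAct
  rewriting (p , a , b , c) = stay , (bitOf b , stay) , (bitOf c , stay)

  vundo : Desc → V → Maybe V
  vundo d (q′ , t) with check₁ d q′ (syms t)
  ... | false = nothing
  ... | true with check₂ d (syms (tmove (invs (effs d)) t))
  ...   | false = nothing
  ...   | true  = just (proj₁ d , tact (rewriting d) (tmove (invs (effs d)) t))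

  running : ∀ {p} → isRunning p ≡ true → halt p ≡ nothing
  running {p} eq with halt p
  ... | nothing = refl

  vstep-running : ∀ {p} t → halt p ≡ nothing →
    vstep (p , t) ≡ just (Action.next (action (p , syms t)) , tact (tactOf (action (p , syms t))) t)
  vstep-running t eq rewrite eq = refl

  vstep-stopped : ∀ {p t a} → halt p ≡ just a → vstep (p , t) ≡ nothing
  vstep-stopped eq rewrite eq = refl

  vundo-unchecked : ∀ {d p t} → check₁ d p (syms t) ≡ false → vundo d (p , t) ≡ nothing
  vundo-unchecked eq rewrite eq = refl

  vundo-failed : ∀ {d p t} → check₁ d p (syms t) ≡ true → check₂ d (syms (tmove (invs (effs d)) t)) ≡ false →
    vundo d (p , t) ≡ nothing
  vundo-failed eq eq′ rewrite eq | eq′ = refl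

  vundo-passed : ∀ {d p t} → check₁ d p (syms t) ≡ true → check₂ d (syms (tmove (invs (effs d)) t)) ≡ true →
    vundo d (p , t) ≡ just (proj₁ d , tact (rewriting d) (tmove (invs (effs d)) t))
  vundo-passed eq eq′ rewrite eq | eq′ = refl

  private
    ∧-true : ∀ {a b} → a ∧ b ≡ true → a ≡ true × b ≡ true
    ∧-true {true} {true} refl = refl , refl

    true-∧ : ∀ {a b} → a ≡ true → b ≡ true → a ∧ b ≡ true
    true-∧ refl refl = refl

    does⇒ : ∀ {A : Set} (d : Dec A) → does d ≡ true → A
    does⇒ (yes a) _ = a

    zact-kept : ∀ m z → zact (bitOf (zread z)) m z ≡ zmove m z
    zact-kept m z = cong (zmove m) (zwrite-same z)

  vundo-action : ∀ p t → halt p ≡ nothing → let a = action (p , syms t) in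
                 vundo (p , syms t) (Action.next a , tact (tactOf a) t) ≡ just (p , t)
  vundo-action p t@(i , w , c) hp = lemma
    where
    d = p , syms t
    a = action d
    open Action a
    q′ = next
    t′ = tact (tactOf a) t
    t₁ = tmove (invs (effs d)) t′
    ci = unact-complete (bitOf (zread i)) inMove i
    cw = unact-complete workWrite workMove w
    cc = unact-complete catWrite catMove c
    i≡ : zact (bitOf (zread i)) inMove i ≡ zmove inMove i
    i≡ = zact-kept inMove i
    isR : isRunning p ≡ true
    isR rewrite hp = refl
    c₁ : check₁ d q′ (syms t′) ≡ true
    c₁ = true-∧ isR (true-∧ (dec-true (next ≟F next) refl)
           (true-∧ (subst (λ z → free (inv (eff inMove (zread i))) (zread z) ≡ true) i≡ (proj₁ ci))
           (true-∧ (proj₁ cw) (proj₁ cc))))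
    ii : zread (proj₁ t₁) ≡ zread i
    ii = trans (cong (λ z → zread (zmove (inv (eff inMove (zread i))) z)) (sym i≡)) (trans (proj₁ (proj₂ ci)) (written-bitOf (zread i)))
    c₂ : check₂ d (syms t₁) ≡ true
    c₂ = true-∧ (dec-true (_ ≟S _) ii)
           (true-∧ (dec-true (_ ≟S _) (proj₁ (proj₂ cw))) (dec-true (_ ≟S _) (proj₁ (proj₂ cc))))
    i₁≡ : proj₁ t₁ ≡ i
    i₁≡ = trans (cong (zmove (inv (eff inMove (zread i)))) (sym i≡))
            (trans (sym (zwrite-same _)) (trans (cong (λ s → zwrite (bitOf s) (zmove (inv (eff inMove (zread i))) (zact (bitOf (zread i)) inMove i)))
               (trans (proj₁ (proj₂ ci)) (written-bitOf (zread i)))) (proj₂ (proj₂ ci))))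
    lemma : vundo d (q′ , t′) ≡ just (p , t)
    lemma rewrite c₁ | c₂ = cong (λ t → just (p , t)) (cong₂ _,_ i₁≡ (cong₂ _,_ (proj₂ (proj₂ cw)) (proj₂ (proj₂ cc))))

  vstep-running⁻¹ : ∀ {p t v} → vstep (p , t) ≡ just v →
    halt p ≡ nothing × v ≡ (Action.next (action (p , syms t)) , tact (tactOf (action (p , syms t))) t)
  vstep-running⁻¹ {p} eq with halt p
  vstep-running⁻¹ refl | nothing = refl , refl

  vundo-complete : ∀ {u v} → vstep u ≡ just v → vundo (vdesc u) v ≡ just u
  vundo-complete {p , t} eq with hp , refl ← vstep-running⁻¹ {p} {t} eq = vundo-action p t hp

  vundo-sound : ∀ d {u v} → vundo d v ≡ just u → vstep u ≡ just v × vdesc u ≡ d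
  vundo-sound d@(p , a , b , c) {u} {q′ , t@(iz , wz , cz)} eq with check₁ d q′ (syms t) in c₁
  ... | true with check₂ d (syms (tmove (invs (effs d)) t)) in c₂
  vundo-sound d@(p , a , b , c) {u} {q′ , t@(iz , wz , cz)} refl | true | true = st , de
    where
    open Action (action d)
    r  = ∧-true {isRunning p} c₁
    r₁ = ∧-true {does (next ≟F q′)} (proj₂ r)
    f  = ∧-true {free (inv (eff inMove a)) (zread iz)} (proj₂ r₁)
    f₁ = ∧-true {free (inv (eff workMove b)) (zread wz)} (proj₂ f)
    g  = ∧-true {does (zread (zmove (inv (eff inMove a)) iz) ≟S a)} c₂
    g₁ = ∧-true {does (zread (zmove (inv (eff workMove b)) wz) ≟S written workWrite b)} (proj₂ g)
    ia : zread (zmove (inv (eff inMove a)) iz) ≡ a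
    ia = does⇒ (_ ≟S _) (proj₁ g)
    si = unact-sound (bitOf a) inMove a iz (proj₁ f) (trans ia (sym (written-bitOf a)))
    sw = unact-sound workWrite workMove b wz (proj₁ f₁) (does⇒ (_ ≟S _) (proj₁ g₁))
    sc = unact-sound catWrite catMove c cz (proj₂ f₁) (does⇒ (_ ≟S _) (proj₂ g₁))
    i₁ = zmove (inv (eff inMove a)) iz
    im : zmove inMove i₁ ≡ iz
    im = trans (cong (zmove inMove) (sym (keep i₁ ia))) (proj₂ si)
      where
      keep : ∀ z → zread z ≡ a → zwrite (bitOf a) (zwrite (bitOf a) z) ≡ z
      keep z refl = trans (cong (zwrite (bitOf (zread z))) (zwrite-same z)) (zwrite-same z)
    t₁ = tact (rewriting d) (tmove (invs (effs d)) t)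
    sy : syms t₁ ≡ (a , b , c)
    sy = cong₂ _,_ ia (cong₂ _,_ (proj₁ sw) (proj₁ sc))
    de : (p , syms t₁) ≡ d
    de = cong (p ,_) sy
    st : vstep (p , t₁) ≡ just (q′ , t)
    st = trans (vstep-running t₁ (running (proj₁ r)))
      (trans (cong (λ s → just (Action.next (action (p , s)) , tact (tactOf (action (p , s))) t₁)) sy)
        (cong just (cong₂ _,_ (does⇒ (_ ≟F _) (proj₁ r₁)) (cong₂ _,_ im (cong₂ _,_ (proj₂ sw) (proj₂ sc))))))

  -- When the second test refutes a candidate, the heads have already moved back. Since the first
  -- test ensured that no move was blocked, moving forward again restores the vertex.
  tmove-invs : ∀ d p t → check₁ d p (syms t) ≡ true → tmove (effs d) (tmove (invs (effs d)) t) ≡ t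
  tmove-invs d@(p′ , a , b , c) p (iz , wz , cz) c₁ =
    cong₂ _,_ (restore (eff inMove a) iz (proj₁ f))
      (cong₂ _,_ (restore (eff workMove b) wz (proj₁ f₁)) (restore (eff catMove c) cz (proj₂ f₁)))
    where
    open Action (action d)
    f  = ∧-true {free (inv (eff inMove a)) (zread iz)} (proj₂ (∧-true {does (next ≟F p)} (proj₂ (∧-true {isRunning p′} c₁))))
    f₁ = ∧-true {free (inv (eff workMove b)) (zread wz)} (proj₂ f)
    restore : ∀ m z → free (inv m) (zread z) ≡ true → zmove m (zmove (inv m) z) ≡ z
    restore m z fr = trans (cong (λ d → zmove d (zmove (inv m) z)) (sym (inv-inv m))) (zmove-inv (inv m) z fr)

  encD-decD : ∀ i → encD (decD i) ≡ i
  encD-decD = to-from-× (fin-Fin {q}) (fin-× {Sym} {Sym × Sym}) (λ _ → refl)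
                (to-from-× fin-Sym (fin-× {Sym} {Sym}) sym-onto (to-from-× fin-Sym fin-Sym sym-onto sym-onto))
    where
    sym-onto : ∀ i → to fin-Sym (from fin-Sym i) ≡ i
    sym-onto zero                   = refl
    sym-onto (suc zero)             = refl
    sym-onto (suc (suc zero))       = refl
    sym-onto (suc (suc (suc zero))) = refl

  undo : Fin K → V → Maybe V
  undo i = vundo (decD i)

  undo-complete : ∀ {u v} → vstep u ≡ just v → undo (encD (vdesc u)) v ≡ just u
  undo-complete {u} {v} eq = trans (cong (λ d → vundo d v) (decD-encD (vdesc u))) (vundo-complete eq)

  undo-sound : ∀ {i u v} → undo i v ≡ just u → vstep u ≡ just v × encD (vdesc u) ≡ i
  undo-sound {i} eq = let s , e = vundo-sound (decD i) eq in s , trans (cong encD e) (encD-decD i)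

  open Tour V _≟V_ K vstep (λ v → encD (vdesc v)) undo undo-complete undo-sound public

  module Sized {n : ℕ} (x : Vec Bool n) (s c : ℕ) where

    Cfg : Set
    Cfg = Fin q × Fin (suc (suc n)) × (Vec Bool s × Fin (suc (suc s))) × (Vec Bool c × Fin (suc (suc c)))

    vertex : Cfg → V
    vertex (p , ih , (wt , wh) , (ct , ch)) = p , zip x ih , zip wt wh , zip ct ch

    fin-Cfg : Finite Cfg
    fin-Cfg = fin-×

    configs : ℕ
    configs = size fin-Cfg

    decode : Fin configs → V
    decode i = vertex (from fin-Cfg i)

    valid-vertex : ∀ f → Valid configs decode (vertex f)
    valid-vertex f = to fin-Cfg f , cong vertex (from-to fin-Cfg f)

    act-valid : ∀ p {p′ t} a → Valid configs decode (p′ , t) → Valid configs decode (p , tact a t)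
    act-valid p (mi , (bw , mw) , (bc , mc)) (j , refl) = acted (from fin-Cfg j)
      where
      acted : ∀ f → Valid configs decode (p , tact (mi , (bw , mw) , (bc , mc)) (proj₂ (vertex f)))
      acted (_ , ih , (wt , wh) , (ct , ch)) = subst (λ t → Valid configs decode (p , t))
        (cong₂ _,_ (sym (zmove-zip mi x ih)) (cong₂ _,_ (sym (zact-zip bw mw wt wh)) (sym (zact-zip bc mc ct ch))))
        (valid-vertex (p , moveHead mi ih , (writeTape wt wh bw , moveHead mw wh) , (writeTape ct ch bc , moveHead mc ch)))

    valid-step : ∀ {v w} → vstep v ≡ just w → Valid configs decode v → Valid configs decode w
    valid-step {p , t} eq val with halt p
    valid-step {p , t} refl val | nothing = act-valid _ (tactOf (action (p , syms t))) val

    valid-undo : ∀ {d v w} → undo d v ≡ just w → Valid configs decode v → Valid configs decode w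
    valid-undo {i} {q′ , t} eq val with check₁ (decD i) q′ (syms t)
    ... | true with check₂ (decD i) (syms (tmove (invs (effs (decD i))) t))
    valid-undo {i} {q′ , t} refl val | true | true =
      act-valid _ (rewriting (decD i))
        (subst (λ t → Valid configs decode (q′ , t)) (tact-keeping (invs (effs (decD i))) t)
          (act-valid q′ (keeping (syms t) (invs (effs (decD i)))) val))

    open Reach configs decode valid-step valid-undo public

    vertexOf : Config M n s c → V
    vertexOf g = let open Config g in state , zip x ih , zip wt wh , zip ct ch

    vstep-halted : ∀ g {a} → halt (Config.state g) ≡ just a → vstep (vertexOf g) ≡ nothing
    vstep-halted g eq = vstep-stopped eq

    vstep-step : ∀ g → halt (Config.state g) ≡ nothing → vstep (vertexOf g) ≡ just (vertexOf (step M x g))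
    vstep-step g eq = trans (vstep-running _ eq) (lemma g eq)
      where
      lemma : ∀ (g : Config M n s c) → halt (Config.state g) ≡ nothing → let open Config g ; a = action (vdesc (vertexOf g)) in
        just (Action.next a , tact (tactOf a) (proj₂ (vertexOf g))) ≡ just (vertexOf (step M x g))
      lemma g eq with halt (Config.state g)
      lemma g refl | nothing
        rewrite zread-zip x (Config.ih g) | zread-zip (Config.wt g) (Config.wh g) | zread-zip (Config.ct g) (Config.ch g)
        = cong (λ t → just (Action.next a , t)) (cong₂ _,_ (zmove-zip (Action.inMove a) x (Config.ih g))
            (cong₂ _,_ (zact-zip (Action.workWrite a) (Action.workMove a) (Config.wt g) (Config.wh g)) (zact-zip (Action.catWrite a) (Action.catMove a) (Config.ct g) (Config.ch g))))
        where
        a : Action q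
        a = action (Config.state g , readTape x (Config.ih g) , readTape (Config.wt g) (Config.wh g) , readTape (Config.ct g) (Config.ch g))

    run-halted : ∀ t (g : Config M n s c) {a} → halt (Config.state g) ≡ just a → run M x t g ≡ g
    run-halted zero    g eq = refl
    run-halted (suc t) g eq = trans (cong (run M x t) (fix g eq)) (run-halted t g eq)
      where
      fix : ∀ (g : Config M n s c) {a} → halt (Config.state g) ≡ just a → step M x g ≡ g
      fix g eq rewrite eq = refl

    -- `run` idles at a halting configuration while paths end there, so the path may be shorter than
    -- the run.
    run-path : ∀ t (g : Config M n s c) {a} → halt (Config.state (run M x t g)) ≡ just a →
               ∃[ t′ ] vertexOf g ↝[ t′ ] vertexOf (run M x t g)
    run-path zero    g h = 0 , here
    run-path (suc t) g h = continue (halt (Config.state g)) refl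
      where
      continue : ∀ r → halt (Config.state g) ≡ r → ∃[ t′ ] vertexOf g ↝[ t′ ] vertexOf (run M x (suc t) g)
      continue (just _) eq = 0 , subst (λ g′ → vertexOf g ↝[ 0 ] vertexOf g′) (sym (run-halted (suc t) g eq)) here
      continue nothing  eq = let t′ , p = run-path t (step M x g) h in suc t′ , next (vstep-step g eq) p

    path-run : ∀ {t h} (g : Config M n s c) → vertexOf g ↝[ t ] h → vertexOf (run M x t g) ≡ h
    path-run g here                    = refl
    path-run {suc t} {h} g (next {v = v} e p) = continue (halt (Config.state g)) refl
      where
      continue : ∀ r → halt (Config.state g) ≡ r → vertexOf (run M x t (step M x g)) ≡ h
      continue (just _) eq = contradiction (trans (sym e) (vstep-halted g eq)) λ ()
      continue nothing  eq = path-run (step M x g)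
        (subst (λ v → v ↝[ t ] h) (just-injective (trans (sym e) (vstep-step g eq))) p)

-- Counter programs

Reg : Set
Reg = Fin 7

-- `io f` reads the input and the catalytic symbol and returns the continuation, the bit to
-- write on the catalytic tape, and the moves of the input and the catalytic head.
data Instr (X : Set) : Set where
  io   : (Sym → Sym → X × Bool × Move × Move) → Instr X
  inc  : Reg → X → Instr X
  dec  : Reg → X → Instr X
  test : Reg → (Bool → X) → Instr X

mapI : ∀ {X Y : Set} → (X → Y) → Instr X → Instr Y
mapI f (io g)     = io λ a c → let x , r = g a c in f x , r
mapI f (inc r x)  = inc r (f x)
mapI f (dec r x)  = dec r (f x)
mapI f (test r g) = test r (f ∘ g)

record Mem : Set where
  constructor mem
  field
    input cat : Zip
    regs      : Vec ℕ 7

open Mem public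

setReg : Mem → Reg → ℕ → Mem
setReg m r v = record m { regs = regs m [ r ]≔ v }

-- Program fragments with entry points A and exits B.
infixr 4 _⨾_
data Frag : Set → Set → Set₁ where
  ioF    : ∀ {A B} ⦃ _ : Finite A ⦄ → (A → Sym → Sym → B × Bool × Move × Move) → Frag A B
  incF   : Reg → Frag ⊤ ⊤
  decF   : Reg → Frag ⊤ ⊤
  testF  : Reg → Frag ⊤ Bool
  dimap  : ∀ {A A′ B B′} → (A′ → A) → (B → B′) → Frag A B → Frag A′ B′
  _⨾_    : ∀ {A B C} → Frag A B → Frag B C → Frag A C
  choice : ∀ {A B C} → Frag A C → Frag B C → Frag (A ⊎ B) C
  loop   : ∀ {A B} → Frag A (A ⊎ B) → Frag A B
  _⊗_    : ∀ K {A B} ⦃ _ : Finite K ⦄ → Frag A B → Frag (K × A) (K × B)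

St : ∀ {A B} → Frag A B → Set
St (ioF {A} f)   = A
St (incF r)      = ⊤
St (decF r)      = ⊤
St (testF r)     = ⊤
St (dimap f g P) = St P
St (P ⨾ Q)       = St P ⊎ St Q
St (choice P Q)  = St P ⊎ St Q
St (loop P)      = St P
St (K ⊗ P)       = K × St P

fin-St : ∀ {A B} (P : Frag A B) → Finite (St P)
fin-St (ioF ⦃ F ⦄ f) = F
fin-St (incF r)      = fin-⊤
fin-St (decF r)      = fin-⊤
fin-St (testF r)     = fin-⊤
fin-St (dimap f g P) = fin-St P
fin-St (P ⨾ Q)       = fin-⊎ ⦃ fin-St P ⦄ ⦃ fin-St Q ⦄
fin-St (choice P Q)  = fin-⊎ ⦃ fin-St P ⦄ ⦃ fin-St Q ⦄
fin-St (loop P)      = fin-St P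
fin-St (K ⊗ P)       = fin-× ⦃ it ⦄ ⦃ fin-St P ⦄

enter : ∀ {A B} (P : Frag A B) → A → St P
enter (ioF f)       a        = a
enter (incF r)      a        = a
enter (decF r)      a        = a
enter (testF r)     a        = a
enter (dimap f g P) a        = enter P (f a)
enter (P ⨾ Q)       a        = inj₁ (enter P a)
enter (choice P Q)  (inj₁ a) = inj₁ (enter P a)
enter (choice P Q)  (inj₂ b) = inj₂ (enter Q b)
enter (loop P)      a        = enter P a
enter (K ⊗ P)       (k , a)  = k , enter P a

code : ∀ {A B} (P : Frag A B) → St P → Instr (St P ⊎ B)
code (ioF f)       a        = io λ i c → let b , r = f a i c in inj₂ b , r
code (incF r)      _        = inc r (inj₂ tt)
code (decF r)      _        = dec r (inj₂ tt)
code (testF r)     _        = test r inj₂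
code (dimap f g P) s        = mapI [ inj₁ , inj₂ ∘ g ] (code P s)
code (P ⨾ Q)       (inj₁ s) = mapI [ inj₁ ∘ inj₁ , inj₁ ∘ inj₂ ∘ enter Q ] (code P s)
code (P ⨾ Q)       (inj₂ s) = mapI [ inj₁ ∘ inj₂ , inj₂ ] (code Q s)
code (choice P Q)  (inj₁ s) = mapI [ inj₁ ∘ inj₁ , inj₂ ] (code P s)
code (choice P Q)  (inj₂ s) = mapI [ inj₁ ∘ inj₂ , inj₂ ] (code Q s)
code (loop P)      s        = mapI [ inj₁ , [ inj₁ ∘ enter P , inj₂ ] ] (code P s)
code (K ⊗ P)       (k , s)  = mapI [ inj₁ ∘ (k ,_) , inj₂ ∘ (k ,_) ] (code P s)

nop : ∀ {A B : Set} ⦃ _ : Finite A ⦄ → (A → B) → Frag A B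
nop f = ioF λ a _ c → f a , bitOf c , stay , stay

carry : ∀ {K : Set} ⦃ _ : Finite K ⦄ → Frag ⊤ ⊤ → Frag K K
carry P = dimap (_, tt) proj₁ (_ ⊗ P)

branch : ∀ {K : Set} ⦃ _ : Finite K ⦄ → Reg → Frag K (K ⊎ K)
branch r = dimap (_, tt) (λ (k , b) → if b then inj₁ k else inj₂ k) (_ ⊗ testF r)

for : ∀ {K : Set} ⦃ _ : Finite K ⦄ → Reg → Frag K K → Frag K K
for r P = loop (branch r ⨾ choice (carry (decF r) ⨾ dimap id inj₁ P) (nop inj₂))

-- Execution of counter programs with time bounds

module Semantics (cap : Reg → ℕ) where

  data Exec {X : Set} : Instr X → Mem → X → Mem → Set where
    io   : ∀ {f : Sym → Sym → X × Bool × Move × Move} {m} → let x , b , mi , mc = f (zread (input m)) (zread (cat m)) in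
           Exec (io f) m x (record m { input = zmove mi (input m) ; cat = zact b mc (cat m) })
    inc  : ∀ {r x m} → suc (lookup (regs m) r) < cap r →
           Exec (inc r x) m x (setReg m r (suc (lookup (regs m) r)))
    dec  : ∀ {r x m v} → lookup (regs m) r ≡ suc v → Exec (dec r x) m x (setReg m r v)
    -- Decrementing 0 wraps around, which is how a program obtains the number cap r ∸ 1.
    fill : ∀ {r x m} → lookup (regs m) r ≡ 0 → Exec (dec r x) m x (setReg m r (cap r ∸ 1))
    test₀ : ∀ {r f m} → lookup (regs m) r ≡ 0 → Exec (test r f) m (f false) m
    test₊ : ∀ {r f m v} → lookup (regs m) r ≡ suc v → Exec (test r f) m (f true) m

  exec-map : ∀ {X Y : Set} (f : X → Y) {i m x m′} → Exec i m x m′ → Exec (mapI f i) m (f x) m′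
  exec-map f io        = io
  exec-map f (inc p)   = inc p
  exec-map f (dec p)   = dec p
  exec-map f (fill p)  = fill p
  exec-map f (test₀ p) = test₀ p
  exec-map f (test₊ p) = test₊ p

  data Runs {S O : Set} (code : S → Instr (S ⊎ O)) : S ⊎ O → Mem → ℕ → O → Mem → Set where
    stop : ∀ {o m} → Runs code (inj₂ o) m 0 o m
    go   : ∀ {s m x m₁ t o m₂} → Exec (code s) m x m₁ → Runs code x m₁ t o m₂ →
           Runs code (inj₁ s) m (suc t) o m₂

  -- The common core of all combinators: on the embedded states, the code of a compound fragment is
  -- the renamed code of its part. `g` embeds the states and `h` tells where an exit continues.
  runs-lift : ∀ {S O S′ O′ : Set} {code : S → Instr (S ⊎ O)} {code′ : S′ → Instr (S′ ⊎ O′)}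
              (g : S → S′) (h : O → S′ ⊎ O′) →
              (∀ s → code′ (g s) ≡ mapI [ inj₁ ∘ g , h ] (code s)) →
              ∀ {x m t o m₁ t′ o′ m₂} → Runs code x m t o m₁ → Runs code′ (h o) m₁ t′ o′ m₂ →
              Runs code′ ([ inj₁ ∘ g , h ] x) m (t + t′) o′ m₂
  runs-lift g h eq stop k = k
  runs-lift g h eq (go {s} e r) k =
    go (subst (λ i → Exec i _ _ _) (sym (eq s)) (exec-map _ e)) (runs-lift g h eq r k)

  record Run {A B : Set} (P : Frag A B) (a : A) (m : Mem) (T : ℕ) (b : B) (m′ : Mem) : Set where
    constructor within
    field
      {time} : ℕ
      bound  : time ≤ T
      runs   : Runs (code P) (inj₁ (enter P a)) m time b m′

  weaken : ∀ {A B : Set} {P : Frag A B} {a m T T′ b m′} → T ≤ T′ → Run P a m T b m′ → Run P a m T′ b m′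
  weaken T≤ (within t≤ r) = within (≤-trans t≤ T≤) r

  land : ∀ {A B : Set} {P : Frag A B} {a m T b m₁ m₂} → m₁ ≡ m₂ → Run P a m T b m₁ → Run P a m T b m₂
  land refl r = r

  run-seq : ∀ {A B C : Set} {P : Frag A B} {Q : Frag B C} {a m T b m₁ T′ c m₂} →
            Run P a m T b m₁ → Run Q b m₁ T′ c m₂ → Run (P ⨾ Q) a m (T + T′) c m₂
  run-seq {P = P} {Q} (within p r) (within {t} q s) =
    within (+-mono-≤ p (≤-trans (≤-reflexive (+-identityʳ t)) q))
      (runs-lift inj₁ (inj₁ ∘ inj₂ ∘ enter Q) (λ _ → refl) r (runs-lift inj₂ inj₂ (λ _ → refl) s stop))

  private
    lift₀ : ∀ {A B A′ B′ : Set} {P : Frag A B} {Q : Frag A′ B′} (g : St P → St Q) (h : B → B′) →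
            (∀ s → code Q (g s) ≡ mapI [ inj₁ ∘ g , inj₂ ∘ h ] (code P s)) →
            ∀ {a a′ m T b m′} → enter Q a′ ≡ g (enter P a) → Run P a m T b m′ → Run Q a′ m T (h b) m′
    lift₀ g h eq refl′ (within {t} t≤ r) =
      within (≤-trans (≤-reflexive (+-identityʳ t)) t≤) (subst (λ s → Runs _ (inj₁ s) _ _ _ _) (sym refl′) (runs-lift g (inj₂ ∘ h) eq r stop))

  run-dimap : ∀ {A A′ B B′ : Set} (f : A′ → A) (g : B → B′) {P : Frag A B} {a m T b m′} →
              Run P (f a) m T b m′ → Run (dimap f g P) a m T (g b) m′
  run-dimap f g = lift₀ id g (λ _ → refl) refl

  run-choice₁ : ∀ {A B C : Set} {P : Frag A C} {Q : Frag B C} {a m T c m′} →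
                Run P a m T c m′ → Run (choice P Q) (inj₁ a) m T c m′
  run-choice₁ = lift₀ inj₁ id (λ _ → refl) refl

  run-choice₂ : ∀ {A B C : Set} {P : Frag A C} {Q : Frag B C} {b m T c m′} →
                Run Q b m T c m′ → Run (choice P Q) (inj₂ b) m T c m′
  run-choice₂ = lift₀ inj₂ id (λ _ → refl) refl

  run-⊗ : ∀ {K A B : Set} ⦃ _ : Finite K ⦄ {P : Frag A B} {k a m T b m′} →
          Run P a m T b m′ → Run (K ⊗ P) (k , a) m T (k , b) m′
  run-⊗ {k = k} = lift₀ (k ,_) (k ,_) (λ _ → refl) refl

  run-carry : ∀ {K : Set} ⦃ _ : Finite K ⦄ {P : Frag ⊤ ⊤} {k : K} {m T m′} →
              Run P tt m T tt m′ → Run (carry P) k m T k m′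
  run-carry r = run-dimap (_, tt) proj₁ (run-⊗ r)

  run-loop-stop : ∀ {A B : Set} {P : Frag A (A ⊎ B)} {a m T b m′} →
                  Run P a m T (inj₂ b) m′ → Run (loop P) a m T b m′
  run-loop-stop {P = P} (within {t} t≤ r) =
    within (≤-trans (≤-reflexive (+-identityʳ t)) t≤) (runs-lift id [ inj₁ ∘ enter P , inj₂ ] (λ _ → refl) r stop)

  run-loop-more : ∀ {A B : Set} {P : Frag A (A ⊎ B)} {a m T a′ m₁ T′ b m′} →
                  Run P a m T (inj₁ a′) m₁ → Run (loop P) a′ m₁ T′ b m′ → Run (loop P) a m (T + T′) b m′
  run-loop-more {P = P} (within p r) (within q s) =
    within (+-mono-≤ p q) (runs-lift id [ inj₁ ∘ enter P , inj₂ ] (λ _ → refl) r s)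

  run-io : ∀ {A B : Set} ⦃ _ : Finite A ⦄ (f : A → Sym → Sym → B × Bool × Move × Move) {a m} →
           let b , w , mi , mc = f a (zread (input m)) (zread (cat m)) in
           Run (ioF f) a m 1 b (mem (zmove mi (input m)) (zact w mc (cat m)) (regs m))
  run-io f = within ≤-refl (go io stop)

  run-keep : ∀ {A B : Set} ⦃ _ : Finite A ⦄ {f : A → Sym → Sym → B × Bool × Move × Move} {a m b mi mc} →
             f a (zread (input m)) (zread (cat m)) ≡ (b , bitOf (zread (cat m)) , mi , mc) →
             Run (ioF f) a m 1 b (mem (zmove mi (input m)) (zmove mc (cat m)) (regs m))
  run-keep {f = f} {a} {m} {b} {mi} {mc} eq = subst (λ z → Run (ioF f) a m 1 b (mem (zmove mi (input m)) (zmove mc z) (regs m)))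
    (zwrite-same (cat m))
    (subst (λ (b , w , mi , mc) → Run (ioF f) a m 1 b (mem (zmove mi (input m)) (zact w mc (cat m)) (regs m))) eq (run-io f))

  run-nop : ∀ {A B : Set} ⦃ _ : Finite A ⦄ (f : A → B) {a m} → Run (nop f) a m 1 (f a) m
  run-nop f = run-keep refl

  run-inc : ∀ {r m} → suc (lookup (regs m) r) < cap r →
            Run (incF r) tt m 1 tt (setReg m r (suc (lookup (regs m) r)))
  run-inc p = within ≤-refl (go (inc p) stop)

  run-dec : ∀ {r m v} → lookup (regs m) r ≡ suc v → Run (decF r) tt m 1 tt (setReg m r v)
  run-dec p = within ≤-refl (go (dec p) stop)

  run-fill : ∀ {r m} → lookup (regs m) r ≡ 0 → Run (decF r) tt m 1 tt (setReg m r (cap r ∸ 1))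
  run-fill p = within ≤-refl (go (fill p) stop)

  run-branch₊ : ∀ {K : Set} ⦃ _ : Finite K ⦄ {r m v} {k : K} → lookup (regs m) r ≡ suc v →
                Run (branch r) k m 1 (inj₁ k) m
  run-branch₊ p = run-dimap (_, tt) _ (run-⊗ (within ≤-refl (go (test₊ p) stop)))

  run-branch₀ : ∀ {K : Set} ⦃ _ : Finite K ⦄ {r m} {k : K} → lookup (regs m) r ≡ 0 →
                Run (branch r) k m 1 (inj₂ k) m
  run-branch₀ p = run-dimap (_, tt) _ (run-⊗ (within ≤-refl (go (test₀ p) stop)))

  -- Each round spends a test and a decrement besides the body, and the exit spends a test and a
  -- `nop`; hence `v * (2 + T) + 2`.
  run-for : ∀ {K : Set} ⦃ _ : Finite K ⦄ {r : Reg} {P : Frag K K} (Inv : ℕ → K → Mem → Set) (T : ℕ) →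
            (∀ {v k m} → Inv v k m → lookup (regs m) r ≡ v) →
            (∀ {v k m} → Inv (suc v) k m →
               ∃[ k′ ] ∃[ m′ ] (Run P k (setReg m r v) T k′ m′ × Inv v k′ m′)) →
            ∀ v {k m} → Inv v k m → ∃[ k′ ] ∃[ m′ ] (Run (for r P) k m (v * (2 + T) + 2) k′ m′ × Inv 0 k′ m′)
  run-for Inv T reg body zero    {k} {m} i =
    k , m , run-loop-stop (run-seq (run-branch₀ (reg i)) (run-choice₂ (run-nop inj₂))) , i
  run-for {r = r} {P} Inv T reg body (suc v) {k} {m} i
    with k₁ , m₁ , b , i₁ ← body i
    with k₂ , m₂ , rest , i₂ ← run-for {r = r} {P} Inv T reg body v i₁
    = k₂ , m₂ , weaken (≤-reflexive (sym (+-assoc (2 + T) (v * (2 + T)) 2)))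
        (run-loop-more (run-seq (run-branch₊ (reg i))
           (run-choice₁ (run-seq (run-carry (run-dec (reg i))) (run-dimap id inj₁ b)))) rest) , i₂

  module Indexed {K : Set} ⦃ _ : Finite K ⦄ {r : Reg} {F : Frag K K} (st : ℕ → K) (mm : ℕ → ℕ → Mem) (t : ℕ)
                 (get : ∀ i v → lookup (regs (mm i v)) r ≡ v)
                 (set : ∀ i v v′ → setReg (mm i v) r v′ ≡ mm i v′) where

    run-for-up : (∀ i v → Run F (st i) (mm i v) t (st (suc i)) (mm (suc i) v)) →
                 ∀ T → Run (for r F) (st 0) (mm 0 T) (T * (2 + t) + 2) (st T) (mm T 0)
    run-for-up body T = final (run-for Inv t inv-get inv-body T (0 , refl , refl , refl))
      where
      Inv : ℕ → K → Mem → Set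
      Inv v k m = ∃[ i ] (i + v ≡ T × k ≡ st i × m ≡ mm i v)
      inv-get : ∀ {v k m} → Inv v k m → lookup (regs m) r ≡ v
      inv-get {v} (i , _ , _ , refl) = get i v
      inv-body : ∀ {v k m} → Inv (suc v) k m → ∃[ k′ ] ∃[ m′ ] (Run F k (setReg m r v) t k′ m′ × Inv v k′ m′)
      inv-body {v} (i , e , refl , refl) = st (suc i) , mm (suc i) v ,
        subst (λ m → Run F (st i) m t (st (suc i)) (mm (suc i) v)) (sym (set i (suc v) v)) (body i v) ,
        suc i , trans (sym (+-suc i v)) e , refl , refl
      final : ∃[ k ] ∃[ m ] (Run (for r F) (st 0) (mm 0 T) (T * (2 + t) + 2) k m × Inv 0 k m) →
              Run (for r F) (st 0) (mm 0 T) (T * (2 + t) + 2) (st T) (mm T 0)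
      final (_ , _ , res , i , e , refl , refl) =
        subst (λ i → Run (for r F) (st 0) (mm 0 T) (T * (2 + t) + 2) (st i) (mm i 0)) (trans (sym (+-identityʳ i)) e) res

    run-for-down : (∀ i v → Run F (st (suc i)) (mm (suc i) v) t (st i) (mm i v)) →
                   ∀ T → Run (for r F) (st T) (mm T T) (T * (2 + t) + 2) (st 0) (mm 0 0)
    run-for-down body T = final (run-for Inv t inv-get inv-body T (refl , refl))
      where
      Inv : ℕ → K → Mem → Set
      Inv v k m = k ≡ st v × m ≡ mm v v
      inv-get : ∀ {v k m} → Inv v k m → lookup (regs m) r ≡ v
      inv-get {v} (_ , refl) = get v v
      inv-body : ∀ {v k m} → Inv (suc v) k m → ∃[ k′ ] ∃[ m′ ] (Run F k (setReg m r v) t k′ m′ × Inv v k′ m′)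
      inv-body {v} (refl , refl) = st v , mm v v ,
        subst (λ m → Run F (st (suc v)) m t (st v) (mm v v)) (sym (set (suc v) (suc v) v)) (body v v) , refl , refl
      final : ∃[ k ] ∃[ m ] (Run (for r F) (st T) (mm T T) (T * (2 + t) + 2) k m × Inv 0 k m) →
              Run (for r F) (st T) (mm T T) (T * (2 + t) + 2) (st 0) (mm 0 0)
      final (_ , _ , res , refl , refl) = res

-- The latest verdict wins. This is harmless because the component of a start configuration contains
-- a single halting configuration, so all verdicts of one tour agree.
note : Ans → Maybe Ans → Ans
note a nothing  = a
note _ (just a) = a

module Noted {D : Set} (verdict : D → Maybe Ans) (f : D → D) where

  noted : ℕ → D → Ans
  noted zero    x = dunno
  noted (suc i) x = note (noted i x) (verdict (iter f i x))

  noted-cases : ∀ i x → noted i x ≡ dunno ⊎ ∃[ j ] verdict (iter f j x) ≡ just (noted i x)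
  noted-cases zero    x = inj₁ refl
  noted-cases (suc i) x with verdict (iter f i x) in eq
  ... | nothing = noted-cases i x
  ... | just a  = inj₂ (i , eq)

  noted-some : ∀ i x {j b} → j < i → verdict (iter f j x) ≡ just b → ∃[ j′ ] verdict (iter f j′ x) ≡ just (noted i x)
  noted-some (suc i) x {j} (s≤s j≤i) h with verdict (iter f i x) in eq
  ... | just a  = i , eq
  ... | nothing with m≤n⇒m<n∨m≡n j≤i
  ...   | inj₁ j<i  = noted-some i x j<i h
  ...   | inj₂ refl with () ← trans (sym h) eq

-- Each `decF` acts on a register that is 0 and thereby loads it with `cap r ∸ 1`. The first loop
-- leaves it at 0 again, so the same trick gives the way back exactly as many rounds.
roundF : ∀ {K : Set} ⦃ _ : Finite K ⦄ → Reg → Frag K K → Frag K K → Frag K K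
roundF r F G = carry (decF r) ⨾ for r F ⨾ carry (decF r) ⨾ for r G

module RoundTrip (cap : Reg → ℕ) {K D : Set} ⦃ _ : Finite K ⦄ {r : Reg} {F G : Frag (Ans × K) (Ans × K)}
                 (ctl : D → K) (rep : D → ℕ → Mem)
                 (get : ∀ x v → lookup (regs (rep x v)) r ≡ v)
                 (set : ∀ x v v′ → setReg (rep x v) r v′ ≡ rep x v′)
                 (verdict : D → Maybe Ans) (f g : D → D) (gf : ∀ x → g (f x) ≡ x)
                 (Ok : D → Set) (ok : ∀ x → Ok x → Ok (f x)) (t : ℕ) where
  open Semantics cap
  open Noted verdict f

  run-round : (∀ a x v → Ok x → Run F (a , ctl x) (rep x v) t (note a (verdict x) , ctl (f x)) (rep (f x) v)) →
              (∀ a x v → Ok x → Run G (a , ctl x) (rep x v) t (a , ctl (g x)) (rep (g x) v)) →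
              ∀ x → Ok x → let T = cap r ∸ 1 in
              Run (roundF r F G) (dunno , ctl x) (rep x 0)
                (1 + (T * (2 + t) + 2 + (1 + (T * (2 + t) + 2)))) (noted T x , ctl x) (rep x 0)
  run-round runF runG x okx =
    run-seq (run-carry (refill x)) (run-seq forward (run-seq (run-carry (refill (iter f T x))) backward))
    where
    T = cap r ∸ 1
    ok-iter : ∀ i → Ok (iter f i x)
    ok-iter zero    = okx
    ok-iter (suc i) = ok (iter f i x) (ok-iter i)
    refill : ∀ y → Run (decF r) _ (rep y 0) 1 _ (rep y T)
    refill y = land (set y 0 T) (run-fill (get y 0))
    forward : Run (for r F) (dunno , ctl x) (rep x T) (T * (2 + t) + 2) (noted T x , ctl (iter f T x)) (rep (iter f T x) 0)
    forward = Indexed.run-for-up (λ i → noted i x , ctl (iter f i x)) (λ i v → rep (iter f i x) v) t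
      (λ i v → get (iter f i x) v) (λ i v v′ → set (iter f i x) v v′)
      (λ i v → runF (noted i x) (iter f i x) v (ok-iter i)) T
    backward : Run (for r G) (noted T x , ctl (iter f T x)) (rep (iter f T x) T) (T * (2 + t) + 2) (noted T x , ctl x) (rep x 0)
    backward = Indexed.run-for-down (λ i → noted T x , ctl (iter f i x)) (λ i v → rep (iter f i x) v) t
      (λ i v → get (iter f i x) v) (λ i v v′ → set (iter f i x) v v′)
      (λ i v → subst (λ y → Run G (noted T x , ctl (iter f (suc i) x)) (rep (iter f (suc i) x) v) t (noted T x , ctl y) (rep y v))
                 (gf (iter f i x)) (runG (noted T x) (iter f (suc i) x) v (ok-iter (suc i)))) T

-- Counters on the work tape

data Op : Set where
  incO decO testO : Op

-- Binary arithmetic, least significant bit first, with a carry, a borrow, or a "seen a 1" flag.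
digit : Op → Bool → Bool → Bool × Bool
digit incO  true  true  = true  , false
digit incO  true  false = false , true
digit incO  false b     = false , b
digit decO  true  true  = false , false
digit decO  true  false = true  , true
digit decO  false b     = false , b
digit testO _     true  = true  , true
digit testO f     false = f     , false

digitIf : Bool → Op → Bool → Bool → Bool × Bool
digitIf true  op f b = digit op f b
digitIf false op f b = f , b

start-flag : Op → Bool
start-flag incO  = true
start-flag decO  = true
start-flag testO = false

⟦_⟧ : Bool → ℕ
⟦ true ⟧  = 1
⟦ false ⟧ = 0

-- Cell j of the work tape belongs to the register lay o, where o runs cyclically through the
-- offsets k, k ∸ 1, …, 0.
module Layout (k : ℕ) (lay : Fin (suc k) → Reg) where

  mine : Reg → Fin (suc k) → Bool
  mine r o = does (lay o ≟F r)

  sweep : Op → Reg → Fin (suc k) → Bool → List Bool → List Bool × Bool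
  sweep op r o f []       = [] , f
  sweep op r o f (b ∷ bs) =
    let f₁ , b₁ = digitIf (mine r o) op f b ; bs′ , f′ = sweep op r (down o) f₁ bs in b₁ ∷ bs′ , f′

  val : Reg → Fin (suc k) → List Bool → ℕ
  val r o []       = 0
  val r o (b ∷ bs) with mine r o
  ... | false = val r (down o) bs
  ... | true  = ⟦ b ⟧ + 2 * val r (down o) bs

  width : Reg → Fin (suc k) → ℕ → ℕ
  width r o zero    = 0
  width r o (suc m) = ⟦ mine r o ⟧ + width r (down o) m

  val< : ∀ r o bs → val r o bs < 2 ^ width r o (length bs)
  val< r o []       = s≤s z≤n
  val< r o (b ∷ bs) with mine r o
  ... | false = val< r (down o) bs
  ... | true  = bound b (val< r (down o) bs)
    where
    lem : ∀ v → 2 + 2 * v ≡ 2 * suc v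
    lem = solve-∀
    bound : ∀ b {v c} → v < c → ⟦ b ⟧ + 2 * v < 2 * c
    bound true  {v} v<c = ≤-trans (≤-reflexive (lem v)) (*-monoʳ-≤ 2 v<c)
    bound false {v} v<c = ≤-trans (n≤1+n _) (≤-trans (≤-reflexive (lem v)) (*-monoʳ-≤ 2 v<c))

  sweep-length : ∀ op r o f bs → length (proj₁ (sweep op r o f bs)) ≡ length bs
  sweep-length op r o f []       = refl
  sweep-length op r o f (b ∷ bs) with mine r o
  ... | false = cong suc (sweep-length op r (down o) f bs)
  ... | true  = cong suc (sweep-length op r (down o) _ bs)

  sweep-other : ∀ op r r′ → r′ ≢ r → ∀ o f bs → val r′ o (proj₁ (sweep op r o f bs)) ≡ val r′ o bs
  sweep-other op r r′ ne o f []       = refl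
  sweep-other op r r′ ne o f (b ∷ bs) with lay o ≟F r | lay o ≟F r′
  ... | yes refl | yes refl = contradiction refl ne
  ... | yes refl | no _ = sweep-other op r r′ ne (down o) _ bs
  ... | no _ | yes refl = cong (λ v → ⟦ b ⟧ + 2 * v) (sweep-other op r r′ ne (down o) f bs)
  ... | no _ | no _ = sweep-other op r r′ ne (down o) f bs

  -- A conservation law: the outgoing carry weighs as much as the capacity of the cells passed. It
  -- holds for either carry, which is what the induction requires; overflow is excluded only
  -- afterwards, in `inc-exact`.
  sweep-inc : ∀ r o f bs → let bs′ , f′ = sweep incO r o f bs in
              val r o bs′ + ⟦ f′ ⟧ * 2 ^ width r o (length bs) ≡ val r o bs + ⟦ f ⟧
  sweep-inc r o f []       = *-identityʳ ⟦ f ⟧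
  sweep-inc r o f (b ∷ bs) with mine r o
  ... | false = sweep-inc r (down o) f bs
  ... | true  = cell (proj₁ (digit incO f b)) (proj₂ (digit incO f b)) {val r (down o) bs}
      {val r (down o) (proj₁ rest)} {⟦ proj₂ rest ⟧} {2 ^ width r (down o) (length bs)} (table f b) (sweep-inc r (down o) _ bs)
    where
    rest = sweep incO r (down o) (proj₁ (digit incO f b)) bs
    table : ∀ f b → let f₁ , b₁ = digit incO f b in ⟦ b₁ ⟧ + 2 * ⟦ f₁ ⟧ ≡ ⟦ b ⟧ + ⟦ f ⟧
    table true  true  = refl
    table true  false = refl
    table false true  = refl
    table false false = refl
    cell : ∀ f₁ b₁ {v v′ F c} → ⟦ b₁ ⟧ + 2 * ⟦ f₁ ⟧ ≡ ⟦ b ⟧ + ⟦ f ⟧ → v′ + F * c ≡ v + ⟦ f₁ ⟧ →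
           (⟦ b₁ ⟧ + 2 * v′) + F * (2 * c) ≡ (⟦ b ⟧ + 2 * v) + ⟦ f ⟧
    cell f₁ b₁ {v} {v′} {F} {c} p q = trans (l₁ ⟦ b₁ ⟧ v′ F c) (trans (cong (λ z → ⟦ b₁ ⟧ + 2 * z) q)
      (trans (l₂ ⟦ b₁ ⟧ v ⟦ f₁ ⟧) (trans (cong (_+ 2 * v) p) (l₃ ⟦ b ⟧ ⟦ f ⟧ v))))
      where
      l₁ : ∀ b v F c → (b + 2 * v) + F * (2 * c) ≡ b + 2 * (v + F * c)
      l₁ = solve-∀
      l₂ : ∀ b v f → b + 2 * (v + f) ≡ (b + 2 * f) + 2 * v
      l₂ = solve-∀
      l₃ : ∀ b f v → (b + f) + 2 * v ≡ (b + 2 * v) + f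
      l₃ = solve-∀

  sweep-dec : ∀ r o f bs → let bs′ , f′ = sweep decO r o f bs in
              val r o bs′ + ⟦ f ⟧ ≡ val r o bs + ⟦ f′ ⟧ * 2 ^ width r o (length bs)
  sweep-dec r o f []       = sym (*-identityʳ ⟦ f ⟧)
  sweep-dec r o f (b ∷ bs) with mine r o
  ... | false = sweep-dec r (down o) f bs
  ... | true  = cell (proj₁ (digit decO f b)) (proj₂ (digit decO f b)) {val r (down o) bs}
      {val r (down o) (proj₁ rest)} {⟦ proj₂ rest ⟧} {2 ^ width r (down o) (length bs)} (table f b) (sweep-dec r (down o) _ bs)
    where
    rest = sweep decO r (down o) (proj₁ (digit decO f b)) bs
    table : ∀ f b → let f₁ , b₁ = digit decO f b in ⟦ b₁ ⟧ + ⟦ f ⟧ ≡ ⟦ b ⟧ + 2 * ⟦ f₁ ⟧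
    table true  true  = refl
    table true  false = refl
    table false true  = refl
    table false false = refl
    cell : ∀ f₁ b₁ {v v′ F c} → ⟦ b₁ ⟧ + ⟦ f ⟧ ≡ ⟦ b ⟧ + 2 * ⟦ f₁ ⟧ → v′ + ⟦ f₁ ⟧ ≡ v + F * c →
           (⟦ b₁ ⟧ + 2 * v′) + ⟦ f ⟧ ≡ (⟦ b ⟧ + 2 * v) + F * (2 * c)
    cell f₁ b₁ {v} {v′} {F} {c} p q = trans (l₁ ⟦ b₁ ⟧ v′ ⟦ f ⟧) (trans (cong (_+ 2 * v′) p)
      (trans (l₂ ⟦ b ⟧ v′ ⟦ f₁ ⟧) (trans (cong (λ z → ⟦ b ⟧ + 2 * z) q) (l₃ ⟦ b ⟧ v F c))))
      where
      l₁ : ∀ b v f → (b + 2 * v) + f ≡ (b + f) + 2 * v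
      l₁ = solve-∀
      l₂ : ∀ b v f → (b + 2 * f) + 2 * v ≡ b + 2 * (v + f)
      l₂ = solve-∀
      l₃ : ∀ b v F c → b + 2 * (v + F * c) ≡ (b + 2 * v) + F * (2 * c)
      l₃ = solve-∀

  sweep-test-cells : ∀ r o f bs → proj₁ (sweep testO r o f bs) ≡ bs
  sweep-test-cells r o f []       = refl
  sweep-test-cells r o f (b ∷ bs) with mine r o
  ... | false = cong (b ∷_) (sweep-test-cells r (down o) f bs)
  sweep-test-cells r o f (true  ∷ bs) | true = cong (true ∷_) (sweep-test-cells r (down o) true bs)
  sweep-test-cells r o f (false ∷ bs) | true = cong (false ∷_) (sweep-test-cells r (down o) f bs)

  sweep-test-seen : ∀ r o bs → proj₂ (sweep testO r o true bs) ≡ true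
  sweep-test-seen r o []       = refl
  sweep-test-seen r o (b ∷ bs) with mine r o
  ... | false = sweep-test-seen r (down o) bs
  sweep-test-seen r o (true  ∷ bs) | true = sweep-test-seen r (down o) bs
  sweep-test-seen r o (false ∷ bs) | true = sweep-test-seen r (down o) bs

  sweep-test₀ : ∀ r o bs → val r o bs ≡ 0 → proj₂ (sweep testO r o false bs) ≡ false
  sweep-test₀ r o []       _ = refl
  sweep-test₀ r o (b ∷ bs) p with mine r o
  ... | false = sweep-test₀ r (down o) bs p
  sweep-test₀ r o (false ∷ bs) p | true = sweep-test₀ r (down o) bs (m+n≡0⇒m≡0 _ p)

  sweep-test₊ : ∀ r o bs → val r o bs ≢ 0 → proj₂ (sweep testO r o false bs) ≡ true
  sweep-test₊ r o []       p = contradiction refl p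
  sweep-test₊ r o (b ∷ bs) p with mine r o
  ... | false = sweep-test₊ r (down o) bs p
  sweep-test₊ r o (true  ∷ bs) p | true = sweep-test-seen r (down o) bs
  sweep-test₊ r o (false ∷ bs) p | true = sweep-test₊ r (down o) bs (λ q → p (cong (2 *_) q))

  first : Fin (suc k)
  first = fromℕ k

  inc-exact : ∀ r bs → let c = 2 ^ width r first (length bs) in
              suc (val r first bs) < c → val r first (proj₁ (sweep incO r first true bs)) ≡ suc (val r first bs)
  inc-exact r bs lt with sweep incO r first true bs | sweep-inc r first true bs
  ... | bs′ , false | eq = trans (sym (+-identityʳ _)) (trans eq (+-comm _ 1))
  ... | bs′ , true  | eq = contradiction lt (≤⇒≯ (≤-trans (m≤n+m _ (val r first bs′))
          (≤-reflexive (trans (cong (val r first bs′ +_) (sym (+-identityʳ _))) (trans eq (+-comm _ 1))))))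

  dec-exact : ∀ r bs {v} → val r first bs ≡ suc v → val r first (proj₁ (sweep decO r first true bs)) ≡ v
  dec-exact r bs {v} p with sweep decO r first true bs | sweep-dec r first true bs | sweep-length decO r first true bs
  ... | bs′ , false | eq | _ = suc-injective (trans (+-comm 1 _) (trans eq (trans (+-identityʳ _) p)))
  -- A borrow out of the last cell would make the new value at least the capacity, against `val<`.
  ... | bs′ , true  | eq | len = contradiction (val< r first bs′) (≤⇒≯ (≤-trans (≤-reflexive (cong (λ l → 2 ^ width r first l) len))
          (≤-trans (m≤n+m _ v) (≤-reflexive (suc-injective (sym
            (trans (+-comm 1 _) (trans eq (trans (cong₂ _+_ p (+-identityʳ _)) refl)))))))))

  fill-exact : ∀ r bs → val r first bs ≡ 0 →
               val r first (proj₁ (sweep decO r first true bs)) ≡ 2 ^ width r first (length bs) ∸ 1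
  fill-exact r bs p with sweep decO r first true bs | sweep-dec r first true bs
  ... | bs′ , false | eq = contradiction (trans (+-comm 1 _) (trans eq (trans (+-identityʳ _) p))) λ ()
  ... | bs′ , true  | eq = trans (sym (m+n∸n≡m _ 1)) (cong (_∸ 1) (trans eq (trans (cong (_+ 1 * 2 ^ width r first (length bs)) p) (+-identityʳ _))))

-- Compiling counter programs into catalytic machines

module Compile (P : Frag ⊤ Ans) (k : ℕ) (lay : Fin (suc k) → Reg) where
  open Layout k lay

  Micro : Set
  Micro = ⊤ ⊎ (Fin (suc k) × Bool) ⊎ Bool

  pattern idle        = inj₁ tt
  pattern sweeping o f = inj₂ (inj₁ (o , f))
  pattern back f      = inj₂ (inj₂ f)

  States : Set
  States = (St P × Micro) ⊎ Ans

  fin-States : Finite States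
  fin-States = fin-⊎ ⦃ fin-× ⦃ fin-St P ⦄ ⦄

  resume : St P ⊎ Ans → States
  resume (inj₁ s) = inj₁ (s , idle)
  resume (inj₂ a) = inj₂ a

  Next : Set
  Next = States × TAct

  quiet : States → Bool → Move → Sym → Next
  quiet s b m c = s , stay , (b , m) , (bitOf c , stay)

  cell : Op → Reg → St P → Fin (suc k) → Bool → Sym → Sym → Next
  cell op r s o f (bit b) c =
    let f₁ , b₁ = digitIf (mine r o) op f b in quiet (inj₁ (s , sweeping (down o) f₁)) b₁ right c
  cell op r s o f lend c = quiet (inj₁ (s , back f)) false stay c
  cell op r s o f rend c = quiet (inj₁ (s , back f)) false left c

  rewind : St P → (Bool → States) → Bool → Sym → Sym → Next
  rewind s e f (bit b) c = quiet (inj₁ (s , back f)) b left c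
  rewind s e f lend    c = quiet (e f) false stay c
  rewind s e f rend    c = quiet (inj₁ (s , back f)) false left c

  sweepNext : Op → Reg → St P → (Bool → States) → Micro → Sym → Sym → Next
  sweepNext op r s e idle           w c = quiet (inj₁ (s , sweeping first (start-flag op))) false right c
  sweepNext op r s e (sweeping o f) w c = cell op r s o f w c
  sweepNext op r s e (back f)       w c = rewind s e f w c

  instrNext : St P → Instr (St P ⊎ Ans) → Micro → Sym → Sym → Sym → Next
  instrNext s (io f)     _ i w c = let x , b , mi , mc = f i c in resume x , mi , (false , stay) , (b , mc)
  instrNext s (inc r x)  μ i w c = sweepNext incO r s (λ _ → resume x) μ w c
  instrNext s (dec r x)  μ i w c = sweepNext decO r s (λ _ → resume x) μ w c
  instrNext s (test r g) μ i w c = sweepNext testO r s (λ f → resume (g f)) μ w c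

  nextOf : States → Sym → Sym → Sym → Next
  nextOf (inj₁ (s , μ)) i w c = instrNext s (code P s) μ i w c
  nextOf (inj₂ a)       i w c = quiet (inj₂ a) false stay c

  haltS : States → Maybe Ans
  haltS (inj₁ _) = nothing
  haltS (inj₂ a) = just a

  machine : Machine
  machine = record
    { q = size fin-States ; start = to fin-States (inj₁ (enter P tt , idle))
    ; halt = λ i → haltS (from fin-States i)
    ; δ = λ j i w c → let s , mi , (bw , mw) , (bc , mc) = nextOf (from fin-States j) i w c in
        record { next = to fin-States s ; workWrite = bw ; catWrite = bc ; inMove = mi ; workMove = mw ; catMove = mc } }

  open Graph machine using (_↝[_]_; here; next; ↝-trans; vstep; vstep-running; V; module Sized)

  at-state : States → Tapes → V
  at-state s t = to fin-States s , t

  machine-step : ∀ {s μ} t → let s′ , a = nextOf (inj₁ (s , μ)) (proj₁ (syms t)) (proj₁ (proj₂ (syms t))) (proj₂ (proj₂ (syms t))) in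
                 vstep (at-state (inj₁ (s , μ)) t) ≡ just (at-state s′ (tact a t))
  machine-step {s} {μ} t@(i , w , c) = trans (vstep-running t (cong haltS (from-to fin-States (inj₁ (s , μ)))))
    (cong (λ st → let s′ , a = nextOf st (zread i) (zread w) (zread c) in just (to fin-States s′ , tact a t)) (from-to fin-States (inj₁ (s , μ))))

  quiet-step : ∀ {s μ t s′ b m} → nextOf (inj₁ (s , μ)) (zread (proj₁ t)) (zread (proj₁ (proj₂ t))) (zread (proj₂ (proj₂ t)))
                 ≡ quiet s′ b m (zread (proj₂ (proj₂ t))) →
               vstep (at-state (inj₁ (s , μ)) t) ≡ just (at-state s′ (proj₁ t , zact b m (proj₁ (proj₂ t)) , proj₂ (proj₂ t)))
  quiet-step {s} {μ} {t@(i , w , c)} {s′} {b} {m} eq = trans (machine-step t)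
    (trans (cong (λ (s , a) → just (at-state s (tact a t))) eq)
           (cong (λ c → just (at-state s′ (i , zact b m w , c))) (zwrite-same c)))

  module _ (op : Op) (r : Reg) (s : St P) (e : Bool → States)
           (is : ∀ μ i w c → nextOf (inj₁ (s , μ)) i w c ≡ sweepNext op r s e μ w c) where

    sweep-path : ∀ i c o f l bs → let bs′ , f′ = sweep op r o f bs in ∃[ o′ ]
      at-state (inj₁ (s , sweeping o f)) (i , popR l bs , c) ↝[ length bs ]
      at-state (inj₁ (s , sweeping o′ f′)) (i , atR (bs′ ʳ++ l) , c)
    sweep-path i c o f l []       = o , here
    sweep-path i c o f l (b ∷ bs) =
      let f₁ , b₁ = digitIf (mine r o) op f b ; o′ , p = sweep-path i c (down o) f₁ (b₁ ∷ l) bs in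
      o′ , next (quiet-step {m = right} (is (sweeping o f) _ _ _)) p

    back-path : ∀ i c f l r′ →
      at-state (inj₁ (s , back f)) (i , popL l r′ , c) ↝[ length l ] at-state (inj₁ (s , back f)) (i , atL (l ʳ++ r′) , c)
    back-path i c f []      r′ = here
    back-path i c f (b ∷ l) r′ = next (quiet-step {m = left} (is (back f) _ _ _)) (back-path i c f l (b ∷ r′))

    -- The two passes take `length bs` steps each; the other three leave the left marker, bounce off
    -- the right one, and finish at the left one.
    whole-sweep : ∀ i c bs → let bs′ , f′ = sweep op r first (start-flag op) bs in
      at-state (inj₁ (s , idle)) (i , atL bs , c) ↝[ 3 + 2 * length bs ] at-state (e f′) (i , atL bs′ , c)
    whole-sweep i c bs = subst (λ n → at-state (inj₁ (s , idle)) (i , atL bs , c) ↝[ n ] at-state (e f′) (i , atL bs′ , c)) count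
      (next (quiet-step {m = right} (is idle _ _ _))
        (↝-trans (proj₂ swept) (next (quiet-step {m = left} (is (sweeping (proj₁ swept) f′) _ _ _))
          (↝-trans (back-path i c f′ (reverse bs′) [])
            (next (subst (λ xs → vstep (at-state (inj₁ (s , back f′)) (i , atL xs , c)) ≡ just (at-state (e f′) (i , atL bs′ , c)))
                     (sym (reverse-involutive bs′)) (quiet-step {m = stay} (is (back f′) _ _ _))) here)))))
      where
      bs′ = proj₁ (sweep op r first (start-flag op) bs)
      f′  = proj₂ (sweep op r first (start-flag op) bs)
      swept = sweep-path i c first (start-flag op) [] bs
      count : suc (length bs + suc (length (reverse bs′) + 1)) ≡ 3 + 2 * length bs
      count rewrite length-reverse bs′ | sweep-length op r first (start-flag op) bs = arith (length bs)
        where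
        arith : ∀ a → suc (a + suc (a + 1)) ≡ 3 + 2 * a
        arith = solve-∀

  -- `S` does not occur in `machine`: the end markers tell the head where to turn, and the
  -- capacities of the registers are imposed by whatever work tape is supplied.
  module Simulation (S : ℕ) where

    cap : Reg → ℕ
    cap r = 2 ^ width r first S

    open Semantics cap

    record Holds (bs : List Bool) (m : Mem) : Set where
      constructor holds
      field
        len  : length bs ≡ S
        vals : ∀ r → lookup (regs m) r ≡ val r first bs

    holds-update : ∀ {bs m} op r v → Holds bs m →
      val r first (proj₁ (sweep op r first (start-flag op) bs)) ≡ v →
      Holds (proj₁ (sweep op r first (start-flag op) bs)) (setReg m r v)
    holds-update {bs} {m} op r v (holds len vals) eq = holds (trans (sweep-length op r first _ bs) len) lemma
      where
      lemma : ∀ r′ → lookup (regs m [ r ]≔ v) r′ ≡ val r′ first (proj₁ (sweep op r first (start-flag op) bs))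
      lemma r′ with r′ ≟F r
      ... | yes refl = trans (lookup∘update r (regs m) v) (sym eq)
      ... | no ne = trans (lookup∘update′ ne (regs m) v) (trans (vals r′) (sym (sweep-other op r r′ ne first _ bs)))

    tapes : Mem → List Bool → Tapes
    tapes m bs = input m , atL bs , cat m

    Reaches : St P → Mem → List Bool → St P ⊎ Ans → Mem → Set
    Reaches s m bs x m′ = ∃[ t ] ∃[ bs′ ] (t ≤ 3 + 2 * S × Holds bs′ m′ ×
      at-state (inj₁ (s , idle)) (tapes m bs) ↝[ t ] at-state (resume x) (tapes m′ bs′))

    exec-path : ∀ s {ins m x m′} bs → code P s ≡ ins → Exec ins m x m′ → Holds bs m → Reaches s m bs x m′
    exec-path s {ins} {m} bs eq ex h@(holds refl vals) = by-cases ex eq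
      where
      swept : ∀ op r e → (∀ μ i w c → instrNext s ins μ i w c ≡ sweepNext op r s e μ w c) → code P s ≡ ins →
        let bs′ , f′ = sweep op r first (start-flag op) bs in
        at-state (inj₁ (s , idle)) (tapes m bs) ↝[ 3 + 2 * length bs ] at-state (e f′) (tapes m bs′)
      swept op r e is eq = whole-sweep op r s e (λ μ i w c → trans (cong (λ k → instrNext s k μ i w c) eq) (is μ i w c)) (input m) (cat m) bs
      tested : ∀ r (g : Bool → St P ⊎ Ans) b → proj₂ (sweep testO r first false bs) ≡ b →
        (∀ μ i w c → instrNext s ins μ i w c ≡ sweepNext testO r s (resume ∘ g) μ w c) → code P s ≡ ins → Reaches s m bs (g b) m
      tested r g b flag is eq = _ , bs , ≤-refl , h ,
        subst₂ (λ f xs → at-state (inj₁ (s , idle)) (tapes m bs) ↝[ 3 + 2 * length bs ] at-state (resume (g f)) (tapes m xs))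
          flag (sweep-test-cells r first false bs) (swept testO r (resume ∘ g) is eq)
      by-cases : ∀ {x m′} → Exec ins m x m′ → code P s ≡ ins → Reaches s m bs x m′
      by-cases (io {f}) eq = 1 , bs , s≤s z≤n , holds refl vals ,
        next (trans (machine-step {s} {idle} (tapes m bs))
          (cong (λ c → let s′ , a = instrNext s c idle (zread (input m)) lend (zread (cat m)) in
                       just (at-state s′ (tact a (tapes m bs)))) eq)) here
      by-cases (inc {r} {x} lt) eq = _ , _ , ≤-refl ,
        holds-update incO r _ h (trans (inc-exact r bs (subst (λ v → suc v < _) (vals r) lt)) (cong suc (sym (vals r)))) ,
        swept incO r (λ _ → resume x) (λ _ _ _ _ → refl) eq
      by-cases (dec {r} {x} {v = v} p) eq = _ , _ , ≤-refl ,
        holds-update decO r v h (dec-exact r bs (trans (sym (vals r)) p)) , swept decO r (λ _ → resume x) (λ _ _ _ _ → refl) eq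
      by-cases (fill {r} {x} p) eq = _ , _ , ≤-refl ,
        holds-update decO r _ h (fill-exact r bs (trans (sym (vals r)) p)) , swept decO r (λ _ → resume x) (λ _ _ _ _ → refl) eq
      by-cases (test₀ {r} {g} p) eq =
        tested r g false (sweep-test₀ r first bs (trans (sym (vals r)) p)) (λ _ _ _ _ → refl) eq
      by-cases (test₊ {r} {g} p) eq =
        tested r g true (sweep-test₊ r first bs (λ q → contradiction (trans (sym p) (trans (vals r) q)) λ ())) (λ _ _ _ _ → refl) eq

    runs-path : ∀ {x m t a m′} bs → Runs (code P) x m t a m′ → Holds bs m →
      ∃[ t′ ] ∃[ bs′ ] (t′ ≤ t * (3 + 2 * S) ×
        at-state (resume x) (tapes m bs) ↝[ t′ ] at-state (inj₂ a) (tapes m′ bs′))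
    runs-path bs stop       h = 0 , bs , z≤n , here
    runs-path bs (go {s} ex r) h =
      let t₁ , bs₁ , b₁ , h₁ , p₁ = exec-path s bs refl ex h
          t₂ , bs₂ , b₂ , p₂ = runs-path bs₁ r h₁
      in t₁ + t₂ , bs₂ , +-mono-≤ b₁ b₂ , ↝-trans p₁ p₂

-- Simulating the tapes with counters

-- rP and rQ hold the distances of the simulated catalytic head from the two ends of its tape,
-- rL and rR the parts of the simulated work tape on either side of its head, rC the clock;
-- rA and rW are scratch.
pattern rP = zero
pattern rQ = suc zero
pattern rL = suc (suc zero)
pattern rR = suc (suc (suc zero))
pattern rC = suc (suc (suc (suc zero)))
pattern rA = suc (suc (suc (suc (suc zero))))
pattern rW = suc (suc (suc (suc (suc (suc zero)))))

memory : Zip → Zip → (p q l r c a w : ℕ) → Mem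
memory i z p q l r c a w = mem i z (p ∷ q ∷ l ∷ r ∷ c ∷ a ∷ w ∷ [])

-- Bijective base 2: the empty stack is 0, so emptiness is a zero test.
enc : List Bool → ℕ
enc []       = 0
enc (b ∷ bs) = suc (⟦ b ⟧ + 2 * enc bs)

enc-bound : ∀ bs → 2 + enc bs ≤ 2 ^ suc (length bs)
enc-bound []       = ≤-refl
enc-bound (b ∷ bs) = ≤-trans (lemma b) (*-monoʳ-≤ 2 (enc-bound bs))
  where
  double : ∀ v → 4 + 2 * v ≡ 2 * (2 + v)
  double = solve-∀
  lemma : ∀ b → 3 + (⟦ b ⟧ + 2 * enc bs) ≤ 2 * (2 + enc bs)
  lemma true  = ≤-reflexive (double (enc bs))
  lemma false = ≤-trans (n≤1+n _) (≤-reflexive (double (enc bs)))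

transfer : Reg → Reg → Frag ⊤ ⊤
transfer a b = for a (incF b)

pushF : Reg → Frag Bool ⊤
pushF x = carry (for x (incF rA ⨾ incF rA)) ⨾ carry (incF rA) ⨾
          dimap (λ b → if b then inj₁ tt else inj₂ tt) id (choice (incF rA) (nop id)) ⨾ transfer rA x

-- Subtracts two at a time and collects the quotient in `rA`. The place where `x` is found to be
-- exhausted, between the two subtractions or before them, is the remainder.
halveF : Reg → Frag ⊤ Bool
halveF x = loop (branch x ⨾ choice
  (decF x ⨾ branch x ⨾ choice (decF x ⨾ dimap id inj₁ (incF rA)) (nop (λ _ → inj₂ true)))
  (nop (λ _ → inj₂ false)))

popF : Reg → Sym → Frag ⊤ Sym
popF x e = branch x ⨾ choice (decF x ⨾ halveF x ⨾ dimap id bit (carry (transfer rA x))) (nop (λ _ → e))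

pushSymF : Reg → Frag Sym ⊤
pushSymF x = dimap (λ { (bit b) → inj₁ b ; _ → inj₂ tt }) id (choice (pushF x) (nop id))

-- The written symbol, sorted by the direction in which the head really moves.
classify : Sym × (Bool × Move) → Sym ⊎ (Sym ⊎ Sym)
classify (s , b , m) with eff m s
... | stay  = inj₁ (written b s)
... | right = inj₂ (inj₁ (written b s))
... | left  = inj₂ (inj₂ (written b s))

-- The symbol under the head lives in the control, the rest of the tape in two stacks. A move pushes
-- the old symbol on one side and pops the new one from the other. End markers are never stored:
-- pushing one does nothing, and popping an empty stack produces one.
workF : Frag (Sym × (Bool × Move)) Sym
workF = dimap classify id (choice (nop id) (choice (pushSymF rL ⨾ popF rR rend) (pushSymF rR ⨾ popF rL lend)))

-- On a simulated end marker the real head stands just outside the window, on a foreign cell or on a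
-- real marker. Such a cell must be rewritten with its own bit.
bitFor : Sym → Sym → Bool
bitFor (bit b) _ = b
bitFor _       c = bitOf c

writeF : Move → Frag Sym ⊤
writeF m = ioF λ s _ c → tt , bitFor s c , stay , m

readCatF : Frag ⊤ Sym
readCatF = ioF λ _ _ c → c , bitOf c , stay , stay

catF : Frag (Sym × (Bool × Move)) Sym
catF = dimap classify id (choice (dimap (λ s → s , s) proj₁ (Sym ⊗ writeF stay)) (choice
  (writeF right ⨾ incF rP ⨾ decF rQ ⨾ branch rQ ⨾ choice readCatF (nop (λ _ → rend)))
  (writeF left  ⨾ decF rP ⨾ incF rQ ⨾ branch rP ⨾ choice readCatF (nop (λ _ → lend)))))

inputF : Frag Move Sym
inputF = ioF (λ m _ c → tt , bitOf c , m , stay) ⨾ ioF (λ _ i c → i , bitOf c , stay , stay)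

_⊛_ : ∀ {A B C D : Set} ⦃ _ : Finite C ⦄ ⦃ _ : Finite B ⦄ → Frag A B → Frag C D → Frag (A × C) (B × D)
_⊛_ {B = B} {C = C} F G = dimap (λ (a , c) → c , a) (λ (c , b) → b , c) (C ⊗ F) ⨾ (B ⊗ G)

actF : Frag (Syms × TAct) Syms
actF = dimap (λ { ((si , sw , sc) , (mi , w , c)) → mi , (sw , w) , (sc , c) }) id (inputF ⊛ (workF ⊛ catF))

-- The bit under the head enters neither `lval` nor `rval`, as the control holds it. The two
-- distances always satisfy `pos z + rpos z ≡ suc (zsize z)`.
lval rval pos rpos zsize : Zip → ℕ
lval (atL r)    = 0
lval (at l b r) = enc l
lval (atR l)    = enc l
rval (atL r)    = enc r
rval (at l b r) = enc r
rval (atR l)    = 0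
pos (atL r)     = 0
pos (at l b r)  = suc (length l)
pos (atR l)     = suc (length l)
rpos (atL r)    = suc (length r)
rpos (at l b r) = suc (length r)
rpos (atR l)    = 0
zsize (atL r)    = length r
zsize (at l b r) = length l + suc (length r)
zsize (atR l)    = length l

zsize-popR : ∀ l r → zsize (popR l r) ≡ length l + length r
zsize-popR l []      = sym (+-identityʳ _)
zsize-popR l (b ∷ r) = refl

zsize-popL : ∀ l r → zsize (popL l r) ≡ length l + length r
zsize-popL []      r = refl
zsize-popL (b ∷ l) r = +-suc _ _

zsize-zmove : ∀ m z → zsize (zmove m z) ≡ zsize z
zsize-zmove left  (atL r)    = refl
zsize-zmove left  (at l b r) = zsize-popL l (b ∷ r)
zsize-zmove left  (atR l)    = trans (zsize-popL l []) (+-identityʳ _)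
zsize-zmove stay  z          = refl
zsize-zmove right (atL r)    = zsize-popR [] r
zsize-zmove right (at l b r) = trans (zsize-popR (b ∷ l) r) (sym (+-suc _ _))
zsize-zmove right (atR l)    = refl

zsize-zact : ∀ b m z → zsize (zact b m z) ≡ zsize z
zsize-zact b m z = trans (zsize-zmove m (zwrite b z)) (same z)
  where
  same : ∀ z → zsize (zwrite b z) ≡ zsize z
  same (atL _)    = refl
  same (at _ _ _) = refl
  same (atR _)    = refl

module Correct (cap : Reg → ℕ) where
  open Semantics cap

  -- Isolates two registers and hides the rest of the memory in `f`, so that the arithmetic
  -- fragments are verified once for all pairs of registers and all surroundings.
  record View (a b : Reg) (f : ℕ → ℕ → Mem) : Set where
    field
      getᵃ : ∀ u v → lookup (regs (f u v)) a ≡ u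
      getᵇ : ∀ u v → lookup (regs (f u v)) b ≡ v
      setᵃ : ∀ u v u′ → setReg (f u v) a u′ ≡ f u′ v
      setᵇ : ∀ u v v′ → setReg (f u v) b v′ ≡ f u v′

    flipped : View b a (λ v u → f u v)
    flipped = record { getᵃ = λ v u → getᵇ u v ; getᵇ = λ v u → getᵃ u v
                     ; setᵃ = λ v u v′ → setᵇ u v v′ ; setᵇ = λ v u u′ → setᵃ u v u′ }

    incᵇ : ∀ {u v} → suc v < cap b → Run (incF b) tt (f u v) 1 tt (f u (suc v))
    incᵇ {u} {v} lt = land
      (trans (setᵇ u v _) (cong (λ w → f u (suc w)) (getᵇ u v)))
      (run-inc (subst (λ w → suc w < cap b) (sym (getᵇ u v)) lt))

    decᵃ : ∀ {u v} → Run (decF a) tt (f (suc u) v) 1 tt (f u v)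
    decᵃ {u} {v} = land (setᵃ (suc u) v u) (run-dec (getᵃ (suc u) v))

    for-step : ∀ {K : Set} ⦃ _ : Finite K ⦄ {F : Frag K K} {k k′ : K} {u v T m′} →
               Run F k (f u v) T k′ m′ → Run F k (setReg (f (suc u) v) a u) T k′ m′
    for-step {F = F} {k} {k′} {u} {v} {T} {m′} = subst (λ m → Run F k m T k′ m′) (sym (setᵃ (suc u) v u))

    run-transfer : ∀ n v → n + v < cap b → Run (transfer a b) tt (f n v) (n * 3 + 2) tt (f 0 (n + v))
    run-transfer n v lt
      with _ , _ , res , _ , refl , refl ← run-for {r = a} {P = incF b} (λ u _ m → ∃[ w ] (u + w ≡ n + v × m ≡ f u w)) 1
             (λ { {u} (w , _ , refl) → getᵃ u w })
             (λ { {u} (w , e , refl) → tt , f u (suc w) ,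
                  for-step (incᵇ (≤-<-trans (≤-trans (m≤n+m (suc w) u) (≤-reflexive (trans (+-suc u w) e))) lt)) ,
                  suc w , trans (+-suc u w) e , refl })
             n (v , refl , refl)
      = res

    private
      two : ∀ u w → 2 * u + suc (suc w) ≡ 2 * suc u + w
      two = solve-∀

    run-double : ∀ n v → 2 * n + v < cap b → Run (for a (incF b ⨾ incF b)) tt (f n v) (n * 4 + 2) tt (f 0 (2 * n + v))
    run-double n v lt
      with _ , _ , res , _ , refl , refl ← run-for {r = a} {P = incF b ⨾ incF b} (λ u _ m → ∃[ w ] (2 * u + w ≡ 2 * n + v × m ≡ f u w)) 2
             (λ { {u} (w , _ , refl) → getᵃ u w })
             (λ { {u} (w , e , refl) →
                  let e′ = trans (two u w) e
                      lt₂ = ≤-<-trans (≤-trans (m≤n+m (suc (suc w)) (2 * u)) (≤-reflexive e′)) lt in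
                  tt , f u (suc (suc w)) ,
                  for-step (run-seq (incᵇ (<-trans (n<1+n _) lt₂)) (incᵇ lt₂)) ,
                  suc (suc w) , e′ , refl })
             n (v , refl , refl)
      = res

  open View

  module Stack {x : Reg} {f : ℕ → ℕ → Mem} (V : View x rA f) (X : ℕ) (X<x : X < cap x) (X<A : X < cap rA) where

    run-push : ∀ b v → suc (⟦ b ⟧ + 2 * v) ≤ X → Run (pushF x) b (f v 0) (7 * X + 6) tt (f (suc (⟦ b ⟧ + 2 * v)) 0)
    run-push b v le = land (cong (λ w → f w 0) (+-identityʳ _))
      (weaken time (run-seq (run-carry (run-double V v 0 (≤-<-trans le₂ X<A)))
      (run-seq (run-carry (incᵇ V (≤-<-trans le₁ X<A)))
      (run-seq (run-dimap (λ b → if b then inj₁ tt else inj₂ tt) id (add b le))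
               (run-transfer (flipped V) (suc (⟦ b ⟧ + 2 * v)) 0 (≤-<-trans (≤-trans (≤-reflexive (+-identityʳ _)) le) X<x))))))
      where
      le₁ : suc (2 * v + 0) ≤ X
      le₁ = ≤-trans (s≤s (≤-trans (≤-reflexive (+-identityʳ _)) (m≤n+m _ ⟦ b ⟧))) le
      le₂ : 2 * v + 0 ≤ X
      le₂ = ≤-trans (n≤1+n _) le₁
      add : ∀ b → suc (⟦ b ⟧ + 2 * v) ≤ X →
            Run (choice (incF rA) (nop id)) (if b then inj₁ tt else inj₂ tt) (f 0 (suc (2 * v + 0))) 1 tt (f 0 (suc (⟦ b ⟧ + 2 * v)))
      add true  le rewrite +-identityʳ (2 * v) = run-choice₁ (incᵇ V (≤-<-trans le X<A))
      add false le rewrite +-identityʳ (2 * v) = run-choice₂ (run-nop id)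
      time : v * 4 + 2 + (1 + (1 + (suc (⟦ b ⟧ + 2 * v) * 3 + 2))) ≤ 7 * X + 6
      time = ≤-trans (+-mono-≤ (+-monoˡ-≤ 2 (*-monoˡ-≤ 4 (≤-trans (m≤m+n v _) (≤-trans (m≤n+m _ (suc ⟦ b ⟧)) le))))
                               (s≤s (s≤s (+-monoˡ-≤ 2 (*-monoˡ-≤ 3 le))))) (≤-reflexive (arith X))
        where
        arith : ∀ X → X * 4 + 2 + (1 + (1 + (X * 3 + 2))) ≡ 7 * X + 6
        arith = solve-∀

    run-halve : ∀ b v w → v + w < cap rA → Run (halveF x) tt (f (⟦ b ⟧ + 2 * v) w) (v * 5 + 4) b (f 0 (v + w))
    run-halve true  zero w lt = run-loop-stop (run-seq (run-branch₊ (getᵃ V 1 w)) (run-choice₁ (run-seq (decᵃ V)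
      (run-seq (run-branch₀ (getᵃ V 0 w)) (run-choice₂ (run-nop _))))))
    run-halve false zero w lt = weaken (s≤s (s≤s z≤n))
      (run-loop-stop (run-seq (run-branch₀ (getᵃ V 0 w)) (run-choice₂ (run-nop _))))
    run-halve b (suc v) w lt = subst₂ (λ i o → Run (halveF x) tt (f i w) (suc v * 5 + 4) b (f 0 o)) (sym (two ⟦ b ⟧ v)) (+-suc v w)
      (run-loop-more
        (run-seq (run-branch₊ (getᵃ V _ w)) (run-choice₁ (run-seq (decᵃ V) (run-seq (run-branch₊ (getᵃ V _ w))
           (run-choice₁ (run-seq (decᵃ V) (run-dimap id inj₁ (incᵇ V (≤-<-trans (s≤s (m≤n+m w v)) lt)))))))))
        (run-halve b v (suc w) (subst (_< cap rA) (sym (+-suc v w)) lt)))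
      where
      two : ∀ b v → b + 2 * suc v ≡ suc (suc (b + 2 * v))
      two = solve-∀

    run-pop-empty : ∀ e → Run (popF x e) tt (f 0 0) (8 * X + 8) e (f 0 0)
    run-pop-empty e = weaken (≤-trans (s≤s (s≤s z≤n)) (m≤n+m 8 (8 * X))) (run-seq (run-branch₀ (getᵃ V 0 0)) (run-choice₂ (run-nop _)))

    run-pop : ∀ e b v → v ≤ X → Run (popF x e) tt (f (suc (⟦ b ⟧ + 2 * v)) 0) (8 * X + 8) (bit b) (f v 0)
    run-pop e b v le = land (cong (λ w → f w 0) (trans (+-identityʳ _) (+-identityʳ v)))
      (weaken time (run-seq (run-branch₊ (getᵃ V _ 0)) (run-choice₁ (run-seq (decᵃ V)
        (run-seq (run-halve b v 0 (≤-<-trans v0 X<A)) (run-dimap id bit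
          (run-carry (run-transfer (flipped V) (v + 0) 0 (≤-<-trans (≤-trans (≤-reflexive (+-identityʳ _)) v0) X<x)))))))))
      where
      v0 : v + 0 ≤ X
      v0 = ≤-trans (≤-reflexive (+-identityʳ v)) le
      time : 1 + (1 + (v * 5 + 4 + ((v + 0) * 3 + 2))) ≤ 8 * X + 8
      time = ≤-trans (s≤s (s≤s (+-mono-≤ (+-monoˡ-≤ 4 (*-monoˡ-≤ 5 le)) (+-monoˡ-≤ 2 (*-monoˡ-≤ 3 v0))))) (≤-reflexive (arith X))
        where
        arith : ∀ X → 1 + (1 + (X * 5 + 4 + (X * 3 + 2))) ≡ 8 * X + 8
        arith = solve-∀

module Act (cap : Reg → ℕ) (s N : ℕ)
           (capL : 2 ^ suc s < cap rL) (capR : 2 ^ suc s < cap rR) (capA : 2 ^ suc s < cap rA)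
           (capP : suc N < cap rP) (capQ : suc N < cap rQ) where
  open Semantics cap
  open Correct cap

  X : ℕ
  X = 2 ^ suc s

  enc≤X : ∀ l → length l ≤ s → enc l ≤ X
  enc≤X l le = ≤-trans (m≤n+m (enc l) 2) (≤-trans (enc-bound l) (^-monoʳ-≤ 2 (s≤s le)))

  viewL : ∀ i c p q r cl w → View rL rA (λ u v → memory i c p q u r cl v w)
  viewL i c p q r cl w = record
    { getᵃ = λ _ _ → refl ; getᵇ = λ _ _ → refl ; setᵃ = λ _ _ _ → refl ; setᵇ = λ _ _ _ → refl }

  viewR : ∀ i c p q l cl w → View rR rA (λ u v → memory i c p q l u cl v w)
  viewR i c p q l cl w = record
    { getᵃ = λ _ _ → refl ; getᵇ = λ _ _ → refl ; setᵃ = λ _ _ _ → refl ; setᵇ = λ _ _ _ → refl }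

  module Work (i c : Zip) (p q cl w : ℕ) where

    holding : Zip → Mem
    holding z = memory i c p q (lval z) (rval z) cl 0 w

    run-popR : ∀ l r → length r ≤ s →
      Run (popF rR rend) tt (memory i c p q (enc l) (enc r) cl 0 w) (8 * X + 8) (zread (popR l r)) (holding (popR l r))
    run-popR l []      le = Stack.run-pop-empty (viewR i c p q (enc l) cl w) X capR capA rend
    run-popR l (b ∷ r) le = Stack.run-pop (viewR i c p q (enc l) cl w) X capR capA rend b (enc r)
                              (enc≤X r (≤-trans (n≤1+n _) le))

    run-popL : ∀ l r → length l ≤ s →
      Run (popF rL lend) tt (memory i c p q (enc l) (enc r) cl 0 w) (8 * X + 8) (zread (popL l r)) (holding (popL l r))
    run-popL []      r le = Stack.run-pop-empty (viewL i c p q (enc r) cl w) X capL capA lend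
    run-popL (b ∷ l) r le = Stack.run-pop (viewL i c p q (enc r) cl w) X capL capA lend b (enc l)
                              (enc≤X l (≤-trans (n≤1+n _) le))

    run-pushL : ∀ b l r → suc (length l) ≤ s →
      Run (pushSymF rL) (bit b) (memory i c p q (enc l) (enc r) cl 0 w) (7 * X + 6) tt (memory i c p q (enc (b ∷ l)) (enc r) cl 0 w)
    run-pushL b l r le = run-dimap _ id (run-choice₁
      (Stack.run-push (viewL i c p q (enc r) cl w) X capL capA b (enc l) (enc≤X (b ∷ l) le)))

    run-pushR : ∀ b l r → suc (length r) ≤ s →
      Run (pushSymF rR) (bit b) (memory i c p q (enc l) (enc r) cl 0 w) (7 * X + 6) tt (memory i c p q (enc l) (enc (b ∷ r)) cl 0 w)
    run-pushR b l r le = run-dimap _ id (run-choice₁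
      (Stack.run-push (viewR i c p q (enc l) cl w) X capR capA b (enc r) (enc≤X (b ∷ r) le)))

    workTime : ℕ
    workTime = 7 * X + 6 + (8 * X + 8)

    private
      1≤push : 1 ≤ 7 * X + 6
      1≤push = ≤-trans (s≤s z≤n) (m≤n+m 6 (7 * X))
      1≤time : 1 ≤ workTime
      1≤time = ≤-trans 1≤push (m≤m+n _ _)

      stay-case : ∀ (e : Sym) m → Run (nop id) e m workTime e m
      stay-case e m = weaken 1≤time (run-nop id)

      goR-case : ∀ {e m₁ m₂ o m₃} → Run (pushSymF rL) e m₁ (7 * X + 6) tt m₂ → Run (popF rR rend) tt m₂ (8 * X + 8) o m₃ →
                 Run (choice (nop id) (choice (pushSymF rL ⨾ popF rR rend) (pushSymF rR ⨾ popF rL lend))) (inj₂ (inj₁ e)) m₁ workTime o m₃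
      goR-case a b = run-choice₂ (run-choice₁ (run-seq a b))

      goL-case : ∀ {e m₁ m₂ o m₃} → Run (pushSymF rR) e m₁ (7 * X + 6) tt m₂ → Run (popF rL lend) tt m₂ (8 * X + 8) o m₃ →
                 Run (choice (nop id) (choice (pushSymF rL ⨾ popF rR rend) (pushSymF rR ⨾ popF rL lend))) (inj₂ (inj₂ e)) m₁ workTime o m₃
      goL-case a b = run-choice₂ (run-choice₂ (run-seq a b))

    run-work : ∀ z b m → zsize z ≡ s →
      Run workF (zread z , b , m) (holding z) workTime (zread (zact b m z)) (holding (zact b m z))
    run-work (atL r)    b left  _ = run-dimap classify id (run-choice₁ (stay-case _ _))
    run-work (atL r)    b stay  _ = run-dimap classify id (run-choice₁ (stay-case _ _))
    run-work (atL r)    b right e = run-dimap classify id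
      (goR-case (weaken 1≤push (run-dimap _ id (run-choice₂ (run-nop id)))) (run-popR [] r (≤-reflexive e)))
    run-work (at l x r) b left  e = run-dimap classify id
      (goL-case (run-pushR b l r (≤-trans (m≤n+m _ _) (≤-reflexive e))) (run-popL l (b ∷ r) (≤-trans (m≤m+n _ _) (≤-reflexive e))))
    run-work (at l x r) b stay  _ = run-dimap classify id (run-choice₁ (stay-case _ _))
    run-work (at l x r) b right e = run-dimap classify id
      (goR-case (run-pushL b l r (≤-trans (s≤s (m≤m+n _ _)) (≤-reflexive (trans (sym (+-suc _ _)) e))))
                (run-popR (b ∷ l) r (≤-trans (≤-trans (n≤1+n _) (m≤n+m _ _)) (≤-reflexive e))))
    run-work (atR l)    b left  e = run-dimap classify id
      (goL-case (weaken 1≤push (run-dimap _ id (run-choice₂ (run-nop id)))) (run-popL l [] (≤-reflexive e)))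
    run-work (atR l)    b stay  _ = run-dimap classify id (run-choice₁ (stay-case _ _))
    run-work (atR l)    b right _ = run-dimap classify id (run-choice₁ (stay-case _ _))

  module Cat (pre post : List Bool) (i : Zip) (l r cl w : ℕ) where

    showing : Zip → Mem
    showing z = memory i (window pre post z) (pos z) (rpos z) l r cl 0 w

    run-readR : ∀ ls rs → Run (branch rQ ⨾ choice readCatF (nop (λ _ → rend))) tt
      (memory i (window pre post (popR ls rs)) (suc (length ls)) (length rs) l r cl 0 w) 2 (zread (popR ls rs)) (showing (popR ls rs))
    run-readR ls []       = run-seq (run-branch₀ refl) (run-choice₂ (run-nop _))
    run-readR ls (b ∷ rs) = run-seq (run-branch₊ refl) (run-choice₁ (run-keep refl))

    run-readL : ∀ ls rs → Run (branch rP ⨾ choice readCatF (nop (λ _ → lend))) tt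
      (memory i (window pre post (popL ls rs)) (length ls) (suc (length rs)) l r cl 0 w) 2 (zread (popL ls rs)) (showing (popL ls rs))
    run-readL []       rs = run-seq (run-branch₀ refl) (run-choice₂ (run-nop _))
    run-readL (b ∷ ls) rs = run-seq (run-branch₊ refl) (run-choice₁ (run-io _))

    run-write : ∀ b m z → zmove m (window pre post (zwrite b z)) ≡ window pre post (zact b m z) →
      ∀ p q → Run (writeF m) (written b (zread z)) (memory i (window pre post z) p q l r cl 0 w) 1 tt
                (memory i (window pre post (zact b m z)) p q l r cl 0 w)
    run-write b m z moved p q = land
      (cong (λ c → memory i c p q l r cl 0 w) (trans (cong (zmove m) (written-window z)) moved)) (run-io _)
      where
      written-window : ∀ z → zwrite (bitFor (written b (zread z)) (zread (window pre post z))) (window pre post z) ≡ window pre post (zwrite b z)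
      written-window (atL r)    = zwrite-same (popL pre (r ++ post))
      written-window (at _ _ _) = refl
      written-window (atR l)    = zwrite-same (popR (l ++ pre) post)

    private
      stay-case : ∀ b z {z′} → z′ ≡ zact b stay z → showing z′ ≡ memory i (window pre post z′) (pos z) (rpos z) l r cl 0 w →
        Run (dimap (λ s → s , s) proj₁ (Sym ⊗ writeF stay)) (written b (zread z)) (showing z) 5 (written b (zread z)) (showing z′)
      stay-case b z refl eq = land (sym eq)
        (weaken (s≤s z≤n) (run-dimap (λ s → s , s) proj₁ (run-⊗ (run-write b stay z refl (pos z) (rpos z)))))

      right-case : ∀ b z → zread (zwrite b z) ≢ rend → ∀ ls rs → zact b right z ≡ popR ls rs → pos z ≡ length ls → rpos z ≡ suc (length rs) →
        suc (length ls) ≤ suc N →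
        Run (writeF right ⨾ incF rP ⨾ decF rQ ⨾ branch rQ ⨾ choice readCatF (nop (λ _ → rend))) (written b (zread z)) (showing z) 5
          (zread (popR ls rs)) (showing (popR ls rs))
      right-case b z ne ls rs eq p q le rewrite p | q =
        run-seq (land (cong (λ z → memory i (window pre post z) (length ls) (suc (length rs)) l r cl 0 w) eq)
                  (run-write b right z (window-right pre post (zwrite b z) ne) (length ls) (suc (length rs))))
          (run-seq (run-inc (≤-<-trans le capP)) (run-seq (run-dec refl) (run-readR ls rs)))

      left-case : ∀ b z → zread (zwrite b z) ≢ lend → ∀ ls rs → zact b left z ≡ popL ls rs → pos z ≡ suc (length ls) → rpos z ≡ length rs →
        suc (length rs) ≤ suc N →
        Run (writeF left ⨾ decF rP ⨾ incF rQ ⨾ branch rP ⨾ choice readCatF (nop (λ _ → lend))) (written b (zread z)) (showing z) 5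
          (zread (popL ls rs)) (showing (popL ls rs))
      left-case b z ne ls rs eq p q le rewrite p | q =
        run-seq (land (cong (λ z → memory i (window pre post z) (suc (length ls)) (length rs) l r cl 0 w) eq)
                  (run-write b left z (window-left pre post (zwrite b z) ne) (suc (length ls)) (length rs)))
          (run-seq (run-dec refl) (run-seq (run-inc (≤-<-trans le capQ)) (run-readL ls rs)))

    run-cat : ∀ z b m → zsize z ≡ N →
      Run catF (zread z , b , m) (showing z) 5 (zread (zact b m z)) (showing (zact b m z))
    run-cat z@(atL rs)     b left  _ = run-dimap classify id (run-choice₁ (stay-case b z refl refl))
    run-cat z@(atL rs)     b stay  _ = run-dimap classify id (run-choice₁ (stay-case b z refl refl))
    run-cat z@(atL rs)     b right e = run-dimap classify id (run-choice₂ (run-choice₁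
      (right-case b z (λ ()) [] rs refl refl refl (s≤s z≤n))))
    run-cat z@(at ls x rs) b left  e = run-dimap classify id (run-choice₂ (run-choice₂
      (left-case b z (λ ()) ls (b ∷ rs) refl refl refl (s≤s (≤-trans (m≤n+m _ _) (≤-reflexive e))))))
    run-cat z@(at ls x rs) b stay  _ = run-dimap classify id (run-choice₁ (stay-case b z refl refl))
    run-cat z@(at ls x rs) b right e = run-dimap classify id (run-choice₂ (run-choice₁
      (right-case b z (λ ()) (b ∷ ls) rs refl refl refl (s≤s (≤-trans (s≤s (m≤m+n _ _)) (≤-reflexive (trans (sym (+-suc _ _)) e)))))))
    run-cat z@(atR ls)     b left  e = run-dimap classify id (run-choice₂ (run-choice₂
      (left-case b z (λ ()) ls [] refl refl refl (s≤s z≤n))))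
    run-cat z@(atR ls)     b stay  _ = run-dimap classify id (run-choice₁ (stay-case b z refl refl))
    run-cat z@(atR ls)     b right _ = run-dimap classify id (run-choice₁ (stay-case b z refl refl))

  run-input : ∀ i c v m → Run inputF m (mem i c v) 2 (zread (zmove m i)) (mem (zmove m i) c v)
  run-input i c v m = run-seq (run-keep refl) (run-keep refl)

  run-⊛ : ∀ {A B C D : Set} ⦃ _ : Finite C ⦄ ⦃ _ : Finite B ⦄ {F : Frag A B} {G : Frag C D} {a b c d m m₁ m₂ T T′} →
          Run F a m T b m₁ → Run G c m₁ T′ d m₂ → Run (F ⊛ G) (a , c) m (T + T′) (b , d) m₂
  run-⊛ f g = run-seq (run-dimap (λ (a , c) → c , a) (λ (c , b) → b , c) (run-⊗ f)) (run-⊗ g)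

  Fits : Tapes → Set
  Fits (i , w , c) = zsize w ≡ s × zsize c ≡ N

  fits-tact : ∀ a t → Fits t → Fits (tact a t)
  fits-tact (mi , (bw , mw) , (bc , mc)) (i , w , c) (e , e′) = trans (zsize-zact bw mw w) e , trans (zsize-zact bc mc c) e′

  represent : List Bool → List Bool → Tapes → ℕ → Mem
  represent pre post (i , w , c) cl = memory i (window pre post c) (pos c) (rpos c) (lval w) (rval w) cl 0 0

  actTime : ℕ
  actTime = 2 + (7 * X + 6 + (8 * X + 8) + 5)

  run-act : ∀ pre post t a cl → Fits t →
    Run actF (syms t , a) (represent pre post t cl) actTime (syms (tact a t)) (represent pre post (tact a t) cl)
  run-act pre post (i , w , c) (mi , (bw , mw) , (bc , mc)) cl (e , e′) = run-dimap _ id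
    (run-⊛ (run-input i _ _ mi)
      (run-⊛ (Work.run-work (zmove mi i) (window pre post c) (pos c) (rpos c) cl 0 w bw mw e)
             (Cat.run-cat pre post (zmove mi i) (lval (zact bw mw w)) (rval (zact bw mw w)) cl 0 c bc mc e′)))

-- The clocked tour as a program

scanF rewindF lapF mulF shiftF : Frag ⊤ ⊤
scanF = loop (incF rQ ⨾ ioF λ { _ rend c → inj₂ tt , bitOf c , stay , stay
                             ; _ _    c → inj₁ tt , bitOf c , right , stay })
rewindF = loop (ioF λ { _ lend c → inj₂ tt , bitOf c , stay , stay
                      ; _ _    c → inj₁ tt , bitOf c , left , stay })
-- rQ += n + 2, one for each position of the input head
lapF = scanF ⨾ rewindF
mulF = transfer rQ rA ⨾ for rA lapF
shiftF = for rQ (incF rP ⨾ ioF (λ _ _ c → tt , bitOf c , stay , right)) ⨾ transfer rP rQ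

powF : ℕ → Frag ⊤ ⊤
powF zero    = nop id
powF (suc k) = mulF ⨾ powF k

-- Prepares the counters for the start configuration. `rQ` becomes `(n + 2) ^ k + 1`, the distance
-- between the two markers of the window. `rR` becomes the code of `s` zeros, which in bijective
-- base 2 is `2 ^ s ∸ 1`, precisely the value to which `rW` wraps around.
initF : ℕ → Frag ⊤ ⊤
initF k = incF rQ ⨾ powF k ⨾ incF rQ ⨾ decF rW ⨾ transfer rW rR

absorb : ∀ v w n → v * n + (n + w) ≡ suc v * n + w
absorb = solve-∀

enc-zeros : ∀ s → suc (enc (replicate s false)) ≡ 2 ^ s
enc-zeros zero    = refl
enc-zeros (suc s) = trans (double (enc (replicate s false))) (cong (2 *_) (enc-zeros s))
  where
  double : ∀ v → suc (suc (2 * v)) ≡ 2 * suc v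
  double = solve-∀

_orElse_ : Ans → Ans → Ans
dunno orElse b = b
acc   orElse b = acc
rej   orElse b = rej

retry? : Ans → ⊤ ⊎ Ans
retry? dunno = inj₁ tt
retry? a     = inj₂ a

module TourF (M : Machine) where
  open Machine M
  open Graph M hiding (next)

  Ctl : Set
  Ctl = Fin (suc K) × Fin q × Syms

  -- Crossing an arc forwards takes one simulated action. Going backwards takes two, because a
  -- candidate can be refuted only after the heads have moved back; `settle` then chooses between
  -- returning the heads and restoring the overwritten bits.
  decide : Ctl → Ctl ⊎ (((Fin K × Fin q) × (Syms × TAct)) ⊎ ((Fin K × Fin q) × (Syms × TAct)))
  decide (out , p , s) with halt p
  ... | just _  = inj₁ (out , p , s)
  ... | nothing = let a = action (p , s) in inj₂ (inj₁ ((encD (p , s) , Action.next a) , (s , tactOf a)))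
  decide (inn d , p , s) with check₁ (decD d) p s
  ... | false = inj₁ (inn d , p , s)
  ... | true  = inj₂ (inj₂ ((d , p) , (s , keeping s (invs (effs (decD d))))))

  settle : (Fin K × Fin q) × Syms → (Fin (suc K) × Fin q) × (Syms × TAct)
  settle ((d , p) , s) with check₂ (decD d) s
  ... | false = (inn d , p) , (s , keeping s (effs (decD d)))
  ... | true  = (out , proj₁ (decD d)) , (s , rewriting (decD d))

  decide-halted : ∀ {p s a} → halt p ≡ just a → decide (out , p , s) ≡ inj₁ (out , p , s)
  decide-halted eq rewrite eq = refl

  decide-running : ∀ {p s} → halt p ≡ nothing →
    decide (out , p , s) ≡ inj₂ (inj₁ ((encD (p , s) , Action.next (action (p , s))) , (s , tactOf (action (p , s)))))
  decide-running eq rewrite eq = refl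

  decide-unchecked : ∀ {d p s} → check₁ (decD d) p s ≡ false → decide (inn d , p , s) ≡ inj₁ (inn d , p , s)
  decide-unchecked eq rewrite eq = refl

  decide-checked : ∀ {d p s} → check₁ (decD d) p s ≡ true →
    decide (inn d , p , s) ≡ inj₂ (inj₂ ((d , p) , (s , keeping s (invs (effs (decD d))))))
  decide-checked eq rewrite eq = refl

  settle-failed : ∀ {d p s} → check₂ (decD d) s ≡ false → settle ((d , p) , s) ≡ ((inn d , p) , (s , keeping s (effs (decD d))))
  settle-failed eq rewrite eq = refl

  settle-passed : ∀ {d p s} → check₂ (decD d) s ≡ true → settle ((d , p) , s) ≡ ((out , proj₁ (decD d)) , (s , rewriting (decD d)))
  settle-passed eq rewrite eq = refl

  flip-halted : ∀ {p t a} → halt p ≡ just a → flip ((p , t) , out) ≡ ((p , t) , out)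
  flip-halted {p} {t} eq = flip-out-nothing (vstep-stopped {p} {t} eq)

  flip-running : ∀ {p t} → halt p ≡ nothing → let a = action (p , syms t) in
    flip ((p , t) , out) ≡ ((Action.next a , tact (tactOf a) t) , inn (encD (p , syms t)))
  flip-running {p} {t} eq = flip-out-just (vstep-running t eq)

  flip-unchecked : ∀ {d p t} → check₁ (decD d) p (syms t) ≡ false → flip ((p , t) , inn d) ≡ ((p , t) , inn d)
  flip-unchecked {d} {p} {t} eq = flip-inn-nothing {d} (vundo-unchecked {decD d} {p} {t} eq)

  flip-failed : ∀ {d p t} → check₁ (decD d) p (syms t) ≡ true → check₂ (decD d) (syms (tmove (invs (effs (decD d))) t)) ≡ false →
    flip ((p , t) , inn d) ≡ ((p , t) , inn d)
  flip-failed {d} {p} {t} eq eq′ = flip-inn-nothing {d} (vundo-failed {decD d} {p} {t} eq eq′)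

  flip-passed : ∀ {d p t} → check₁ (decD d) p (syms t) ≡ true → check₂ (decD d) (syms (tmove (invs (effs (decD d))) t)) ≡ true →
    flip ((p , t) , inn d) ≡ ((proj₁ (decD d) , tact (rewriting (decD d)) (tmove (invs (effs (decD d))) t)) , out)
  flip-passed {d} {p} {t} eq eq′ = flip-inn-just {d} (vundo-passed {decD d} {p} {t} eq eq′)

  unpack : (Fin (suc K) × Fin q) × Syms → Ctl
  unpack ((e , p) , s) = e , p , s

  branches : Frag (Ctl ⊎ (((Fin K × Fin q) × (Syms × TAct)) ⊎ ((Fin K × Fin q) × (Syms × TAct)))) Ctl
  branches = choice (nop id) (choice
    (dimap id (λ { ((i , p) , s) → inn i , p , s }) ((Fin K × Fin q) ⊗ actF))
    (((Fin K × Fin q) ⊗ actF) ⨾ dimap settle unpack ((Fin (suc K) × Fin q) ⊗ actF)))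

  flipF : Frag Ctl Ctl
  flipF = dimap decide id branches

  fwdF bwdF : Frag (Ans × Ctl) (Ans × Ctl)
  fwdF = dimap (λ { (a , e , p , s) → note a (halt p) , e , p , s }) (λ { (a , e , p , s) → a , down e , p , s }) (Ans ⊗ flipF)
  bwdF = dimap (λ { (a , e , p , s) → a , up e , p , s }) id (Ans ⊗ flipF)

  tourF : Frag ⊤ Ans
  tourF = dimap (λ _ → dunno , out , start , lend , lend , lend) proj₁
    (roundF rC fwdF bwdF)

  mainF : ℕ → Frag ⊤ Ans
  mainF k = initF k ⨾ tourF ⨾ dimap retry? id
    (choice (shiftF ⨾ tourF) (nop id))

  ctl : Dart → Ctl
  ctl ((p , t) , e) = e , p , syms t

  verdict : Dart → Maybe Ans
  verdict ((p , t) , e) = halt p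

  open Noted verdict fwd public

  module Tours (cap : Reg → ℕ) (s N : ℕ)
               (capL : 2 ^ suc s < cap rL) (capR : 2 ^ suc s < cap rR) (capA : 2 ^ suc s < cap rA)
               (capP : suc N < cap rP) (capQ : suc N < cap rQ) where
    open Semantics cap
    open Correct cap
    open Act cap s N capL capR capA capP capQ

    rep : List Bool → List Bool → Dart → ℕ → Mem
    rep pre post ((p , t) , e) cl = represent pre post t cl

    FitsD : Dart → Set
    FitsD ((p , t) , e) = Fits t

    flipTime : ℕ
    flipTime = actTime + actTime

    private
      1≤flip : 1 ≤ flipTime
      1≤flip = ≤-trans (s≤s z≤n) (m≤m+n actTime actTime)

    fits-tmove : ∀ ms t → Fits t → Fits (tmove ms t)
    fits-tmove ms t f = subst Fits (tact-keeping ms t) (fits-tact (keeping (syms t) ms) t f)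

    run-keeping : ∀ pre post t ms cl → Fits t →
      Run actF (syms t , keeping (syms t) ms) (represent pre post t cl) actTime (syms (tmove ms t)) (represent pre post (tmove ms t) cl)
    run-keeping pre post t ms cl f = subst
      (λ t′ → Run actF (syms t , keeping (syms t) ms) (represent pre post t cl) actTime (syms t′) (represent pre post t′ cl))
      (tact-keeping ms t) (run-act pre post t (keeping (syms t) ms) cl f)

    run-flip : ∀ pre post x cl → FitsD x →
      Run flipF (ctl x) (rep pre post x cl) flipTime (ctl (flip x)) (rep pre post (flip x) cl)
    run-flip pre post x cl f = run-dimap decide id (by-cases x f)
      where
      Goal : Dart → Ctl ⊎ (((Fin K × Fin q) × (Syms × TAct)) ⊎ ((Fin K × Fin q) × (Syms × TAct))) → Dart → Set
      Goal x d y = Run branches d (rep pre post x cl) flipTime (ctl y) (rep pre post y cl)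

      idle : ∀ x → Goal x (inj₁ (ctl x)) x
      idle x = weaken 1≤flip (run-choice₁ (run-nop id))

      by-cases : ∀ x → FitsD x → Goal x (decide (ctl x)) (flip x)
      by-cases x@((p , t) , out) f = halted? (halt p) refl
        where
        halted? : ∀ r → halt p ≡ r → Goal x (decide (ctl x)) (flip x)
        halted? (just _) eq = subst₂ (Goal x) (sym (decide-halted eq)) (sym (flip-halted eq)) (idle x)
        halted? nothing  eq = subst₂ (Goal x) (sym (decide-running eq)) (sym (flip-running eq))
          (run-choice₂ (run-choice₁ (weaken (m≤m+n _ _) (run-dimap id _ (run-⊗ (run-act pre post t _ cl f))))))
      by-cases x@((p , t) , inn d) f = checked? _ refl
        where
        ms = effs (decD d)
        t₁ = tmove (invs ms) t
        f₁ = fits-tmove (invs ms) t f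

        Second : ((Fin K × Fin q) × Syms → (Fin (suc K) × Fin q) × (Syms × TAct)) → Dart → Set
        Second f y = Run (dimap f unpack ((Fin (suc K) × Fin q) ⊗ actF)) ((d , p) , syms t₁) (represent pre post t₁ cl) actTime (ctl y) (rep pre post y cl)

        -- `dimap` applies its first function only on entry, so that function may be exchanged for
        -- any other with the same value there.
        second : ∀ {e y} → settle ((d , p) , syms t₁) ≡ e → Second (λ _ → e) y → Second settle y
        second refl (within t≤ r) = within t≤ r

        result? : ∀ b → check₁ (decD d) p (syms t) ≡ true → check₂ (decD d) (syms t₁) ≡ b → Second settle (flip x)
        result? false c₁ c₂ = second {y = flip x} (settle-failed c₂) (subst (Second _)
          (sym (trans (flip-failed {d} {p} {t} c₁ c₂) (cong (λ t → (p , t) , inn d) (sym (tmove-invs (decD d) p t c₁)))))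
          (run-dimap _ unpack (run-⊗ (run-keeping pre post t₁ ms cl f₁))))
        result? true  c₁ c₂ = second {y = flip x} (settle-passed c₂) (subst (Second _) (sym (flip-passed {d} {p} {t} c₁ c₂))
          (run-dimap _ unpack (run-⊗ (run-act pre post t₁ (rewriting (decD d)) cl f₁))))

        checked? : ∀ b → check₁ (decD d) p (syms t) ≡ b → Goal x (decide (ctl x)) (flip x)
        checked? false eq = subst₂ (Goal x) (sym (decide-unchecked eq)) (sym (flip-unchecked {d} {p} {t} eq)) (idle x)
        checked? true  eq = subst (λ e → Goal x e (flip x)) (sym (decide-checked eq))
          (run-choice₂ (run-choice₂ (run-seq (run-⊗ (run-keeping pre post t (invs ms) cl f)) (result? _ eq refl))))

    fits-flip : ∀ x → FitsD x → FitsD (flip x)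
    fits-flip x@((p , t) , out) f = halted? (halt p) refl
      where
      halted? : ∀ r → halt p ≡ r → FitsD (flip x)
      halted? (just _) eq = subst FitsD (sym (flip-halted {p} {t} eq)) f
      halted? nothing  eq = subst FitsD (sym (flip-running {p} {t} eq)) (fits-tact (tactOf (action (p , syms t))) t f)
    fits-flip x@((p , t) , inn d) f = checked? _ _ refl refl
      where
      ms = effs (decD d)
      t₁ = tmove (invs ms) t
      checked? : ∀ b b′ → check₁ (decD d) p (syms t) ≡ b → check₂ (decD d) (syms t₁) ≡ b′ → FitsD (flip x)
      checked? false _     eq _   = subst FitsD (sym (flip-unchecked {d} {p} {t} eq)) f
      checked? true  false eq eq′ = subst FitsD (sym (flip-failed {d} {p} {t} eq eq′)) f
      checked? true  true  eq eq′ = subst FitsD (sym (flip-passed {d} {p} {t} eq eq′))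
        (fits-tact (rewriting (decD d)) t₁ (fits-tmove (invs ms) t f))

    run-fwd : ∀ pre post a x cl → FitsD x →
      Run fwdF (a , ctl x) (rep pre post x cl) flipTime (note a (verdict x) , ctl (fwd x)) (rep pre post (fwd x) cl)
    run-fwd pre post a x cl f = run-dimap _ _ (run-⊗ (run-flip pre post x cl f))

    run-bwd : ∀ pre post a x cl → FitsD x →
      Run bwdF (a , ctl x) (rep pre post x cl) flipTime (a , ctl (bwd x)) (rep pre post (bwd x) cl)
    run-bwd pre post a x cl f = run-dimap _ id (run-⊗ (run-flip pre post (unturn x) cl f))

    T : ℕ
    T = cap rC ∸ 1

    tourTime : ℕ
    tourTime = 1 + (T * (2 + flipTime) + 2 + (1 + (T * (2 + flipTime) + 2)))

    run-tour : ∀ pre post xs ws cs → let t = atL xs , atL ws , atL cs in Fits t →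
      Run tourF tt (represent pre post t 0) tourTime (noted T ((start , t) , out)) (represent pre post t 0)
    run-tour pre post xs ws cs f = run-dimap _ proj₁
      (RoundTrip.run-round cap ctl (rep pre post) (λ _ _ → refl) (λ _ _ _ → refl)
        verdict fwd bwd bwd-fwd FitsD fits-flip flipTime
        (run-fwd pre post) (run-bwd pre post) ((start , atL xs , atL ws , atL cs) , out) f)

  module Run-main (cap : Reg → ℕ) (s k : ℕ) (xs : List Bool)
               (capL : 2 ^ suc s < cap rL) (capR : 2 ^ suc s < cap rR) (capA : 2 ^ suc s < cap rA)
               (capP : suc ((length xs + 2) ^ k) < cap rP) (capQ : suc ((length xs + 2) ^ k) < cap rQ) (capA′ : suc ((length xs + 2) ^ k) < cap rA) (capW : cap rW ≡ 2 ^ s) where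
    n N : ℕ
    n = length xs
    N = (n + 2) ^ k

    open Semantics cap
    open Correct cap
    open View
    open Act cap s N capL capR capA capP capQ
    open Tours cap s N capL capR capA capP capQ

    module Start (c : Zip) where

      start-mem : Zip → ℕ → ℕ → Mem
      start-mem i q a = memory i c 0 q 0 0 0 a 0

      run-scan : ∀ l r q a → suc (length r) + q ≤ suc N →
        Run scanF tt (start-mem (popR l r) q a) (suc (length r) * 2) tt (start-mem (atR (r ʳ++ l)) (suc (length r) + q) a)
      run-scan l []      q a le = run-loop-stop (run-seq (run-inc (≤-<-trans le capQ))
        (run-keep refl))
      run-scan l (b ∷ r) q a le = land (cong (λ q → start-mem (atR (r ʳ++ (b ∷ l))) q a) (+-suc _ q))
        (run-loop-more (run-seq (run-inc (≤-<-trans (≤-trans (s≤s (m≤n+m q (suc (length r)))) le) capQ))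
          (run-keep refl))
          (run-scan (b ∷ l) r (suc q) a (subst (_≤ suc N) (sym (+-suc _ q)) le)))

      run-rewind : ∀ l r q a →
        Run rewindF tt (start-mem (popL l r) q a) (suc (length l)) tt (start-mem (atL (l ʳ++ r)) q a)
      run-rewind []      r q a = run-loop-stop
        (run-keep refl)
      run-rewind (b ∷ l) r q a = run-loop-more
        (run-keep refl)
        (run-rewind l (b ∷ r) q a)

      lapTime : ℕ
      lapTime = 2 + suc n * 2 + (1 + suc n)

      run-lap : ∀ q a → (n + 2) + q ≤ suc N → Run lapF tt (start-mem (atL xs) q a) lapTime tt (start-mem (atL xs) ((n + 2) + q) a)
      run-lap q a le = run-seq
        (land (cong (λ q → start-mem (atR (reverse xs)) q a) count)
          (run-loop-more (run-seq (run-inc (≤-<-trans (≤-trans (s≤s (m≤n+m q (suc n))) le′) capQ))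
            (run-keep refl))
            (run-scan [] xs (suc q) a (subst (_≤ suc N) (sym count) le))))
        (subst₂ (λ t i → Run rewindF tt (start-mem (atR (reverse xs)) ((n + 2) + q) a) t tt (start-mem (atL i) ((n + 2) + q) a))
          (cong (2 +_) (length-reverse xs)) (reverse-involutive xs)
          (run-loop-more
            (run-keep refl)
            (run-rewind (reverse xs) [] ((n + 2) + q) a)))
        where
        arith : ∀ n q → suc n + suc q ≡ (n + 2) + q
        arith = solve-∀
        count : suc n + suc q ≡ (n + 2) + q
        count = arith n q
        le′ : suc (suc n) + q ≤ suc N
        le′ = subst (_≤ suc N) (trans (sym count) (+-suc (suc n) q)) le

      viewQA : View rQ rA (λ u v → start-mem (atL xs) u v)
      viewQA = record { getᵃ = λ _ _ → refl ; getᵇ = λ _ _ → refl ; setᵃ = λ _ _ _ → refl ; setᵇ = λ _ _ _ → refl }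

      mulTime : ℕ
      mulTime = N * 3 + 2 + (N * (2 + lapTime) + 2)

      run-mul : ∀ q → q ≤ N → q * (n + 2) ≤ N → Run mulF tt (start-mem (atL xs) q 0) mulTime tt (start-mem (atL xs) (q * (n + 2)) 0)
      run-mul q q≤ le = weaken (+-mono-≤ (+-monoˡ-≤ 2 (*-monoˡ-≤ 3 q≤)) (+-monoˡ-≤ 2 (*-monoˡ-≤ (2 + lapTime) q≤)))
        (run-seq (run-transfer viewQA q 0 (≤-<-trans (≤-trans (≤-reflexive (+-identityʳ q)) (≤-trans q≤ (n≤1+n N))) capA′)) second)
        where
        second : Run (for rA lapF) tt (start-mem (atL xs) 0 (q + 0)) (q * (2 + lapTime) + 2) tt (start-mem (atL xs) (q * (n + 2)) 0)
        second rewrite +-identityʳ q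
          with _ , _ , r , w , e , refl ← run-for {r = rA} {P = lapF}
                 (λ v _ m → ∃[ w ] (v * (n + 2) + w ≡ q * (n + 2) × m ≡ start-mem (atL xs) w v)) lapTime
                 (λ { (_ , _ , refl) → refl })
                 (λ { {v} (w , e , refl) → let e′ = trans (absorb v w (n + 2)) e in
                      tt , _ , run-lap w v (≤-trans (≤-trans (m≤n+m (n + 2 + w) (v * (n + 2))) (≤-reflexive e′)) (≤-trans le (n≤1+n N))) , (n + 2) + w , e′ , refl })
                 q (0 , +-identityʳ _ , refl)
          with refl ← e = r

      run-pow : ∀ j q → q * (n + 2) ^ j ≤ N →
        Run (powF j) tt (start-mem (atL xs) q 0) (j * mulTime + 1) tt (start-mem (atL xs) (q * (n + 2) ^ j) 0)
      run-pow zero    q le = land (cong (λ q → start-mem (atL xs) q 0) (sym (*-identityʳ q))) (run-nop id)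
      run-pow (suc j) q le = weaken (≤-reflexive (sym (+-assoc mulTime (j * mulTime) 1)))
        (land (cong (λ q → start-mem (atL xs) q 0) (*-assoc q (n + 2) ((n + 2) ^ j)))
          (run-seq (run-mul q (≤-trans (m≤m*n q (n + 2)) le₁) le₁) (run-pow j (q * (n + 2)) le₂)))
        where
        instance
          nz : NonZero (n + 2)
          nz = >-nonZero (≤-trans (s≤s z≤n) (m≤n+m 2 n))
        le₂ : q * (n + 2) * (n + 2) ^ j ≤ N
        le₂ = ≤-trans (≤-reflexive (*-assoc q (n + 2) ((n + 2) ^ j))) le
        le₁ : q * (n + 2) ≤ N
        le₁ = ≤-trans (m≤m*n (q * (n + 2)) ((n + 2) ^ j) ⦃ m^n≢0 (n + 2) j ⦄) le₂

      initTime : ℕ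
      initTime = 1 + (k * mulTime + 1 + (1 + (1 + (2 ^ s * 3 + 2))))

      run-init : ∀ {q} → q ≡ suc N →
        Run (initF k) tt (start-mem (atL xs) 0 0) initTime tt (memory (atL xs) c 0 q 0 (enc (replicate s false)) 0 0 0)
      run-init refl = run-seq (run-inc (≤-<-trans (s≤s z≤n) capQ)) (run-seq pow (run-seq (run-inc capQ)
        (run-seq (run-fill refl) (weaken (+-monoˡ-≤ 2 (*-monoˡ-≤ 3 (≤-trans (m∸n≤m _ 1) (≤-reflexive capW))))
          (land (cong (λ v → memory (atL xs) c 0 (suc N) 0 v 0 0 0) zeros) (run-transfer viewWR (cap rW ∸ 1) 0 (≤-<-trans below capR)))))))
        where
        viewWR : View rW rR (λ u v → memory (atL xs) c 0 (suc N) 0 v 0 0 u)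
        viewWR = record { getᵃ = λ _ _ → refl ; getᵇ = λ _ _ → refl ; setᵃ = λ _ _ _ → refl ; setᵇ = λ _ _ _ → refl }
        pow : Run (powF k) tt (start-mem (atL xs) 1 0) (k * mulTime + 1) tt (start-mem (atL xs) N 0)
        pow = land (cong (λ q → start-mem (atL xs) q 0) (*-identityˡ N))
                (run-pow k 1 (≤-reflexive (*-identityˡ N)))
        zeros : (cap rW ∸ 1) + 0 ≡ enc (replicate s false)
        zeros = trans (+-identityʳ _) (trans (cong (_∸ 1) (trans capW (sym (enc-zeros s)))) refl)
        below : (cap rW ∸ 1) + 0 ≤ 2 ^ suc s
        below = ≤-trans (≤-reflexive (+-identityʳ _)) (≤-trans (m∸n≤m _ 1) (≤-trans (≤-reflexive capW) (m≤m+n _ _)))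

    shiftTime : ℕ
    shiftTime = suc N * 4 + 2 + (suc N * 3 + 2)

    run-shift : ∀ ys zs l r → length ys ≡ suc N →
      Run shiftF tt (memory (atL xs) (atL (ys ++ zs)) 0 (suc N) l r 0 0 0) shiftTime tt
        (memory (atL xs) (popL (reverse ys) zs) 0 (suc N) l r 0 0 0)
    run-shift ys zs l r len = run-seq moving
      (land (cong (λ q → memory (atL xs) (popL (reverse ys) zs) 0 q l r 0 0 0) (+-identityʳ (suc N)))
        (run-transfer viewPQ (suc N) 0 (≤-<-trans (≤-reflexive (+-identityʳ _)) capQ)))
      where
      viewPQ : View rP rQ (λ u v → memory (atL xs) (popL (reverse ys) zs) u v l r 0 0 0)
      viewPQ = record { getᵃ = λ _ _ → refl ; getᵇ = λ _ _ → refl ; setᵃ = λ _ _ _ → refl ; setᵇ = λ _ _ _ → refl }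
      F : Frag ⊤ ⊤
      F = incF rP ⨾ ioF (λ _ _ c → tt , bitOf c , stay , right)
      Inv : ℕ → ⊤ → Mem → Set
      Inv u _ m = ∃[ as ] ∃[ bs ] ∃[ p ] (p + u ≡ suc N × length bs ≡ u × bs ʳ++ as ≡ reverse ys ×
                    m ≡ memory (atL xs) (popL as (bs ++ zs)) p u l r 0 0 0)
      body : ∀ {u k m} → Inv (suc u) k m → ∃[ k′ ] ∃[ m′ ] (Run F k (setReg m rQ u) 2 k′ m′ × Inv u k′ m′)
      body {u} (as , b ∷ bs , p , e , e₁ , e₂ , refl) = tt , _ ,
        run-seq (run-inc (≤-<-trans (≤-trans (s≤s (m≤m+n p u)) (≤-reflexive (trans (sym (+-suc p u)) e))) capP))
          (land (cong (λ z → memory (atL xs) z (suc p) u l r 0 0 0) (right-popL as (b ∷ bs ++ zs))) (run-keep refl)) ,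
        b ∷ as , bs , suc p , trans (sym (+-suc p u)) e , suc-injective e₁ , e₂ , refl
      moving : Run (for rQ F) tt (memory (atL xs) (atL (ys ++ zs)) 0 (suc N) l r 0 0 0) (suc N * 4 + 2) tt
                 (memory (atL xs) (popL (reverse ys) zs) (suc N) 0 l r 0 0 0)
      moving with _ , _ , res , as , [] , p , e , _ , e₂ , refl ← run-for {r = rQ} {P = F} Inv 2
                    (λ { (_ , _ , _ , _ , _ , _ , refl) → refl }) body (suc N) ([] , ys , 0 , refl , len , refl , refl)
        with refl ← trans (sym (+-identityʳ p)) e with refl ← e₂ = res

    mainTime : ℕ
    mainTime = Start.initTime (atL xs) + (tourTime + (shiftTime + tourTime))

    zeros : List Bool
    zeros = replicate s false

    answer : List Bool → Ans
    answer τ = noted T ((start , atL xs , atL zeros , atL τ) , out)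

    -- Only the cells are claimed to be restored, since after a retry the head rests on `g`. This
    -- separator plays the left end marker of the second window; thanks to it the shift has length
    -- `suc N`, which `rQ` already holds.
    run-main : ∀ τ₀ g τ₁ post → length τ₀ ≡ N → length τ₁ ≡ N → ∃[ m ] (
      Run (mainF k) tt (memory (atL xs) (atL (τ₀ ++ g ∷ τ₁ ++ post)) 0 0 0 0 0 0 0) mainTime (answer τ₀ orElse answer τ₁) m ×
      cells (cat m) ≡ τ₀ ++ g ∷ τ₁ ++ post)
    run-main τ₀ g τ₁ post len₀ len₁ = finish (answer τ₀) refl
      where
      ys = τ₀ ++ g ∷ []
      zs = τ₁ ++ post
      fits : ∀ τ → length τ ≡ N → Fits (atL xs , atL zeros , atL τ)
      fits τ e = length-replicate s , e
      first : Run (initF k) tt (memory (atL xs) (atL (τ₀ ++ g ∷ τ₁ ++ post)) 0 0 0 0 0 0 0) (Start.initTime (atL xs)) tt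
                (represent [] (g ∷ τ₁ ++ post) (atL xs , atL zeros , atL τ₀) 0)
      first = Start.run-init (atL (τ₀ ++ g ∷ τ₁ ++ post)) (cong suc len₀)
      tour₀ : Run tourF tt (represent [] (g ∷ τ₁ ++ post) (atL xs , atL zeros , atL τ₀) 0) tourTime (answer τ₀)
                (represent [] (g ∷ τ₁ ++ post) (atL xs , atL zeros , atL τ₀) 0)
      tour₀ = run-tour [] (g ∷ τ₁ ++ post) xs zeros τ₀ (fits τ₀ len₀)
      ys≡ : ys ++ zs ≡ τ₀ ++ g ∷ τ₁ ++ post
      ys≡ = ++-assoc τ₀ (g ∷ []) zs
      len-ys : length ys ≡ suc N
      len-ys = trans (length-++ τ₀) (trans (+-comm (length τ₀) 1) (cong suc len₀))
      shifted : Run shiftF tt (represent [] (g ∷ τ₁ ++ post) (atL xs , atL zeros , atL τ₀) 0) shiftTime tt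
                  (represent (reverse ys) post (atL xs , atL zeros , atL τ₁) 0)
      shifted = subst₂ (λ m m′ → Run shiftF tt m shiftTime tt m′)
        (cong₂ (λ c q → memory (atL xs) (atL c) 0 q 0 (enc zeros) 0 0 0) ys≡ (cong suc (sym len₀)))
        (cong (λ q → memory (atL xs) (popL (reverse ys) zs) 0 q 0 (enc zeros) 0 0 0) (cong suc (sym len₁)))
        (run-shift ys zs 0 (enc zeros) len-ys)
      tour₁ : Run tourF tt (represent (reverse ys) post (atL xs , atL zeros , atL τ₁) 0) tourTime (answer τ₁)
                (represent (reverse ys) post (atL xs , atL zeros , atL τ₁) 0)
      tour₁ = run-tour (reverse ys) post xs zeros τ₁ (fits τ₁ len₁)
      rest : Frag Ans Ans
      rest = dimap retry? id (choice (shiftF ⨾ tourF) (nop id))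
      1≤ : 1 ≤ shiftTime + tourTime
      1≤ = ≤-trans (s≤s z≤n) (m≤m+n shiftTime tourTime)
      m₀ = represent [] (g ∷ τ₁ ++ post) (atL xs , atL zeros , atL τ₀) 0
      m₁ = represent (reverse ys) post (atL xs , atL zeros , atL τ₁) 0
      Result : Ans → Set
      Result a = ∃[ m ] (Run (mainF k) tt (memory (atL xs) (atL (τ₀ ++ g ∷ τ₁ ++ post)) 0 0 0 0 0 0 0) mainTime (a orElse answer τ₁) m ×
                   cells (cat m) ≡ τ₀ ++ g ∷ τ₁ ++ post)
      build : ∀ {a b m} → answer τ₀ ≡ a → Run rest a m₀ (shiftTime + tourTime) b m →
              Run (mainF k) tt (memory (atL xs) (atL (τ₀ ++ g ∷ τ₁ ++ post)) 0 0 0 0 0 0 0) mainTime b m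
      build refl r = run-seq first (run-seq tour₀ r)
      finish : ∀ a → answer τ₀ ≡ a → Result (answer τ₀)
      finish dunno eq = subst Result (sym eq) (m₁ , build eq (run-dimap _ id (run-choice₁ (run-seq shifted tour₁))) ,
        trans (cells-popL (reverse ys) zs) (trans (ʳ++-defn (reverse ys)) (trans (cong (_++ zs) (reverse-involutive ys)) ys≡)))
      finish acc   eq = subst Result (sym eq) (m₀ , build eq (weaken 1≤ (run-dimap _ id (run-choice₂ (run-nop id)))) , refl)
      finish rej   eq = subst Result (sym eq) (m₀ , build eq (weaken 1≤ (run-dimap _ id (run-choice₂ (run-nop id)))) , refl)

-- Counting seeds

Unique-lookup : ∀ {A : Set} {xs : List A} → Unique xs → ∀ {i j} → List.lookup xs i ≡ List.lookup xs j → i ≡ j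
Unique-lookup (p ∷ ps) {Fin.zero}  {Fin.zero}  eq = refl
Unique-lookup (p ∷ ps) {Fin.zero}  {Fin.suc j} eq = contradiction eq (All.lookup p (∈-lookup j))
Unique-lookup (p ∷ ps) {Fin.suc i} {Fin.zero}  eq = contradiction (sym eq) (All.lookup p (∈-lookup i))
Unique-lookup (p ∷ ps) {Fin.suc i} {Fin.suc j} eq = cong Fin.suc (Unique-lookup ps eq)

Unique-⊆-length : ∀ {A : Set} {xs ys : List A} → Unique xs → All (_∈ ys) xs → length xs ≤ length ys
Unique-⊆-length {xs = xs} {ys} u sub = injective⇒≤ {f = f} inj
  where
  f : Fin (length xs) → Fin (length ys)
  f i = index (All.lookup sub (∈-lookup i))
  inj : ∀ {i j} → f i ≡ f j → i ≡ j
  inj {i} {j} eq = Unique-lookup u (trans (lookup-index (All.lookup sub (∈-lookup i)))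
    (trans (cong (List.lookup ys) eq) (sym (lookup-index (All.lookup sub (∈-lookup j))))))

-- The acceptance condition asks for an explicit duplicate-free list of seeds, whereas probabilities
-- are easier to handle for predicates; `trues` and `count` connect the two.
trues : ∀ m → (Vec Bool m → Bool) → List (Vec Bool m)
trues zero    p with p []
... | true  = [] ∷ []
... | false = []
trues (suc m) p = map (true ∷_) (trues m (p ∘ (true ∷_))) ++ map (false ∷_) (trues m (p ∘ (false ∷_)))

count : ∀ m → (Vec Bool m → Bool) → ℕ
count zero    p with p []
... | true  = 1
... | false = 0
count (suc m) p = count m (p ∘ (true ∷_)) + count m (p ∘ (false ∷_))

length-trues : ∀ m p → length (trues m p) ≡ count m p
length-trues zero    p with p []
... | true  = refl
... | false = refl
length-trues (suc m) p = trans (length-++ (map (true ∷_) (trues m _)))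
  (cong₂ _+_ (trans (length-map (true ∷_) (trues m _)) (length-trues m _)) (trans (length-map (false ∷_) (trues m _)) (length-trues m _)))

trues-unique : ∀ m p → Unique (trues m p)
trues-unique zero    p with p []
... | true  = [] ∷ []
... | false = []
trues-unique (suc m) p = ++⁺ (map⁺ ∷-injectiveʳ (trues-unique m _)) (map⁺ ∷-injectiveʳ (trues-unique m _))
  λ (q , r) → let _ , _ , e = ∈-map⁻ (true ∷_) q ; _ , _ , e′ = ∈-map⁻ (false ∷_) r in
    contradiction (∷-injectiveˡ (trans (sym e) e′)) λ ()

trues-sound : ∀ m p → All (λ v → p v ≡ true) (trues m p)
trues-sound zero    p with p [] in eq
... | true  = eq ∷ []
... | false = []
trues-sound (suc m) p = Allₚ.++⁺ (Allₚ.map⁺ (trues-sound m _)) (Allₚ.map⁺ (trues-sound m _))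

trues-complete : ∀ m p v → p v ≡ true → v ∈ trues m p
trues-complete zero    p []          eq with p []
trues-complete zero    p []          refl | true = here refl
trues-complete (suc m) p (true ∷ v)  eq = ∈-++⁺ˡ (∈-map⁺ (true ∷_) (trues-complete m _ v eq))
trues-complete (suc m) p (false ∷ v) eq = ∈-++⁺ʳ (map (true ∷_) (trues m _)) (∈-map⁺ (false ∷_) (trues-complete m _ v eq))

length≤count : ∀ {m} p {xs : List (Vec Bool m)} → Unique xs → All (λ v → p v ≡ true) xs → length xs ≤ count m p
length≤count {m} p u all = ≤-trans (Unique-⊆-length u (All.map (trues-complete m p _) all)) (≤-reflexive (length-trues m p))

count-cong : ∀ m {p q} → (∀ v → p v ≡ q v) → count m p ≡ count m q
count-cong zero    {p} {q} eq with p [] | q [] | eq []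
... | true  | true  | _ = refl
... | false | false | _ = refl
count-cong (suc m) eq = cong₂ _+_ (count-cong m (eq ∘ (true ∷_))) (count-cong m (eq ∘ (false ∷_)))

count-false : ∀ m → count m (λ _ → false) ≡ 0
count-false zero    = refl
count-false (suc m) = cong₂ _+_ (count-false m) (count-false m)

count-true : ∀ m → count m (λ _ → true) ≡ 2 ^ m
count-true zero    = refl
count-true (suc m) = trans (cong₂ _+_ (count-true m) (count-true m)) (cong (2 ^ m +_) (sym (+-identityʳ _)))

count-not : ∀ m p → count m p + count m (not ∘ p) ≡ 2 ^ m
count-not zero    p with p []
... | true  = refl
... | false = refl
count-not (suc m) p = trans (swap (count m _) (count m _) (count m _) (count m _))
  (trans (cong₂ _+_ (count-not m _) (count-not m _)) (cong (2 ^ m +_) (sym (+-identityʳ _))))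
  where
  swap : ∀ a b c d → (a + b) + (c + d) ≡ (a + c) + (b + d)
  swap = solve-∀

-- Independence of disjoint blocks of bits, expressed without probabilities.
count-++ : ∀ a {b} {r : Vec Bool (a + b) → Bool} {p q} → (∀ u v → r (u Vec.++ v) ≡ p u ∧ q v) →
           count (a + b) r ≡ count a p * count b q
count-++ zero    {b} {r} {p} {q} eq with p [] | eq []
... | true  | eq′ = trans (count-cong b eq′) (sym (+-identityʳ _))
... | false | eq′ = trans (count-cong b eq′) (count-false b)
count-++ (suc a) {b} {r} {p} {q} eq = trans (cong₂ _+_ (count-++ a (eq ∘ (true ∷_))) (count-++ a (eq ∘ (false ∷_))))
  (sym (*-distribʳ-+ (count b q) (count a _) (count a _)))

-- Two independent tries: if at most 5/8 of the seeds are bad, then at most (5/8)² < 1/2 of the pairs are.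
count-two : ∀ N rest (good : Vec Bool N → Bool) (both : Vec Bool (N + suc (N + rest)) → Bool) →
  (∀ u g v w → both (u Vec.++ g ∷ (v Vec.++ w)) ≡ not (good u) ∧ not (good v)) →
  3 * 2 ^ N ≤ 8 * count N good → 2 * count (N + suc (N + rest)) both ≤ 2 ^ (N + suc (N + rest))
count-two N rest good both eq enough = *-cancelˡ-≤ 64 (begin
  64 * (2 * count (N + suc (N + rest)) both)       ≡⟨ cong (λ z → 64 * (2 * z)) value ⟩
  64 * (2 * (B * (B * 2 ^ rest + B * 2 ^ rest)))   ≡⟨ a₁ B (2 ^ rest) ⟩
  4 * ((8 * B) * (8 * B)) * 2 ^ rest               ≤⟨ *-monoˡ-≤ (2 ^ rest) (*-monoʳ-≤ 4 (*-mono-≤ few few)) ⟩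
  4 * ((5 * E) * (5 * E)) * 2 ^ rest               ≡⟨ a₂ E (2 ^ rest) ⟩
  -- Here `2 * 5 * 5 ≤ 8 * 8` is what makes two windows suffice; a single window would need
  -- `2 * 5 ≤ 8`.
  50 * (E * (2 * (E * 2 ^ rest)))                  ≤⟨ *-monoˡ-≤ (E * (2 * (E * 2 ^ rest))) {50} {64} (m≤m+n 50 14) ⟩
  64 * (E * (2 * (E * 2 ^ rest)))                  ≡⟨ cong (64 *_) (sym power) ⟩
  64 * 2 ^ (N + suc (N + rest))                    ∎)
  where
  open ≤-Reasoning
  E = 2 ^ N
  B = count N (not ∘ good)
  few : 8 * B ≤ 5 * E
  few = +-cancelˡ-≤ (3 * E) _ _ (begin
    3 * E + 8 * B             ≤⟨ +-monoˡ-≤ (8 * B) enough ⟩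
    8 * count N good + 8 * B  ≡⟨ sym (*-distribˡ-+ 8 (count N good) B) ⟩
    8 * (count N good + B)    ≡⟨ cong (8 *_) (count-not N good) ⟩
    8 * E                     ≡⟨ a₃ E ⟩
    3 * E + 5 * E             ∎)
    where
    a₃ : ∀ E → 8 * E ≡ 3 * E + 5 * E
    a₃ = solve-∀
  second : ∀ (r : Vec Bool (N + rest) → Bool) → (∀ v w → r (v Vec.++ w) ≡ not (good v) ∧ true) → count (N + rest) r ≡ B * 2 ^ rest
  second r e = trans (count-++ N {rest} {r} {not ∘ good} {λ _ → true} e) (cong (B *_) (count-true rest))
  snd : Vec Bool (N + rest) → Bool
  snd v = not (good (Vec.take N v))
  take-++ : ∀ {a b} (u : Vec Bool a) (v : Vec Bool b) → Vec.take a (u Vec.++ v) ≡ u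
  take-++ []      v = refl
  take-++ (x ∷ u) v = cong (x ∷_) (take-++ u v)
  ∧-true : ∀ b → b ≡ b ∧ true
  ∧-true true  = refl
  ∧-true false = refl
  snd-++ : ∀ v w → snd (v Vec.++ w) ≡ not (good v) ∧ true
  snd-++ v w = trans (cong (not ∘ good) (take-++ v w)) (∧-true _)
  tail-of : Vec Bool (suc (N + rest)) → Bool
  tail-of (g ∷ v) = snd v
  split : ∀ u v → both (u Vec.++ v) ≡ not (good u) ∧ tail-of v
  split u (g ∷ v) = subst (λ v → both (u Vec.++ g ∷ v) ≡ not (good u) ∧ snd v) (take++drop≡id N v)
    (trans (eq u g (Vec.take N v) (Vec.drop N v)) (cong (not (good u) ∧_) (sym (cong (not ∘ good) (take-++ (Vec.take N v) (Vec.drop N v))))))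
  value : count (N + suc (N + rest)) both ≡ B * (B * 2 ^ rest + B * 2 ^ rest)
  value = trans (count-++ N {suc (N + rest)} {both} {not ∘ good} {tail-of} split)
    (cong (B *_) (cong₂ _+_ (second snd snd-++) (second snd snd-++)))
  power : 2 ^ (N + suc (N + rest)) ≡ E * (2 * (E * 2 ^ rest))
  power = trans (^-distribˡ-+-* 2 N (suc (N + rest))) (cong (λ z → E * (2 * z)) (^-distribˡ-+-* 2 N rest))
  a₁ : ∀ B R → 64 * (2 * (B * (B * R + B * R))) ≡ 4 * ((8 * B) * (8 * B)) * R
  a₁ = solve-∀
  a₂ : ∀ E R → 4 * ((5 * E) * (5 * E)) * R ≡ 50 * (E * (2 * (E * R)))
  a₂ = solve-∀

-- Few seeds are slow

_≟A_ : DecidableEquality Ans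
_≟A_ = finite-≟ fin-Ans

length-filter-split : ∀ {A : Set} {Q : A → Set} (Q? : ∀ a → Dec (Q a)) xs →
  length (filter Q? xs) + length (filter (λ a → ¬? (Q? a)) xs) ≡ length xs
length-filter-split Q? [] = refl
length-filter-split Q? (x ∷ xs) with Q? x
... | yes _ = cong suc (length-filter-split Q? xs)
... | no _  = trans (+-suc _ _) (cong suc (length-filter-split Q? xs))

module Slow (M : Machine) (x : List Bool) (s N T : ℕ) (corr : Ans)
  (halts : ∀ (τ : Vec Bool N) → ∃[ t ] ∃[ a ] ((Machine.halt M (Config.state (run M {s = s} (fromList x) t (init M τ))) ≡ just a
             × Config.ct (run M {s = s} (fromList x) t (init M τ)) ≡ τ) × (a ≡ corr ⊎ a ≡ dunno))) where
  open Machine M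
  open Graph M hiding (next)
  open TourF M
  open Sized (fromList x) s N

  dart : Vec Bool N → Dart
  dart τ = vertexOf (init M τ) , out

  result : Vec Bool N → Ans
  result τ = noted T (dart τ)

  final : Vec Bool N → Config M (length x) s N
  final τ = run M (fromList x) (proj₁ (halts τ)) (init M τ)

  value : Vec Bool N → Ans
  value τ = proj₁ (proj₂ (halts τ))

  final-halted : ∀ τ → halt (Config.state (final τ)) ≡ just (value τ)
  final-halted τ = proj₁ (proj₁ (proj₂ (proj₂ (halts τ))))

  final-stuck : ∀ τ → vstep (vertexOf (final τ)) ≡ nothing
  final-stuck τ = vstep-halted (final τ) (final-halted τ)

  path : ∀ τ → ∃[ t ] vertexOf (init M τ) ↝[ t ] vertexOf (final τ)
  path τ = run-path (proj₁ (halts τ)) (init M τ) (final-halted τ)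

  leads : ∀ τ i → ∃[ t ] proj₁ (iter fwd i (dart τ)) ↝[ t ] vertexOf (final τ)
  leads τ = iter-leads (final-stuck τ) (dart τ) (path τ)

  start-valid : ∀ τ → Valid configs decode (vertexOf (init M τ))
  start-valid τ = let open Config (init M {length x} {s} τ) in valid-vertex (state , ih , (wt , wh) , (ct , ch))

  -- Every dart of the tour leads to the final configuration, and a halting vertex leads only to
  -- itself; so a halting vertex that is met is the final one.
  halted-value : ∀ τ i {b} → verdict (iter fwd i (dart τ)) ≡ just b → b ≡ value τ
  halted-value τ i h = just-injective (trans (sym h) (trans (cong (λ v → halt (proj₁ v))
    (proj₁ (↝-unique here (proj₂ (leads τ i)) (vstep-stopped h) (final-stuck τ)))) (final-halted τ)))

  result-ok : ∀ τ → result τ ≡ corr ⊎ result τ ≡ dunno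
  result-ok τ = by-cases (noted-cases T (dart τ)) (proj₂ (proj₂ (proj₂ (halts τ))))
    where
    by-cases : result τ ≡ dunno ⊎ ∃[ j ] verdict (iter fwd j (dart τ)) ≡ just (result τ) →
               value τ ≡ corr ⊎ value τ ≡ dunno → result τ ≡ corr ⊎ result τ ≡ dunno
    by-cases (inj₁ e)       _        = inj₂ e
    by-cases (inj₂ (j , h)) (inj₁ e) = inj₁ (trans (halted-value τ j h) e)
    by-cases (inj₂ (j , h)) (inj₂ e) = inj₂ (trans (halted-value τ j h) e)

  Good : Vec Bool N → Set
  Good τ = result τ ≡ corr

  good? : ∀ τ → Dec (Good τ)
  good? τ = result τ ≟A corr

  Correct : Vec Bool N → Set
  Correct τ = ∃[ t ] halt (Config.state (run M {s = s} (fromList x) t (init M τ))) ≡ just corr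

  -- The two clauses of the definition of the class choose their halting times separately.
  -- Determinism makes both speak of the same configuration.
  correct-value : ∀ τ → Correct τ → value τ ≡ corr
  correct-value τ (t , h) = just-injective (trans (sym (final-halted τ)) (trans (cong (λ v → halt (proj₁ v))
    (proj₁ (↝-unique (proj₂ (path τ)) (proj₂ (run-path t (init M τ) h)) (final-stuck τ) (vstep-halted (run M (fromList x) t (init M τ)) h)))) h))

  -- A correct seed can fail for one reason only: no halting vertex was met in time, since any that
  -- is met carries the right answer.
  slow : ∀ τ → Correct τ → ¬ Good τ → ∀ i → i < T → vstep (proj₁ (iter fwd i (dart τ))) ≢ nothing
  slow τ c bad i i<T stuck = halted (verdict (iter fwd i (dart τ))) refl
    where
    halted : ∀ r → verdict (iter fwd i (dart τ)) ≢ r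
    halted nothing  eq = contradiction (trans (sym stuck) (vstep-running _ eq)) λ ()
    halted (just b) eq = let j , h = noted-some T (dart τ) i<T eq in
      bad (trans (halted-value τ j h) (correct-value τ c))

  -- The pairs of a slow seed and a time below `T` inject into the darts. A dart shared by two seeds
  -- leads to both final configurations, which therefore coincide and show the same restored tape;
  -- for one seed, different times give different darts by `orbit-injective`.
  few-slow : ∀ bs → Unique bs → All Correct bs → All (λ τ → ¬ Good τ) bs → length bs * T ≤ configs * suc K
  few-slow bs u cs ns = injective⇒≤ {f = f} f-injective
    where
    seed : Fin (length bs) → Vec Bool N
    seed = List.lookup bs
    dartCode : ∀ τ i → ∃[ j ] decodeDart configs decode j ≡ iter fwd i (dart τ)
    dartCode τ i = encodeDart configs decode (iter fwd i (dart τ)) (iter-valid (dart τ) (start-valid τ) i)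
    g : Fin (length bs) × Fin T → Fin (configs * suc K)
    g (a , i) = proj₁ (dartCode (seed a) (toℕ i))
    f : Fin (length bs * T) → Fin (configs * suc K)
    f m = g (remQuot T m)
    same-seed : ∀ τ τ′ i i′ → iter fwd i (dart τ) ≡ iter fwd i′ (dart τ′) → τ ≡ τ′
    same-seed τ τ′ i i′ eq = trans (sym (restored τ)) (trans (vec-≡ (proj₁ (↝-unique (proj₂ (leads τ i))
        (subst (λ y → proj₁ y ↝[ proj₁ (leads τ′ i′) ] vertexOf (final τ′)) (sym eq) (proj₂ (leads τ′ i′))) (final-stuck τ) (final-stuck τ′)))) (restored τ′))
      where
      restored : ∀ τ → Config.ct (final τ) ≡ τ
      restored τ = proj₂ (proj₁ (proj₂ (proj₂ (halts τ))))
      vec-≡ : vertexOf (final τ) ≡ vertexOf (final τ′) → Config.ct (final τ) ≡ Config.ct (final τ′)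
      vec-≡ e = trans (sym (Data.Vec.Properties.cast-is-id refl _)) (toList-injective refl (Config.ct (final τ)) (Config.ct (final τ′))
        (trans (sym (cells-zip (Config.ct (final τ)) (Config.ch (final τ)))) (trans (cong (λ v → cells (proj₂ (proj₂ (proj₂ v)))) e)
          (cells-zip (Config.ct (final τ′)) (Config.ch (final τ′))))))
    same-dart : ∀ a i a′ i′ → g (a , i) ≡ g (a′ , i′) → iter fwd (toℕ i) (dart (seed a)) ≡ iter fwd (toℕ i′) (dart (seed a′))
    same-dart a i a′ i′ eq = trans (sym (proj₂ (dartCode (seed a) (toℕ i))))
      (trans (cong (decodeDart configs decode) eq) (proj₂ (dartCode (seed a′) (toℕ i′))))
    same-time : ∀ a i i′ → iter fwd (toℕ i) (dart (seed a)) ≡ iter fwd (toℕ i′) (dart (seed a)) → i ≡ i′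
    same-time a i i′ eq = toℕ-injective (compare (<-cmp (toℕ i) (toℕ i′)))
      where
      collide : ∀ {i j} → i < j → j < T → iter fwd i (dart (seed a)) ≢ iter fwd j (dart (seed a))
      collide = orbit-injective out T (proj₂ (path (seed a))) (final-stuck (seed a)) (start-valid (seed a))
        (slow (seed a) (All.lookup cs (∈-lookup a)) (All.lookup ns (∈-lookup a)))
      compare : Tri (toℕ i < toℕ i′) (toℕ i ≡ toℕ i′) (toℕ i′ < toℕ i) → toℕ i ≡ toℕ i′
      compare (tri≈ _ e _)  = e
      compare (tri< lt _ _) = contradiction eq (collide lt (toℕ<n i′))
      compare (tri> _ _ gt) = contradiction (sym eq) (collide gt (toℕ<n i))
    g-injective : ∀ p p′ → g p ≡ g p′ → p ≡ p′
    g-injective (a , i) (a′ , i′) eq = same (Unique-lookup u (same-seed (seed a) (seed a′) (toℕ i) (toℕ i′) e)) e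
      where
      e = same-dart a i a′ i′ eq
      same : ∀ {a a′} → a ≡ a′ → iter fwd (toℕ i) (dart (seed a)) ≡ iter fwd (toℕ i′) (dart (seed a′)) → (a , i) ≡ (a′ , i′)
      same {a} refl e = cong (a ,_) (same-time a i i′ e)
    f-injective : ∀ {m m′} → f m ≡ f m′ → m ≡ m′
    f-injective {m} {m′} eq = trans (sym (combine-remQuot {length bs} T m))
      (trans (cong (λ (a , i) → combine a i) (g-injective (remQuot T m) (remQuot T m′) eq)) (combine-remQuot {length bs} T m′))

  -- Markov's inequality: `B` bounds the average number of darts per seed and `T` is eight times
  -- larger, so at most `2 ^ N / 8` correct seeds are slow. Subtracting this from one half leaves
  -- 3/8. Writing the bound as `suc B` permits cancellation.
  many-good : ∀ ts → Unique ts → All Correct ts → 2 ^ N ≤ 2 * length ts →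
              ∀ B → configs * suc K ≤ 2 ^ N * suc B → 8 * suc B ≤ T →
              3 * 2 ^ N ≤ 8 * count N (λ τ → does (good? τ))
  many-good ts u cs half B few long = +-cancelʳ-≤ (8 * length bad) _ _ (begin
    3 * 2 ^ N + 8 * length bad        ≤⟨ +-monoʳ-≤ (3 * 2 ^ N) eighth ⟩
    3 * 2 ^ N + 2 ^ N                 ≡⟨ a₁ (2 ^ N) ⟩
    4 * 2 ^ N                         ≤⟨ *-monoʳ-≤ 4 half ⟩
    4 * (2 * length ts)               ≡⟨ cong (λ z → 4 * (2 * z)) (sym (length-filter-split good? ts)) ⟩
    4 * (2 * (length ok + length bad)) ≡⟨ a₂ (length ok) (length bad) ⟩
    8 * length ok + 8 * length bad    ≤⟨ +-monoˡ-≤ (8 * length bad) (*-monoʳ-≤ 8 counted) ⟩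
    8 * count N (λ τ → does (good? τ)) + 8 * length bad ∎)
    where
    open ≤-Reasoning
    ok  = filter good? ts
    bad = filter (λ τ → ¬? (good? τ)) ts
    a₁ : ∀ E → 3 * E + E ≡ 4 * E
    a₁ = solve-∀
    a₂ : ∀ a b → 4 * (2 * (a + b)) ≡ 8 * a + 8 * b
    a₂ = solve-∀
    a₃ : ∀ l B → 8 * l * B ≡ l * (8 * B)
    a₃ = solve-∀
    eighth : 8 * length bad ≤ 2 ^ N
    eighth = *-cancelʳ-≤ (8 * length bad) (2 ^ N) (suc B) (begin
      8 * length bad * suc B   ≡⟨ a₃ (length bad) (suc B) ⟩
      length bad * (8 * suc B) ≤⟨ *-monoʳ-≤ (length bad) long ⟩
      length bad * T           ≤⟨ few-slow bad (Uniqueₚ.filter⁺ _ u) (Allₚ.filter⁺ _ cs) (Allₚ.all-filter (λ τ → ¬? (good? τ)) ts) ⟩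
      configs * suc K          ≤⟨ few ⟩
      2 ^ N * suc B            ∎)
    counted : length ok ≤ count N (λ τ → does (good? τ))
    counted = length≤count (λ τ → does (good? τ)) (Uniqueₚ.filter⁺ good? u) (All.map (λ {τ} g → dec-true (good? τ) g) (Allₚ.all-filter good? ts))

-- Polynomial bounds

n≤2^log : ∀ n → n ≤ 2 ^ ⌈log₂ n ⌉
n≤2^log n = go n (<-wellFounded n)
  where
  double : ∀ n → n ≤ 2 * ⌈ n /2⌉
  double zero          = z≤n
  double (suc zero)    = s≤s z≤n
  double (suc (suc n)) = ≤-trans (s≤s (s≤s (double n))) (≤-reflexive (cong suc (sym (+-suc _ _))))
  -- The accessibility proof is generalized, because the recursive calls of `⌈log2⌉` carry proofs of
  -- their own.
  go : ∀ n (a : Acc _<_ n) → n ≤ 2 ^ ⌈log2⌉ n a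
  go zero          _        = z≤n
  go (suc zero)    _        = ≤-refl
  go (suc (suc n)) (acc rs) = ≤-trans (double (suc (suc n))) (*-monoʳ-≤ 2 (go (suc ⌈ n /2⌉) _))

2^log≤2*n : ∀ n → 2 ≤ n → 2 ^ ⌈log₂ n ⌉ ≤ 2 * n
2^log≤2*n n 2≤n = below ⌈log₂ n ⌉ refl
  where
  below : ∀ l → ⌈log₂ n ⌉ ≡ l → 2 ^ l ≤ 2 * n
  below zero    _  = ≤-trans (s≤s z≤n) (≤-trans 2≤n (m≤m+n n _))
  below (suc l) eq with ≤-total (2 ^ l) n
  ... | inj₁ le = *-monoʳ-≤ 2 le
  ... | inj₂ ge = contradiction (≤-trans (≤-reflexive (sym eq)) (≤-trans (⌈log₂⌉-mono-≤ ge) (≤-reflexive (⌈log₂2^n⌉≡n l)))) 1+n≰n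

lg : ℕ → ℕ
lg n = ⌈log₂ (n + 2) ⌉

2≤n+2 : ∀ n → 2 ≤ n + 2
2≤n+2 n = m≤n+m 2 n

base-nonZero : ∀ n → NonZero (n + 2)
base-nonZero n = >-nonZero (≤-trans (s≤s z≤n) (2≤n+2 n))

n+2≤2^lg : ∀ n → n + 2 ≤ 2 ^ lg n
n+2≤2^lg n = n≤2^log (n + 2)

1≤lg : ∀ n → 1 ≤ lg n
1≤lg n = ⌈log₂⌉-mono-≤ (2≤n+2 n)

2^lg≤square : ∀ n → 2 ^ lg n ≤ (n + 2) ^ 2
2^lg≤square n = ≤-trans (2^log≤2*n (n + 2) (2≤n+2 n))
  (≤-trans (*-monoˡ-≤ (n + 2) (2≤n+2 n)) (≤-reflexive (cong ((n + 2) *_) (sym (*-identityʳ (n + 2))))))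

m<2^m : ∀ m → m < 2 ^ m
m<2^m zero    = s≤s z≤n
m<2^m (suc m) = ≤-trans (s≤s (m<2^m m)) (≤-trans (+-monoˡ-≤ (2 ^ m) (m^n>0 2 m)) (≤-reflexive (cong (2 ^ m +_) (sym (+-identityʳ _)))))

^-monoʳ : ∀ n {a b} → a ≤ b → (n + 2) ^ a ≤ (n + 2) ^ b
^-monoʳ n = ^-monoʳ-≤ (n + 2) ⦃ base-nonZero n ⦄

2^≤base^ : ∀ n a → 2 ^ a ≤ (n + 2) ^ a
2^≤base^ n a = ^-monoˡ-≤ a (2≤n+2 n)

-- Constant factors are absorbed into the exponent, as the base is at least 2. The form is that of
-- `poly`, in which the final bound has to be given.
PolyBounded : (ℕ → ℕ) → Set
PolyBounded f = ∃[ a ] (∀ n → f n ≤ (n + 2) ^ a)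

pb-above : ∀ {f} → PolyBounded f → ∀ m → ∃[ a ] (m ≤ a × (∀ n → f n ≤ (n + 2) ^ a))
pb-above (a , p) m = a + m , m≤n+m m a , λ n → ≤-trans (p n) (^-monoʳ n (m≤m+n a m))

pb-const : ∀ c → PolyBounded (λ _ → c)
pb-const c = c , λ n → ≤-trans (<⇒≤ (m<2^m c)) (2^≤base^ n c)

pb-base : PolyBounded (λ n → n + 2)
pb-base = 1 , λ n → ≤-reflexive (sym (*-identityʳ _))

pb-id : PolyBounded (λ n → n)
pb-id = 1 , λ n → ≤-trans (m≤m+n n 2) (≤-reflexive (sym (*-identityʳ _)))

pb-+ : ∀ {f g} → PolyBounded f → PolyBounded g → PolyBounded (λ n → f n + g n)
pb-+ {f} {g} (a , p) (b , q) = suc (a + b) , λ n → ≤-trans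
  (+-mono-≤ (≤-trans (p n) (^-monoʳ n (m≤m+n a b))) (≤-trans (q n) (^-monoʳ n (m≤n+m b a))))
  (≤-trans (≤-reflexive (cong ((n + 2) ^ (a + b) +_) (sym (+-identityʳ _)))) (*-monoˡ-≤ ((n + 2) ^ (a + b)) (2≤n+2 n)))

pb-* : ∀ {f g} → PolyBounded f → PolyBounded g → PolyBounded (λ n → f n * g n)
pb-* (a , p) (b , q) = a + b , λ n → ≤-trans (*-mono-≤ (p n) (q n)) (≤-reflexive (sym (^-distribˡ-+-* (n + 2) a b)))

pb-power : ∀ k → PolyBounded (λ n → (n + 2) ^ k)
pb-power k = k , λ n → ≤-refl

pb-2^lg : ∀ m → PolyBounded (λ n → 2 ^ (m * lg n))
pb-2^lg m = 2 * m , λ n → ≤-trans (≤-reflexive (trans (cong (2 ^_) (*-comm m (lg n))) (sym (^-*-assoc 2 (lg n) m))))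
  (≤-trans (^-monoˡ-≤ m (2^lg≤square n)) (≤-reflexive (^-*-assoc (n + 2) 2 m)))

pb-lg : PolyBounded lg
pb-lg = 2 , λ n → ≤-trans (<⇒≤ (m<2^m (lg n))) (2^lg≤square n)

pb-mono : ∀ {f g} → (∀ n → f n ≤ g n) → PolyBounded g → PolyBounded f
pb-mono le (a , p) = a , λ n → ≤-trans (le n) (p n)

base^≤2^ : ∀ n a → (n + 2) ^ a ≤ 2 ^ (lg n * a)
base^≤2^ n a = ≤-trans (^-monoˡ-≤ a (n+2≤2^lg n)) (≤-reflexive (^-*-assoc 2 (lg n) a))

-- The inequality starts at exponent 5, where it reads 23 ≤ 32; at 4 it would be 19 ≤ 16. This is
-- the origin of the summand 5 in the period length `k′`.
4z+3≤2^z : ∀ z → 3 + 4 * (5 + z) ≤ 2 ^ (5 + z)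
4z+3≤2^z zero    = m≤m+n 23 9
4z+3≤2^z (suc z) = ≤-trans (≤-reflexive (a₁ z)) (≤-trans (+-mono-≤ (4z+3≤2^z z) small) (≤-reflexive (cong (2 ^ (5 + z) +_) (sym (+-identityʳ _)))))
  where
  a₁ : ∀ z → 3 + 4 * (5 + suc z) ≡ (3 + 4 * (5 + z)) + 4
  a₁ = solve-∀
  small : 4 ≤ 2 ^ (5 + z)
  small = ^-monoʳ-≤ 2 {2} {5 + z} (s≤s (s≤s z≤n))

-- Layout of the work tape

nth : List Reg → ℕ → Reg
nth []       _       = rA
nth (r ∷ rs) zero    = r
nth (r ∷ rs) (suc j) = nth rs j

occ : Reg → List Reg → ℕ
occ r []       = 0
occ r (x ∷ xs) = ⟦ does (x ≟F r) ⟧ + occ r xs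

occ-++ : ∀ r xs ys → occ r (xs ++ ys) ≡ occ r xs + occ r ys
occ-++ r []       ys = refl
occ-++ r (x ∷ xs) ys = trans (cong (⟦ does (x ≟F r) ⟧ +_) (occ-++ r xs ys)) (sym (+-assoc ⟦ does (x ≟F r) ⟧ _ _))

occ-same : ∀ r n → occ r (replicate n r) ≡ n
occ-same r zero    = refl
occ-same r (suc n) = cong₂ _+_ (cong ⟦_⟧ (dec-true (r ≟F r) refl)) (occ-same r n)

occ-other : ∀ {r x} n → x ≢ r → occ r (replicate n x) ≡ 0
occ-other         zero    ne = refl
occ-other {r} {x} (suc n) ne = cong₂ _+_ (cong ⟦_⟧ (dec-false (x ≟F r) ne)) (occ-other n ne)

below : Reg → (ℕ → Reg) → ℕ → ℕ
below r f zero    = 0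
below r f (suc j) = ⟦ does (f j ≟F r) ⟧ + below r f j

below-shift : ∀ r f j → below r f (suc j) ≡ ⟦ does (f 0 ≟F r) ⟧ + below r (λ i → f (suc i)) j
below-shift r f zero    = refl
below-shift r f (suc j) = trans (cong (⟦ does (f (suc j) ≟F r) ⟧ +_) (below-shift r f j))
  (swap ⟦ does (f (suc j) ≟F r) ⟧ ⟦ does (f 0 ≟F r) ⟧ (below r (λ i → f (suc i)) j))
  where
  swap : ∀ a b c → a + (b + c) ≡ b + (a + c)
  swap = solve-∀

below-nth : ∀ r xs → below r (nth xs) (length xs) ≡ occ r xs
below-nth r []       = refl
below-nth r (x ∷ xs) = trans (below-shift r (nth (x ∷ xs)) (length xs)) (cong (⟦ does (x ≟F r) ⟧ +_) (below-nth r xs))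

module Widths (x : Reg) (xs : List Reg) where

  layout : Fin (suc (length xs)) → Reg
  layout o = nth (x ∷ xs) (toℕ o)

  open Layout (length xs) layout

  width-run : ∀ r m j o → toℕ o ≡ j → width r o (suc j + m) ≡ below r (nth (x ∷ xs)) (suc j) + width r first m
  width-run r m zero    zero    refl = sym (cong (_+ width r first m) (+-identityʳ _))
  width-run r m (suc j) (suc i) eq = trans (cong₂ _+_ (cong (λ j → ⟦ does (nth xs j ≟F r) ⟧) e)
      (width-run r m j (inject₁ i) (trans (toℕ-inject₁ i) e)))
    (sym (+-assoc ⟦ does (nth xs j ≟F r) ⟧ (below r (nth (x ∷ xs)) (suc j)) (width r first m)))
    where
    e : toℕ i ≡ j
    e = suc-injective eq

  -- A register that owns `m` offsets of the period gets `m * l` bits. With `l` equal to `lg n` its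
  -- capacity is polynomial in `n`, of a degree governed by the layout, although the layout does not
  -- depend on `n`.
  width-periods : ∀ r l → width r first (l * suc (length xs)) ≡ l * occ r (x ∷ xs)
  width-periods r zero    = refl
  width-periods r (suc l) = trans (width-run r _ (length xs) first (toℕ-fromℕ (length xs)))
    (cong₂ _+_ (below-nth r (x ∷ xs)) (width-periods r l))

-- k bits of each period belong to rW, so that filling rW yields 2 ^ s ∸ 1.
spare : (k e pad : ℕ) → List Reg
spare k e pad = replicate pad rA ++ replicate k rW ++ replicate e rP ++ replicate e rQ ++
                replicate e rL ++ replicate e rR ++ replicate e rC ++ replicate e rA

length-spare : ∀ k e pad → suc (length (spare k e pad)) ≡ suc (pad + (k + 6 * e))
length-spare k e pad = cong ℕ.suc (trans (len pad rA (replicate k rW ++ ps) (len k rW ps (len e rP qs (len e rQ ls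
    (len e rL rs (len e rR cs (len e rC as (length-replicate e)))))))) (arith pad k e))
  where
  as cs rs ls qs ps : List Reg
  as = replicate e rA
  cs = replicate e rC ++ as
  rs = replicate e rR ++ cs
  ls = replicate e rL ++ rs
  qs = replicate e rQ ++ ls
  ps = replicate e rP ++ qs
  len : ∀ n (r : Reg) ys {m} → length ys ≡ m → length (replicate n r ++ ys) ≡ n + m
  len n r ys eq = trans (length-++ (replicate n r)) (cong₂ _+_ (length-replicate n) eq)
  arith : ∀ p k e → p + (k + (e + (e + (e + (e + (e + e)))))) ≡ p + (k + 6 * e)
  arith = solve-∀

private
  skip : ∀ {r x} n {ys} → x ≢ r → occ r (replicate n x ++ ys) ≡ occ r ys
  skip {r} {x} n {ys} ne = trans (occ-++ r (replicate n x) ys) (cong (_+ occ r ys) (occ-other n ne))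

  take : ∀ r n ys → occ r (replicate n r ++ ys) ≡ n + occ r ys
  take r n ys = trans (occ-++ r (replicate n r) ys) (cong (_+ occ r ys) (occ-same r n))

  at-least : ∀ r n ys {m} → m ≡ occ r (replicate n r ++ ys) → n ≤ m
  at-least r n ys eq = ≤-trans (m≤m+n n (occ r ys)) (≤-reflexive (sym (trans eq (take r n ys))))

module _ (k e pad : ℕ) where

  occ-W : occ rW (rA ∷ spare k e pad) ≡ k
  occ-W = trans (skip pad λ ()) (trans (take rW k _) (trans (cong (k +_)
    (trans (skip e λ ()) (trans (skip e λ ()) (trans (skip e λ ()) (trans (skip e λ ()) (trans (skip e λ ()) (occ-other e λ ()))))))) (+-identityʳ k)))

  occ-C : occ rC (rA ∷ spare k e pad) ≡ e
  occ-C = trans (skip pad λ ()) (trans (skip k λ ()) (trans (skip e λ ()) (trans (skip e λ ()) (trans (skip e λ ()) (trans (skip e λ ())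
    (trans (take rC e _) (trans (cong (e +_) (occ-other e λ ())) (+-identityʳ e))))))))

  occ-P : e ≤ occ rP (rA ∷ spare k e pad)
  occ-P = at-least rP e _ (trans (skip pad λ ()) (skip k λ ()))

  occ-Q : e ≤ occ rQ (rA ∷ spare k e pad)
  occ-Q = at-least rQ e _ (trans (skip pad λ ()) (trans (skip k λ ()) (skip e λ ())))

  occ-L : e ≤ occ rL (rA ∷ spare k e pad)
  occ-L = at-least rL e _ (trans (skip pad λ ()) (trans (skip k λ ()) (trans (skip e λ ()) (skip e λ ()))))

  occ-R : e ≤ occ rR (rA ∷ spare k e pad)
  occ-R = at-least rR e _ (trans (skip pad λ ()) (trans (skip k λ ()) (trans (skip e λ ()) (trans (skip e λ ()) (skip e λ ())))))

  occ-A : e ≤ occ rA (rA ∷ spare k e pad)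
  occ-A = ≤-trans (≤-trans (≤-reflexive (sym rest)) (m≤n+m _ pad)) (≤-trans (≤-reflexive (sym (take rA pad _))) (n≤1+n _))
    where
    rest : occ rA (replicate k rW ++ replicate e rP ++ replicate e rQ ++ replicate e rL ++ replicate e rR ++ replicate e rC ++ replicate e rA) ≡ e
    rest = trans (skip k λ ()) (trans (skip e λ ()) (trans (skip e λ ()) (trans (skip e λ ()) (trans (skip e λ ()) (trans (skip e λ ()) (occ-same rA e))))))

-- The fast machine

-- The number of counter instructions as an expression in plain numbers. The padding does not enter,
-- so this quantity can be bounded by a polynomial before the layout is fixed.
timeBound : (k n s N T : ℕ) → ℕ
timeBound k n s N T = setup + (tour + (shift + tour))
  where
  lap   = 2 + suc n * 2 + (1 + suc n)
  setup = 1 + (k * (N * 3 + 2 + (N * (2 + lap) + 2)) + 1 + (1 + (1 + (2 ^ s * 3 + 2))))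
  act   = 2 + (7 * (2 * 2 ^ s) + 6 + (8 * (2 * 2 ^ s) + 8) + 5)
  tour  = 1 + (T * (2 + (act + act)) + 2 + (1 + (T * (2 + (act + act)) + 2)))
  shift = suc N * 4 + 2 + (suc N * 3 + 2)

module Simulate (M : Machine) (k e pad : ℕ) (k+2≤e : k + 2 ≤ e) where
  open TourF M using (mainF; noted; module Run-main)
  open Graph M using (Dart)

  rest : List Reg
  rest = spare k e pad

  k′ : ℕ
  k′ = suc (length rest)

  open Widths rA rest using (layout; width-periods)
  open Layout (length rest) layout using (width; first; val; mine)
  open Compile (mainF k) (length rest) layout public using (machine)
  open Compile (mainF k) (length rest) layout using (module Simulation; at-state; fin-States)

  module OnInput (xs : List Bool) where

    n ℓ s N S : ℕ
    n = length xs
    ℓ = lg n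
    s = k * ℓ
    N = (n + 2) ^ k
    S = k′ * ℓ

    open Simulation S

    cap-occ : ∀ r → cap r ≡ 2 ^ (ℓ * occ r (rA ∷ rest))
    cap-occ r = cong (2 ^_) (trans (cong (width r first) (*-comm k′ ℓ)) (width-periods r ℓ))

    -- Having two offsets more than `k` per period yields `ℓ + ℓ` additional bits. Each `ℓ` is at
    -- least 1, so one of them pays for the `suc` and the other for strictness.
    big : ∀ r → e ≤ occ r (rA ∷ rest) → 2 ^ suc s < cap r
    big r le = subst (2 ^ suc s <_) (sym (cap-occ r)) (^-monoʳ-< 2 (s≤s (s≤s z≤n)) (begin-strict
      suc s               ≡⟨ cong suc (*-comm k ℓ) ⟩
      suc (ℓ * k)         <⟨ s≤s (≤-trans (≤-reflexive (+-comm 1 (ℓ * k))) (+-monoʳ-≤ (ℓ * k) (1≤lg n))) ⟩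
      suc (ℓ * k + ℓ)     ≤⟨ ≤-trans (≤-reflexive (+-comm 1 (ℓ * k + ℓ))) (+-monoʳ-≤ (ℓ * k + ℓ) (1≤lg n)) ⟩
      ℓ * k + ℓ + ℓ       ≡⟨ arith ℓ k ⟩
      ℓ * (k + 2)         ≤⟨ *-monoʳ-≤ ℓ (≤-trans k+2≤e le) ⟩
      ℓ * occ r (rA ∷ rest) ∎))
      where
      open ≤-Reasoning
      arith : ∀ l k → l * k + l + l ≡ l * (k + 2)
      arith = solve-∀

    N≤2^s : N ≤ 2 ^ s
    N≤2^s = ≤-trans (base^≤2^ n k) (≤-reflexive (cong (2 ^_) (*-comm ℓ k)))

    big′ : ∀ r → e ≤ occ r (rA ∷ rest) → suc N < cap r
    big′ r le = ≤-<-trans (≤-trans (s≤s N≤2^s) (≤-trans (+-monoˡ-≤ (2 ^ s) (m^n>0 2 s)) (≤-reflexive (cong (2 ^ s +_) (sym (+-identityʳ _)))))) (big r le)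

    cap-W : cap rW ≡ 2 ^ s
    cap-W = trans (cap-occ rW) (cong (2 ^_) (trans (cong (ℓ *_) (occ-W k e pad)) (*-comm ℓ k)))

    cap-C : cap rC ≡ 2 ^ (ℓ * e)
    cap-C = trans (cap-occ rC) (cong (λ z → 2 ^ (ℓ * z)) (occ-C k e pad))

    open Run-main cap s k xs (big rL (occ-L k e pad)) (big rR (occ-R k e pad)) (big rA (occ-A k e pad))
      (big′ rP (occ-P k e pad)) (big′ rQ (occ-Q k e pad)) (big′ rA (occ-A k e pad)) cap-W public using (answer; run-main; mainTime)

    T : ℕ
    T = 2 ^ (ℓ * e) ∸ 1

    time-eq : mainTime ≡ timeBound k n s N T
    time-eq = cong (λ c → timeBound k n s N (c ∸ 1)) cap-C

    answer-noted : ∀ τ → answer τ ≡ noted T ((Machine.start M , atL xs , atL (replicate s false) , atL τ) , zero)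
    answer-noted τ = cong (λ c → noted (c ∸ 1) ((Machine.start M , atL xs , atL (replicate s false) , atL τ) , zero)) cap-C

    val-zeros : ∀ r o m → val r o (replicate m false) ≡ 0
    val-zeros r o zero    = refl
    val-zeros r o (suc m) with mine r o
    ... | false = val-zeros r (down o) m
    ... | true  = cong (2 *_) (val-zeros r (down o) m)

    holds-zeros : ∀ i c → Holds (replicate S false) (memory i c 0 0 0 0 0 0 0)
    holds-zeros i c = holds (length-replicate S) λ r → trans (zero-regs r) (sym (val-zeros r first S))
      where
      zero-regs : ∀ r → lookup (regs (memory i c 0 0 0 0 0 0 0)) r ≡ 0
      zero-regs rP = refl
      zero-regs rQ = refl
      zero-regs rL = refl
      zero-regs rR = refl
      zero-regs rC = refl
      zero-regs rA = refl
      zero-regs rW = refl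

    simulate : ∀ {c} (τ : Vec Bool c) τ₀ g τ₁ post → length τ₀ ≡ N → length τ₁ ≡ N → toList τ ≡ τ₀ ++ g ∷ τ₁ ++ post →
      ∃[ t ] (t ≤ timeBound k n s N T * (3 + 2 * S) ×
        Machine.halt machine (Config.state (run machine {n} {S} {c} (fromList xs) t (init machine τ))) ≡ just (answer τ₀ orElse answer τ₁) ×
        Config.ct (run machine {n} {S} {c} (fromList xs) t (init machine τ)) ≡ τ)
    simulate {c} τ τ₀ g τ₁ post len₀ len₁ eq = t , bound , halted , restored
      where
      open Semantics cap
      open Graph machine using (_↝[_]_; module Sized)
      open Sized (fromList xs) S c using (vertexOf; path-run)
      all = τ₀ ++ g ∷ τ₁ ++ post
      main = run-main τ₀ g τ₁ post len₀ len₁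
      m = proj₁ main
      ran = proj₁ (proj₂ main)
      pth = runs-path (replicate S false) (Run.runs ran) (holds-zeros (atL xs) (atL all))
      t = proj₁ pth
      bs = proj₁ (proj₂ pth)
      bound : t ≤ timeBound k n s N T * (3 + 2 * S)
      bound = ≤-trans (proj₁ (proj₂ (proj₂ pth))) (*-monoˡ-≤ (3 + 2 * S) (≤-trans (Run.bound ran) (≤-reflexive time-eq)))
      begins : vertexOf (init machine τ) ≡ at-state (inj₁ (enter (mainF k) tt , inj₁ tt)) (atL xs , atL (replicate S false) , atL all)
      begins = cong (λ t → Machine.start machine , t) (cong₂ _,_ (cong atL (toList∘fromList xs)) (cong₂ _,_ (cong atL (toList-replicate S false)) (cong atL eq)))
      final = run machine {n} {S} {c} (fromList xs) t (init machine τ)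
      ends : vertexOf final ≡ at-state (inj₂ (answer τ₀ orElse answer τ₁)) (tapes m bs)
      ends = path-run (init machine τ) (subst (λ v → v ↝[ t ] at-state (inj₂ (answer τ₀ orElse answer τ₁)) (tapes m bs)) (sym begins) (proj₂ (proj₂ (proj₂ pth))))
      halted : Machine.halt machine (Config.state final) ≡ just (answer τ₀ orElse answer τ₁)
      halted = trans (cong (λ v → Machine.halt machine (proj₁ v)) ends)
        (cong (Compile.haltS (mainF k) (length rest) layout) (from-to fin-States (inj₂ (answer τ₀ orElse answer τ₁))))
      restored : Config.ct final ≡ τ
      restored = trans (sym (cast-is-id refl _)) (toList-injective refl (Config.ct final) τ
        (trans (sym (cells-zip (Config.ct final) (Config.ch final))) (trans (cong (λ v → cells (proj₂ (proj₂ (proj₂ v)))) ends)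
          (trans (proj₂ (proj₂ main)) (sym eq)))))

-- Two disjoint windows in a longer catalytic tape

module _ (N r : ℕ) where

  private
    first-window second-window : List Bool → List Bool
    first-window  = List.take N
    second-window ys = List.take N (List.drop (suc N) ys)

    take-exact : ∀ {N} (u : Vec Bool N) ys → List.take N (toList u ++ ys) ≡ toList u
    take-exact []      ys = refl
    take-exact (x ∷ u) ys = cong (x ∷_) (take-exact u ys)

    drop-exact : ∀ {N} (u : Vec Bool N) g ys → List.drop (suc N) (toList u ++ g ∷ ys) ≡ ys
    drop-exact []      g ys = refl
    drop-exact (x ∷ u) g ys = drop-exact u g ys

  module _ (u : Vec Bool N) (g : Bool) (v : Vec Bool N) (w : Vec Bool r) where

    toList-pieces : toList (u Vec.++ g ∷ (v Vec.++ w)) ≡ toList u ++ g ∷ toList v ++ toList w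
    toList-pieces = trans (toList-++ u (g ∷ (v Vec.++ w))) (cong (λ z → toList u ++ g ∷ z) (toList-++ v w))

    first-piece : first-window (toList (u Vec.++ g ∷ (v Vec.++ w))) ≡ toList u
    first-piece = trans (cong first-window toList-pieces) (take-exact u _)

    second-piece : second-window (toList (u Vec.++ g ∷ (v Vec.++ w))) ≡ toList v
    second-piece = trans (cong second-window toList-pieces) (trans (cong first-window (drop-exact u g _)) (take-exact v _))

  -- Formulated with lists for a vector of arbitrary length, so that the equation between
  -- `poly k′ n` and the sum of the pieces never forces a transport.
  Windows : ∀ {c} → Vec Bool c → Set
  Windows τ = ∃[ g ] ∃[ post ] (toList τ ≡ first-window (toList τ) ++ g ∷ second-window (toList τ) ++ post ×
    ∃[ u ] first-window (toList τ) ≡ toList {n = N} u × ∃[ v ] second-window (toList τ) ≡ toList {n = N} v)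

  windows : ∀ {c} → c ≡ N + suc (N + r) → (τ : Vec Bool c) → Windows τ
  windows refl τ = pieces (Vec.take N τ) (Vec.drop N τ) (take++drop≡id N τ)
    where
    pieces₂ : ∀ u g v (w : Vec Bool r) → u Vec.++ g ∷ (v Vec.++ w) ≡ τ → Windows τ
    pieces₂ u g v w refl = g , toList w , trans (toList-pieces u g v w) (cong₂ (λ a b → a ++ g ∷ b ++ toList w)
      (sym (first-piece u g v w)) (sym (second-piece u g v w))) , u , first-piece u g v w , v , second-piece u g v w
    pieces : ∀ u (v : Vec Bool (suc (N + r))) → u Vec.++ v ≡ τ → Windows τ
    pieces u (g ∷ v) eq = pieces₂ u g (Vec.take N v) (Vec.drop N v) (trans (cong (λ v → u Vec.++ g ∷ v) (take++drop≡id N v)) eq)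

  either : (List Bool → Bool) → ∀ {c} → Vec Bool c → Bool
  either good τ = good (first-window (toList τ)) ∨ good (second-window (toList τ))

  either-half : ∀ good {c} → c ≡ N + suc (N + r) → 3 * 2 ^ N ≤ 8 * count N (good ∘ toList) → 2 ^ c ≤ 2 * count c (either good)
  either-half good {c} refl enough = +-cancelʳ-≤ (2 ^ c) _ _ (begin
    2 ^ c + 2 ^ c                        ≡⟨ cong (2 ^ c +_) (sym (+-identityʳ _)) ⟩
    2 * 2 ^ c                            ≡⟨ cong (2 *_) (sym (count-not c (either good))) ⟩
    2 * (some + none)                    ≡⟨ *-distribˡ-+ 2 some none ⟩
    2 * some + 2 * none                  ≤⟨ +-monoʳ-≤ (2 * some) (count-two N r (good ∘ toList) (not ∘ either good) both enough) ⟩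
    2 * some + 2 ^ c                     ∎)
    where
    open ≤-Reasoning
    some = count c (either good)
    none = count c (not ∘ either good)
    de-morgan : ∀ a b → not (a ∨ b) ≡ not a ∧ not b
    de-morgan true  b = refl
    de-morgan false b = refl
    both : ∀ u g v w → not (either good (u Vec.++ g ∷ (v Vec.++ w))) ≡ not (good (toList u)) ∧ not (good (toList v))
    both u g v w = trans (de-morgan (good (first-window (toList (u Vec.++ g ∷ (v Vec.++ w))))) _)
      (cong₂ (λ a b → not (good a) ∧ not (good b)) (first-piece u g v w) (second-piece u g v w))

orElse-correct : ∀ L x b → correct L x orElse b ≡ correct L x
orElse-correct L x b with L x
... | true  = refl
... | false = refl

∨-witness : ∀ {P Q : Set} (p? : Dec P) (q? : Dec Q) → does p? ∨ does q? ≡ true → P ⊎ Q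
∨-witness (yes p) _       _ = inj₁ p
∨-witness (no _)  (yes q) _ = inj₂ q

dunno-incorrect : ∀ L x → dunno ≢ correct L x
dunno-incorrect L x with L x
... | true  = λ ()
... | false = λ ()

-- The average number of darts per seed

module GraphSize (M : Machine) (k : ℕ) where
  open Machine M using (q)
  open Graph M using (K; module Sized)

  -- The number of encoded darts divided by the number `2 ^ N` of seeds. Only the catalytic contents
  -- contribute a factor that is exponential in `N`, and the division removes it.
  graphSize : ℕ → ℕ
  graphSize n = q * ((n + 2) * ((2 ^ (k * lg n) * (k * lg n + 2)) * ((n + 2) ^ k + 2))) * suc K

  configs-eq : ∀ {n} (y : Vec Bool n) → let s = k * lg n ; N = (n + 2) ^ k in
    Sized.configs y s N * suc K ≡ 2 ^ N * graphSize n
  configs-eq {n} y = trans (cong (_* suc K) sizes) (arith q (n + 2) (2 ^ s) (s + 2) (2 ^ N) (N + 2) (suc K))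
    where
    s = k * lg n
    N = (n + 2) ^ k
    arith : ∀ q a b c d e f → q * (a * ((b * c) * (d * e))) * f ≡ d * (q * (a * ((b * c) * e)) * f)
    arith = solve-∀
    tape-size : ∀ m → size (fin-× {Vec Bool m} {Fin (suc (suc m))}) ≡ 2 ^ m * (m + 2)
    tape-size m = trans (size-× fin-Vec fin-Fin) (cong₂ _*_ (size-Vec m) (+-comm 2 m))
    sizes : Sized.configs y s N ≡ q * ((n + 2) * ((2 ^ s * (s + 2)) * (2 ^ N * (N + 2))))
    sizes = trans (size-× fin-Fin fin-×) (cong (q *_) (trans (size-× fin-Fin fin-×) (cong₂ _*_ (+-comm 2 n)
      (trans (size-× fin-× fin-×) (cong₂ _*_ (tape-size s) (tape-size N))))))

  -- The factor 8 limits slow seeds to one eighth; the final 1 compensates for the clock, which runs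
  -- `cap rC ∸ 1` rounds.
  pb-graph : PolyBounded (λ n → 8 * suc (graphSize n) + 1)
  pb-graph = pb-+ (pb-* (pb-const 8) (pb-+ (pb-const 1) (pb-* (pb-* (pb-const q) (pb-* pb-base (pb-*
    (pb-* (pb-2^lg k) (pb-+ (pb-* (pb-const k) pb-lg) (pb-const 2))) (pb-+ (pb-power k) (pb-const 2))))) (pb-const (suc K))))) (pb-const 1)

pb-timeBound : ∀ k e → PolyBounded (λ n → timeBound k n (k * lg n) ((n + 2) ^ k) (2 ^ (lg n * e) ∸ 1))
pb-timeBound k e = pb-+ setup (pb-+ tour (pb-+ shift tour))
  where
  pn = pb-power k
  c = pb-const
  p2 = pb-2^lg k
  pT : PolyBounded (λ n → 2 ^ (lg n * e) ∸ 1)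
  pT = pb-mono (λ n → ≤-trans (m∸n≤m _ 1) (≤-reflexive (cong (2 ^_) (*-comm (lg n) e)))) (pb-2^lg e)
  sn = pb-+ (c 1) pb-id
  lap = pb-+ (pb-+ (c 2) (pb-* sn (c 2))) (pb-+ (c 1) sn)
  setup = pb-+ (c 1) (pb-+ (pb-+ (pb-* (c k) (pb-+ (pb-+ (pb-* pn (c 3)) (c 2)) (pb-+ (pb-* pn (pb-+ (c 2) lap)) (c 2)))) (c 1))
            (pb-+ (c 1) (pb-+ (c 1) (pb-+ (pb-* p2 (c 3)) (c 2)))))
  X = pb-* (c 2) p2
  act = pb-+ (c 2) (pb-+ (pb-+ (pb-+ (pb-* (c 7) X) (c 6)) (pb-+ (pb-* (c 8) X) (c 8))) (c 5))
  once = pb-+ (pb-* pT (pb-+ (c 2) (pb-+ act act))) (c 2)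
  tour = pb-+ (c 1) (pb-+ once (pb-+ (c 1) once))
  shift = pb-+ (pb-+ (pb-* (pb-+ (c 1) pn) (c 4)) (c 2)) (pb-+ (pb-* (pb-+ (c 1) pn) (c 3)) (c 2))

module Theorem (L : Language) (k : ℕ) (M : Machine)
               (halts : ∀ x (τ : Vec Bool (poly k (length x))) → ∃[ t ] ∃[ a ]
                          (HaltsRestoring M (logSpace k) (poly k) x τ t a × (a ≡ correct L x ⊎ a ≡ dunno)))
               (half : ∀ x → ∃[ ts ] (Unique {A = Vec Bool (poly k (length x))} ts ×
                         All (λ τ → ∃[ t ] HaltsAt M (logSpace k) (poly k) x τ t (correct L x)) ts ×
                         2 ^ poly k (length x) ≤ 2 * length ts))
               (e x : ℕ) (k+2≤e : k + 2 ≤ e)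
               (graph≤ : ∀ n → 8 * suc (GraphSize.graphSize M k n) + 1 ≤ (n + 2) ^ e)
               (time≤ : ∀ n → timeBound k n (k * lg n) ((n + 2) ^ k) (2 ^ (lg n * e) ∸ 1) ≤ (n + 2) ^ x) where
  open Machine M using (start)
  open GraphSize M k using (graphSize; configs-eq)

  -- A sweep takes time linear in k′, so padding the work tape makes poly k′ outgrow the running time.
  pad : ℕ
  pad = k + 6 * e + 2 * x + 11

  open Simulate M k e pad k+2≤e using (machine; k′; module OnInput)

  -- `pad` is chosen to make the period length the even number `2 * (5 + z)`. In the exponent of the
  -- time bound one half absorbs the cost of a sweep; the other exceeds `x` by enough to absorb the
  -- number of instructions and the factor `lg n`.
  z : ℕ
  z = k + 6 * e + x + 1

  k′-eq : k′ ≡ 2 * (5 + z)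
  k′-eq = trans (length-spare k e pad) (arith (k + 6 * e) x)
    where
    arith : ∀ a x → suc ((a + 2 * x + 11) + a) ≡ 2 * (5 + (a + x + 1))
    arith = solve-∀

  time-ok : ∀ n → timeBound k n (k * lg n) ((n + 2) ^ k) (2 ^ (lg n * e) ∸ 1) * (3 + 2 * (k′ * lg n)) ≤ poly k′ n
  time-ok n = begin
    timeBound k n (k * lg n) ((n + 2) ^ k) (2 ^ (lg n * e) ∸ 1) * (3 + 2 * (k′ * lg n))
      ≤⟨ *-mono-≤ (time≤ n) sweep ⟩
    b ^ x * (b ^ (5 + z) * b ^ 2)  ≡⟨ cong (b ^ x *_) (sym (^-distribˡ-+-* b (5 + z) 2)) ⟩
    b ^ x * b ^ (5 + z + 2)        ≡⟨ sym (^-distribˡ-+-* b x (5 + z + 2)) ⟩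
    b ^ (x + (5 + z + 2))          ≤⟨ ^-monoʳ n (≤-trans (m≤m+n (x + (5 + z + 2)) (k + 6 * e + 4)) (≤-reflexive (trans (arith₂ (k + 6 * e) x) (sym k′-eq)))) ⟩
    b ^ k′                         ∎
    where
    open ≤-Reasoning
    b = n + 2
    arith₁ : ∀ w l → 3 + 2 * (2 * w * l) ≡ 3 + 4 * w * l
    arith₁ = solve-∀
    arith₂ : ∀ a x → x + (5 + (a + x + 1) + 2) + (a + 4) ≡ 2 * (5 + (a + x + 1))
    arith₂ = solve-∀
    sweep : 3 + 2 * (k′ * lg n) ≤ b ^ (5 + z) * b ^ 2
    sweep = begin
      3 + 2 * (k′ * lg n)            ≡⟨ cong (λ w → 3 + 2 * (w * lg n)) k′-eq ⟩
      3 + 2 * (2 * (5 + z) * lg n)   ≡⟨ arith₁ (5 + z) (lg n) ⟩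
      3 + 4 * (5 + z) * lg n         ≤⟨ +-monoˡ-≤ (4 * (5 + z) * lg n) (*-monoʳ-≤ 3 (1≤lg n)) ⟩
      3 * lg n + 4 * (5 + z) * lg n  ≡⟨ sym (*-distribʳ-+ (lg n) 3 (4 * (5 + z))) ⟩
      (3 + 4 * (5 + z)) * lg n       ≤⟨ *-mono-≤ (≤-trans (4z+3≤2^z z) (2^≤base^ n (5 + z))) (proj₂ pb-lg n) ⟩
      b ^ (5 + z) * b ^ 2            ∎

  room : ∀ n → ∃[ r ] (poly k′ n ≡ poly k n + suc (poly k n + r))
  room n = poly k′ n ∸ (poly k n + suc (poly k n)) , (begin-equality
    poly k′ n                                                              ≡⟨ sym (m+[n∸m]≡n fits) ⟩
    poly k n + suc (poly k n) + (poly k′ n ∸ (poly k n + suc (poly k n)))  ≡⟨ +-assoc (poly k n) (suc (poly k n)) _ ⟩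
    poly k n + suc (poly k n + (poly k′ n ∸ (poly k n + suc (poly k n))))  ∎)
    where
    open ≤-Reasoning
    N = poly k n
    1≤N : 1 ≤ N
    1≤N = ≤-trans (m^n>0 2 k) (2^≤base^ n k)
    arith₁ : ∀ N → N + (N + N) ≤ 2 * (2 * N)
    arith₁ N = ≤-trans (m≤m+n (N + (N + N)) N) (≤-reflexive (four N))
      where
      four : ∀ N → N + (N + N) + N ≡ 2 * (2 * N)
      four = solve-∀
    arith₂ : ∀ a x → 2 * (5 + (a + x + 1)) ≡ 2 + a + (10 + a + 2 * x)
    arith₂ = solve-∀
    fits : N + suc N ≤ poly k′ n
    fits = begin
      N + suc N                ≤⟨ +-monoʳ-≤ N (+-monoˡ-≤ N 1≤N) ⟩
      N + (N + N)              ≤⟨ arith₁ N ⟩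
      2 * (2 * N)              ≤⟨ *-mono-≤ (2≤n+2 n) (*-monoˡ-≤ N (2≤n+2 n)) ⟩
      (n + 2) ^ (2 + k)        ≤⟨ ^-monoʳ n (≤-trans (s≤s (s≤s (m≤m+n k (6 * e)))) (≤-trans (m≤m+n _ _) (≤-reflexive (sym (trans k′-eq (arith₂ (k + 6 * e) x)))))) ⟩
      poly k′ n                ∎

  module PerInput (xs : List Bool) where
    open OnInput xs using (answer; answer-noted; simulate; T; n; s; N)
    open Slow M xs s N T (correct L xs) (halts xs) using (result; result-ok; good?; many-good)

    goodL : List Bool → Bool
    goodL ys = does (answer ys ≟A correct L xs)

    answer-result : ∀ τ → answer (toList τ) ≡ result τ
    answer-result τ = trans (answer-noted (toList τ)) (cong (λ t → TourF.noted M T ((start , t) , zero))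
      (cong₂ _,_ (cong atL (sym (toList∘fromList xs))) (cong (λ w → atL w , atL (toList τ)) (sym (toList-replicate s false)))))

    long : 8 * suc (graphSize n) ≤ T
    long = ≤-trans (≤-reflexive (sym (m+n∸n≡m _ 1))) (∸-monoˡ-≤ 1
      (≤-trans (graph≤ n) (base^≤2^ n e)))

    enough : 3 * 2 ^ N ≤ 8 * count N (goodL ∘ toList)
    enough = subst (λ w → 3 * 2 ^ N ≤ 8 * w) (count-cong N (λ τ → cong (λ a → does (a ≟A correct L xs)) (sym (answer-result τ))))
      (let ts , u , cs , h = half xs in
       many-good ts u cs h (graphSize n) (≤-trans (≤-reflexive (configs-eq (fromList xs))) (*-monoʳ-≤ (2 ^ N) (n≤1+n _))) long)

    r : ℕ
    r = proj₁ (room n)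

    room-eq : poly k′ n ≡ N + suc (N + r)
    room-eq = proj₂ (room n)

    w₀ w₁ : Vec Bool (poly k′ n) → List Bool
    w₀ τ = List.take N (toList τ)
    w₁ τ = List.take N (List.drop (suc N) (toList τ))

    output : Vec Bool (poly k′ n) → Ans
    output τ = answer (w₀ τ) orElse answer (w₁ τ)

    runs : ∀ τ → ∃[ t ] (t ≤ poly k′ n × HaltsRestoring machine (logSpace k′) (poly k′) xs τ t (output τ))
    runs τ =
      let g , post , eq , u , e₀ , v , e₁ = windows N r room-eq τ
          t , b , h , c = simulate τ (w₀ τ) g (w₁ τ) post (trans (cong length e₀) (length-toList u)) (trans (cong length e₁) (length-toList v)) eq
      in t , ≤-trans b (time-ok n) , h , c

    answer-ok : ∀ ys (u : Vec Bool N) → ys ≡ toList u → answer ys ≡ correct L xs ⊎ answer ys ≡ dunno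
    answer-ok ys u refl = Sum.map (trans (answer-result u)) (trans (answer-result u)) (result-ok u)

    ok : ∀ τ → (answer (w₀ τ) ≡ correct L xs ⊎ answer (w₀ τ) ≡ dunno) × (answer (w₁ τ) ≡ correct L xs ⊎ answer (w₁ τ) ≡ dunno)
    ok τ = let g , post , eq , u , e₀ , v , e₁ = windows N r room-eq τ in answer-ok (w₀ τ) u e₀ , answer-ok (w₁ τ) v e₁

    output-ok : ∀ τ → output τ ≡ correct L xs ⊎ output τ ≡ dunno
    output-ok τ = by-cases (proj₁ (ok τ)) (proj₂ (ok τ))
      where
      by-cases : ∀ {a b} → a ≡ correct L xs ⊎ a ≡ dunno → b ≡ correct L xs ⊎ b ≡ dunno → a orElse b ≡ correct L xs ⊎ a orElse b ≡ dunno
      by-cases (inj₁ refl) _ = inj₁ (orElse-correct L xs _)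
      by-cases (inj₂ refl) q = q

    output-good : ∀ τ → either N r goodL τ ≡ true → output τ ≡ correct L xs
    output-good τ = by-cases (answer (w₀ τ)) (answer (w₁ τ)) (proj₁ (ok τ))
      where
      by-cases : ∀ a b → a ≡ correct L xs ⊎ a ≡ dunno →
                 does (a ≟A correct L xs) ∨ does (b ≟A correct L xs) ≡ true → a orElse b ≡ correct L xs
      by-cases a b (inj₁ refl) _ = orElse-correct L xs b
      by-cases a b (inj₂ refl) p = Sum.[ (λ e → contradiction e (dunno-incorrect L xs)) , (λ e → e) ]
        (∨-witness (dunno ≟A correct L xs) (b ≟A correct L xs) p)

    seeds : ∃[ ts ] (Unique {A = Vec Bool (poly k′ n)} ts ×
              All (λ τ → ∃[ t ] HaltsAt machine (logSpace k′) (poly k′) xs τ t (correct L xs)) ts ×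
              2 ^ poly k′ n ≤ 2 * length ts)
    seeds = trues c (either N r goodL) , trues-unique c _ , All.map (λ {τ} → halting τ) (trues-sound c (either N r goodL)) ,
            ≤-trans (either-half N r goodL room-eq enough) (≤-reflexive (cong (2 *_) (sym (length-trues c (either N r goodL)))))
      where
      c = poly k′ n
      halting : ∀ τ → either N r goodL τ ≡ true → ∃[ t ] HaltsAt machine (logSpace k′) (poly k′) xs τ t (correct L xs)
      halting τ p = let t , _ , h , _ = runs τ in t , trans h (cong just (output-good τ p))

  fast : ZPτCLP L
  fast = k′ , machine ,
    ((λ xs τ → let open PerInput xs ; t , _ , h = runs τ in t , output τ , h , output-ok τ) , (λ xs → PerInput.seeds xs)) ,
    (λ xs τ → let open PerInput xs ; t , b , h , _ = runs τ in t , output τ , b , h)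

-- The constants are chosen in an order that avoids circularity: the clock exponent `e` from the
-- size of the graph, then the exponent of the instruction count from `e`, and the padding of the
-- work tape last.
CL⇒CLP : ∀ L → ZPτCL L → ZPτCLP L
CL⇒CLP L (k , M , halts , half) = with-clock (pb-above (GraphSize.pb-graph M k) (k + 2))
  where
  with-time : ∀ e → k + 2 ≤ e → (∀ n → 8 * suc (GraphSize.graphSize M k n) + 1 ≤ (n + 2) ^ e) →
    PolyBounded (λ n → timeBound k n (k * lg n) ((n + 2) ^ k) (2 ^ (lg n * e) ∸ 1)) → ZPτCLP L
  with-time e k+2≤e graph≤ (x , time≤) = Theorem.fast L k M halts half e x k+2≤e graph≤ time≤
  with-clock : ∃[ e ] (k + 2 ≤ e × (∀ n → 8 * suc (GraphSize.graphSize M k n) + 1 ≤ (n + 2) ^ e)) → ZPτCLP L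
  with-clock (e , k+2≤e , graph≤) = with-time e k+2≤e graph≤ (pb-timeBound k e)

theorem6p6 : ∀ (L : Language) → (ZPτCL L → ZPτCLP L) × (ZPτCLP L → ZPτCL L)
theorem6p6 L = CL⇒CLP L , λ (k , M , p , _) → k , M , p
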